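{- Let $L/K$ be a finite extension, let $L_S/K$ be its maximal separable subextension, and let $A=\mathrm{Aut}(L/K)$ with fixed field $L^A$. (1) $r_K(L)=[L:L^A]$. Also $N=L^A$ is the unique intermediate field $K\subset N\subset L$ such that $L/N$ is Galois of maximum possible degree. (2) $l_K(L_S)=r_K(L_S)$, $r_{L_S}(L)=s_{L_S}(L)=1$ and $l_{L_S}(L)=[L:L_S]$. (3) $r_K(L)\cdot s_K(L)=[L_S:K]$ and $l_K(L)\cdot s_K(L)=[L:K]$. Also $[L^A:K]=[L:L_S]\cdot s_K(L)$. (4) $r_K(L)\mid r_K(L_S)$ and $s_K(L_S)\mid s_K(L)$. (5) If $L/K$ is normal, then: (a) $r_K(L_S)=[L_S:K]$ and $s_K(L_S)=1$; (b) $r_K(L)=r_K(L_S)$, $l_K(L)=[L:K]$ and $s_K(L)=1$; (c) $r_K(L^A)=s_K(L^A)=1$ and $l_K(L^A)=[L^A:K]$.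
   Context: $K$ is any field (not necessarily perfect) with a fixed algebraic closure $\bar K$; all extensions are finite and contained in $\bar K$. For any base field $E$ and finite extension $L/E$: the cluster size is $r_E(L)=|\mathrm{Aut}(L/E)|$; $s_E(L)$ is the number of distinct subfields of $\bar K$ isomorphic to $L$ over $E$; the multicluster size is $l_E(L)=[L:L']\cdot r_E(L)$, where $L'$ is the maximal separable subextension of $L/E$. -}

module Defs where

open import Level using (Level; _⊔_; suc)
open import Algebra.Apartness.Bundles using (HeytingField; HeytingCommutativeRing)
open import Algebra.Bundles using (CommutativeRing)
open import Algebra.Bundles.Raw using (RawRing)
open import Algebra.Morphism.Structures using (IsRingIsomorphism; module IsRingIsomorphism)
import Algebra.Properties.Semiring.Sum
open import Axiom.ExcludedMiddle using (ExcludedMiddle)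
open import Data.Fin.Base using (Fin)
open import Data.List.Base using (List; []; _∷_; map; foldr)
open import Data.List.Relation.Unary.All using (All)
import Data.List.Relation.Unary.Unique.Setoid as Unique
import Data.Nat.Base as ℕ
open import Data.Nat.Base using (ℕ)
open import Data.Product.Base using (Σ; ∃; ∃-syntax; _×_; _,_; proj₁)
open import Data.Sum.Base using (_⊎_)
open import Function.Bundles using (Inverse)
open import Relation.Binary.Bundles using (Setoid)
open import Relation.Binary.PropositionalEquality using (setoid)
import Relation.Binary.Reasoning.Setoid as SetoidReasoning
open import Relation.Nullary using (¬_; yes; no)
open import Relation.Unary using (Pred; _∈_; _⊆_; _≐_)

-- Field theory inside a fixed field K̄, which plays the role of an algebraic
-- closure: every field is a subfield of K̄ and every polynomial has its
-- coefficients in K̄.  In the presence of excluded middle a Heyting field is the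
-- same thing as a (classical) field, `x # y` being equivalent to `¬ x ≈ y`.
--
-- Excluded middle is used only in `choose`, i.e. to give the degree, the
-- cardinalities and the maximal separable subextension as total functions.

module FieldTheory
  {c ℓ₁ ℓ₂ : Level}
  (em : ∀ {a} → ExcludedMiddle a)
  (K̄ : HeytingField c ℓ₁ ℓ₂)
  where

  private
    u : Level
    u = c ⊔ ℓ₁

    R : CommutativeRing c ℓ₁
    R = HeytingCommutativeRing.commutativeRing (HeytingField.heytingCommutativeRing K̄)

  open CommutativeRing R
    using (_≈_; _+_; _*_; -_; 0#; 1#; refl; sym; trans; +-cong; *-cong; -‿cong
          ; *-assoc; *-comm; *-identityˡ; *-identityʳ)
    renaming (Carrier to C; setoid to C-setoid)
  open Algebra.Properties.Semiring.Sum (CommutativeRing.semiring R) using (sum)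

  -- An element satisfying P if there is one, and the default value d otherwise.
  choose : ∀ {a p} {A : Set a} → A → Pred A p → A
  choose d P with em {P = ∃ P}
  ... | yes (x , _) = x
  ... | no _        = d

  -- The number of elements of a finite setoid (0 for an infinite one).
  card : ∀ {a ℓ} → Setoid a ℓ → ℕ
  card S = choose 0 (λ n → Inverse (setoid (Fin n)) S)

  record Subfield : Set (suc u) where
    field
      mem      : Pred C u
      resp     : ∀ {x y} → x ≈ y → x ∈ mem → y ∈ mem
      0-closed : 0# ∈ mem
      1-closed : 1# ∈ mem
      +-closed : ∀ {x y} → x ∈ mem → y ∈ mem → x + y ∈ mem
      *-closed : ∀ {x y} → x ∈ mem → y ∈ mem → x * y ∈ mem
      neg-closed : ∀ {x} → x ∈ mem → - x ∈ mem
      inv-closed : ∀ {x y} → x ∈ mem → x * y ≈ 1# → y ∈ mem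

    rawRing : RawRing u ℓ₁
    rawRing = record
      { Carrier = Σ C mem
      ; _≈_ = λ x y → proj₁ x ≈ proj₁ y
      ; _+_ = λ (x , p) (y , q) → x + y , +-closed p q
      ; _*_ = λ (x , p) (y , q) → x * y , *-closed p q
      ; -_  = λ (x , p) → - x , neg-closed p
      ; 0#  = 0# , 0-closed
      ; 1#  = 1# , 1-closed
      }

  open Subfield using (mem; rawRing)

  infix 4 _≤_ _≣_

  _≤_ : Subfield → Subfield → Set u
  E ≤ L = mem E ⊆ mem L

  _≣_ : Subfield → Subfield → Set u
  E ≣ L = mem E ≐ mem L

  -- Coefficient lists, the constant coefficient first.
  Poly : Set c
  Poly = List C

  coeff : Poly → ℕ → C
  coeff []      _         = 0#
  coeff (a ∷ p) ℕ.zero    = a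
  coeff (a ∷ p) (ℕ.suc n) = coeff p n

  infix  4 _≈ₚ_
  infixl 6 _+ₚ_
  infixl 7 _*ₚ_

  -- Trailing zero coefficients are immaterial.
  _≈ₚ_ : Poly → Poly → Set ℓ₁
  p ≈ₚ q = ∀ n → coeff p n ≈ coeff q n

  _+ₚ_ : Poly → Poly → Poly
  []      +ₚ q       = q
  (a ∷ p) +ₚ []      = a ∷ p
  (a ∷ p) +ₚ (b ∷ q) = a + b ∷ p +ₚ q

  _*ₚ_ : Poly → Poly → Poly
  []      *ₚ q = []
  (a ∷ p) *ₚ q = map (a *_) q +ₚ (0# ∷ p *ₚ q)

  eval : Poly → C → C
  eval []      x = 0#
  eval (a ∷ p) x = a + x * eval p x

  ∏[X-_] : List C → Poly
  ∏[X- βs ] = foldr (λ β p → (- β ∷ 1# ∷ []) *ₚ p) (1# ∷ []) βs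

  _∈_[X] : Poly → Subfield → Set u
  p ∈ E [X] = All (_∈ mem E) p

  Constant : Poly → Set ℓ₁
  Constant p = ∀ n → coeff p (ℕ.suc n) ≈ 0#

  Monic : Poly → Set ℓ₁
  Monic p = ∃[ n ] coeff p n ≈ 1# × (∀ m → n ℕ.< m → coeff p m ≈ 0#)

  record Irreducible (E : Subfield) (f : Poly) : Set u where
    field
      over        : f ∈ E [X]
      nonconstant : ¬ Constant f
      indecomposable : ∀ g h → g ∈ E [X] → h ∈ E [X] → f ≈ₚ g *ₚ h →
                       Constant g ⊎ Constant h

  record IsMinimalPolynomial (E : Subfield) (f : Poly) (x : C) : Set u where
    field
      irreducible : Irreducible E f
      monic       : Monic f
      root        : eval f x ≈ 0#

  SplitsIn : Subfield → Poly → Set u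
  SplitsIn L f = ∃[ a ] ∃[ βs ] All (_∈ mem L) βs × f ≈ₚ map (a *_) ∏[X- βs ]

  AlgebraicElement : Subfield → C → Set u
  AlgebraicElement E x = ∃[ p ] p ∈ E [X] × ¬ (p ≈ₚ []) × eval p x ≈ 0#

  Algebraic : Subfield → Subfield → Set u
  Algebraic E L = ∀ x → x ∈ mem L → AlgebraicElement E x

  -- The field K̄ is an algebraic closure of its subfield E.
  record IsAlgebraicClosureOf (E : Subfield) : Set u where
    field
      algebraicallyClosed : ∀ p → ¬ Constant p → ∃[ x ] eval p x ≈ 0#
      algebraic           : ∀ x → AlgebraicElement E x

  record IsBasis (E L : Subfield) {n : ℕ} (b : Fin n → C) : Set u where
    field
      members     : ∀ i → b i ∈ mem L
      independent : ∀ (a : Fin n → C) → (∀ i → a i ∈ mem E) →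
                    sum (λ i → a i * b i) ≈ 0# → ∀ i → a i ≈ 0#
      spanning    : ∀ x → x ∈ mem L → Σ (Fin n → C) λ a →
                    (∀ i → a i ∈ mem E) × x ≈ sum (λ i → a i * b i)

  HasDegree : Subfield → Subfield → ℕ → Set u
  HasDegree E L n = Σ (Fin n → C) (IsBasis E L)

  IsFiniteExtension : Subfield → Subfield → Set u
  IsFiniteExtension E L = E ≤ L × ∃[ n ] HasDegree E L n

  -- For finite L/E all bases have the same size; the value is 0 otherwise.
  [_∶_] : Subfield → Subfield → ℕ
  [ L ∶ E ] = choose 0 (HasDegree E L)

  record Normal (E L : Subfield) : Set u where
    field
      algebraic : Algebraic E L
      splits    : ∀ f → Irreducible E f → ∀ x → x ∈ mem L → eval f x ≈ 0# →
                  SplitsIn L f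

  -- Over an algebraically closed K̄ every monic f is some ∏[X- βs ], so the content
  -- of the last condition is that the roots of f are distinct.
  SeparableElement : Subfield → C → Set u
  SeparableElement E x = ∃[ f ] IsMinimalPolynomial E f x ×
    (∃[ βs ] Unique.Unique C-setoid βs × f ≈ₚ ∏[X- βs ])

  Separable : Subfield → Subfield → Set u
  Separable E L = ∀ x → x ∈ mem L → SeparableElement E x

  record IsMaximalSeparable (E L M : Subfield) : Set (suc u) where
    field
      lower     : E ≤ M
      upper     : M ≤ L
      separable : Separable E M
      greatest  : ∀ N → E ≤ N → N ≤ L → Separable E N → N ≤ M

  -- Unique up to ≣ by `greatest`.  For algebraic L/E it always exists (the elements
  -- of L separable over E), so the default E is never used then.
  maximalSeparable : Subfield → Subfield → Subfield
  maximalSeparable E L = choose E (IsMaximalSeparable E L)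

  record Galois (E L : Subfield) : Set u where
    field
      normal    : Normal E L
      separable : Separable E L

  -- The isomorphisms L → M which are the identity on E (for E ≤ L; then E ≤ M).
  record Iso (E L M : Subfield) : Set u where
    field
      to                : RawRing.Carrier (rawRing L) → RawRing.Carrier (rawRing M)
      isRingIsomorphism : IsRingIsomorphism (rawRing L) (rawRing M) to
      fixes             : ∀ x → proj₁ x ∈ mem E → proj₁ (to x) ≈ proj₁ x

  Aut : Subfield → Subfield → Setoid u u
  Aut E L = record
    { Carrier = Iso E L L
    ; _≈_ = λ σ τ → ∀ x → proj₁ (Iso.to σ x) ≈ proj₁ (Iso.to τ x)
    ; isEquivalence = record
      { refl  = λ _ → refl
      ; sym   = λ p x → sym (p x)
      ; trans = λ p q x → trans (p x) (q x)
      }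
    }

  -- The subfields of K̄ isomorphic to L over E; two of them are identified when
  -- they have the same elements, whatever the isomorphisms.
  Conjugates : Subfield → Subfield → Setoid (suc u) u
  Conjugates E L = record
    { Carrier = Σ Subfield (Iso E L)
    ; _≈_ = λ M N → proj₁ M ≣ proj₁ N
    ; isEquivalence = record
      { refl  = (λ p → p) , (λ p → p)
      ; sym   = λ (p , q) → q , p
      ; trans = λ (p , q) (p′ , q′) → (λ x → p′ (p x)) , (λ x → q (q′ x))
      }
    }

  -- L^A for A = Aut(L/E).
  fixedField : Subfield → Subfield → Subfield
  fixedField E L = record
    { mem = λ x → Σ (x ∈ mem L) λ p → ∀ (σ : Iso E L L) → proj₁ (Iso.to σ (x , p)) ≈ x
    ; resp = λ x≈y (p , f) → resp x≈y p , λ σ →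
        trans (trans (⟦⟧-cong σ (sym x≈y)) (f σ)) x≈y
    ; 0-closed = 0-closed , 0#-homo
    ; 1-closed = 1-closed , 1#-homo
    ; +-closed = λ (p , f) (q , g) → +-closed p q , λ σ →
        trans (+-homo σ (_ , p) (_ , q)) (+-cong (f σ) (g σ))
    ; *-closed = λ (p , f) (q , g) → *-closed p q , λ σ →
        trans (*-homo σ (_ , p) (_ , q)) (*-cong (f σ) (g σ))
    ; neg-closed = λ (p , f) → neg-closed p , λ σ →
        trans (-‿homo σ (_ , p)) (-‿cong (f σ))
    ; inv-closed = λ (p , f) xy≈1 → inv-closed p xy≈1 , λ σ →
        inverse-unique xy≈1
          (trans (*-cong (sym (f σ)) refl)
          (trans (sym (*-homo σ (_ , p) (_ , inv-closed p xy≈1)))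
          (trans (⟦⟧-cong σ {_ , *-closed p (inv-closed p xy≈1)} {_ , 1-closed} xy≈1)
                 (1#-homo σ))))
    }
    where
    open Subfield L hiding (mem; rawRing)
    module σ (σ : Iso E L L) = IsRingIsomorphism (Iso.isRingIsomorphism σ)
    open σ using (⟦⟧-cong; 0#-homo; 1#-homo; +-homo; *-homo; -‿homo)

    inverse-unique : ∀ {x y z} → x * y ≈ 1# → x * z ≈ 1# → z ≈ y
    inverse-unique {x} {y} {z} xy≈1 xz≈1 = begin
      z           ≈⟨ *-identityˡ z ⟨
      1# * z      ≈⟨ *-cong (trans (*-comm y x) xy≈1) refl ⟨
      y * x * z   ≈⟨ *-assoc y x z ⟩
      y * (x * z) ≈⟨ *-cong refl xz≈1 ⟩
      y * 1#      ≈⟨ *-identityʳ y ⟩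
      y           ∎
      where open SetoidReasoning C-setoid

  r : Subfield → Subfield → ℕ
  r E L = card (Aut E L)

  s : Subfield → Subfield → ℕ
  s E L = card (Conjugates E L)

  l : Subfield → Subfield → ℕ
  l E L = [ L ∶ maximalSeparable E L ] ℕ.* r E L

  record IsMaximalGalois (E L N : Subfield) : Set (suc u) where
    field
      lower   : E ≤ N
      upper   : N ≤ L
      galois  : Galois N L
      maximum : ∀ N′ → E ≤ N′ → N′ ≤ L → Galois N′ L → [ L ∶ N′ ] ℕ.≤ [ L ∶ N ]

{-# OPTIONS --safe #-}
module Submission where

-- Everything is deduced from one count.  An embedding of L into K̄ over E is, uniquely, an automorphism
-- of L followed by an isomorphism of L onto one of its conjugates, so there are r E L · s E L of them.
-- If M/E is separable and every embedding of M has exactly one extension to L, there are also [M : E]: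
-- no more by Dedekind's independence of homomorphisms, and no fewer because a simple separable extension
-- has as many embeddings as its minimal polynomial has roots.  Hence
--     r E L · s E L = [M : E].
-- With M the maximal separable subextension (embeddings extend uniquely since Frobenius is injective)
-- this is (3); over E = Lᴬ, where L is Galois by its orbit polynomials, it gives r K L = [L : Lᴬ];
-- and over the fixed field of Aut(Lₛ/K) it gives the divisibilities (4).

open import Defs
open import Algebra.Apartness.Bundles using (HeytingField; HeytingCommutativeRing)
open import Algebra.Bundles using (CommutativeRing)
open import Axiom.ExcludedMiddle using (ExcludedMiddle)
open import Data.Empty using (⊥; ⊥-elim)
open import Data.Fin.Base as Fin using (Fin; zero; suc; punchIn; punchOut; combine; remQuot; _↑ˡ_; _↑ʳ_)
import Data.Fin.Properties as Fin
open import Data.List.Base as List using ([]; _∷_; map; length)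
open import Data.List.Membership.Propositional using () renaming (_∈_ to _∈ˡ_)
open import Data.List.Relation.Unary.All as All using (All; []; _∷_)
import Data.List.Relation.Unary.All.Properties as All
open import Data.List.Relation.Unary.AllPairs using ([]; _∷_)
open import Data.List.Relation.Unary.Any using (here; there)
open import Data.List.Relation.Unary.Unique.Setoid using (Unique)
open import Data.Nat.Base as ℕ using (ℕ; zero; suc)
open import Data.Nat.Induction using (<-rec)
import Data.Nat.Properties as ℕ
open import Data.Product.Base using (Σ; ∃; ∃-syntax; _×_; _,_; proj₁; proj₂; uncurry)
open import Data.Sum.Base using (_⊎_; inj₁; inj₂)
open import Data.Unit.Base using (⊤; tt)
open import Data.Vec.Functional using (Vector) renaming (_∷_ to _∷ᵥ_)
open import Level using (Level; _⊔_; Lift; lift)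
open import Relation.Binary.Definitions using (tri<; tri≈; tri>)
open import Relation.Binary.PropositionalEquality as ≡ using (_≡_)
import Relation.Binary.Reasoning.Setoid as SetoidReasoning
open import Relation.Nullary using (¬_; yes; no; contradiction)
open import Relation.Unary using (Pred; _∈_)

-- The count presupposes a maximal separable subextension, and that sums, products and inverses of
-- separable elements are separable has to be proved before one exists. It follows from a converse
-- of the count: an extension with as many embeddings as its degree consists of separable elements,
-- and this applies to `E(x, y)` because such numbers of embeddings multiply in towers. For this
-- multiplication the statements on extending embeddings start from an arbitrary embedding of the
-- base rather than from the inclusion. Fields are climbed one element at a time, by strong
-- induction on the degree, so no primitive element appears.
--
-- The functions `card` and `[_∶_]` have a default value 0, and `maximalSeparable` has a default as
-- well. Every count therefore rests on a proof that the chosen value is genuine.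
--
-- An embedding is a function on all of K̄ that respects the structure on `L` only. This keeps
-- membership proofs out of its values, and restriction to a subfield leaves the function unchanged.

-- Ring identities normalised over the integers.

module IntegerCoefficientSolver {c ℓ : Level} (R : CommutativeRing c ℓ) where

  open import Algebra.Solver.Ring.AlmostCommutativeRing
    using (fromCommutativeRing; _-Raw-AlmostCommutative⟶_)
  open import Data.Integer.Base as ℤ using (ℤ; -[1+_]; _⊖_)
  import Data.Integer.Properties as ℤ
  open import Data.Maybe.Base using (Maybe; just; nothing)
  open import Data.Nat.Base as ℕ using (ℕ; zero; suc)
  import Data.Nat.Properties as ℕ
  open import Relation.Binary.PropositionalEquality as ≡ using (_≡_)
  open import Relation.Nullary using (yes; no)

  open CommutativeRing R
  open import Algebra.Properties.Semiring.Mult.TCOptimised semiring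
    using (×-homo-+; 1+×) renaming (_×_ to _·_)
  open import Algebra.Properties.AbelianGroup +-abelianGroup
    using (ε⁻¹≈ε; ⁻¹-involutive; ⁻¹-∙-comm)
  open import Algebra.Properties.Ring ring using (-‿distribˡ-*)
  open import Relation.Binary.Reasoning.Setoid setoid

  private
    ⟦_⟧ : ℤ → Carrier
    ⟦ ℤ.+ n ⟧    = n · 1#
    ⟦ -[1+ n ] ⟧ = - (suc n · 1#)

    neg-homo : ∀ i → ⟦ ℤ.- i ⟧ ≈ - ⟦ i ⟧
    neg-homo (ℤ.+ zero)  = sym ε⁻¹≈ε
    neg-homo (ℤ.+ suc n) = refl
    neg-homo -[1+ n ]    = sym (⁻¹-involutive _)

    -- The inductive step for `_⊖_`, whose recursion strips a successor from both arguments.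
    cancel-1 : ∀ x y → x - y ≈ (1# + x) - (1# + y)
    cancel-1 x y = begin
      x - y  ≈⟨ +-identityˡ _ ⟨
      0# + (x - y)  ≈⟨ +-congʳ (-‿inverseʳ 1#) ⟨
      (1# - 1#) + (x - y)  ≈⟨ +-assoc _ _ _ ⟩
      1# + (- 1# + (x - y))  ≈⟨ +-congˡ (+-assoc _ _ _) ⟨
      1# + ((- 1# + x) - y)  ≈⟨ +-congˡ (+-congʳ (+-comm _ _)) ⟩
      1# + ((x - 1#) - y)  ≈⟨ +-congˡ (+-assoc _ _ _) ⟩
      1# + (x + (- 1# - y))  ≈⟨ +-assoc _ _ _ ⟨
      (1# + x) + (- 1# - y)  ≈⟨ +-congˡ (⁻¹-∙-comm _ _) ⟩
      (1# + x) - (1# + y)  ∎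

    ⊖-homo : ∀ m n → ⟦ m ⊖ n ⟧ ≈ m · 1# - n · 1#
    ⊖-homo m       zero    = sym (trans (+-congˡ ε⁻¹≈ε) (+-identityʳ _))
    ⊖-homo zero    (suc n) = sym (+-identityˡ _)
    ⊖-homo (suc m) (suc n) = begin
      ⟦ suc m ⊖ suc n ⟧  ≡⟨ ≡.cong ⟦_⟧ (ℤ.[1+m]⊖[1+n]≡m⊖n m n) ⟩
      ⟦ m ⊖ n ⟧  ≈⟨ ⊖-homo m n ⟩
      m · 1# - n · 1#  ≈⟨ cancel-1 _ _ ⟩
      (1# + m · 1#) - (1# + n · 1#)
        ≈⟨ +-cong (1+× m 1#) (-‿cong (1+× n 1#)) ⟨
      suc m · 1# - suc n · 1#  ∎

    +-homo : ∀ i j → ⟦ i ℤ.+ j ⟧ ≈ ⟦ i ⟧ + ⟦ j ⟧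
    +-homo (ℤ.+ m)  (ℤ.+ n)  = ×-homo-+ 1# m n
    +-homo (ℤ.+ m)  -[1+ n ] = ⊖-homo m (suc n)
    +-homo -[1+ m ] (ℤ.+ n)  = trans (⊖-homo n (suc m)) (+-comm _ _)
    +-homo -[1+ m ] -[1+ n ] = begin
      - (suc (suc (m ℕ.+ n)) · 1#) ≡⟨ ≡.cong (λ k → - (k · 1#)) (≡.sym (ℕ.+-suc (suc m) n)) ⟩
      - ((suc m ℕ.+ suc n) · 1#)  ≈⟨ -‿cong (×-homo-+ 1# (suc m) (suc n)) ⟩
      - (suc m · 1# + suc n · 1#)  ≈⟨ ⁻¹-∙-comm _ _ ⟨
      - (suc m · 1#) - suc n · 1#  ∎

    pos-*-homo : ∀ m j → ⟦ ℤ.+ m ℤ.* j ⟧ ≈ ⟦ ℤ.+ m ⟧ * ⟦ j ⟧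
    pos-*-homo zero    j = sym (zeroˡ _)
    pos-*-homo (suc m) j = begin
      ⟦ ℤ.+ suc m ℤ.* j ⟧  ≡⟨ ≡.cong ⟦_⟧ (ℤ.suc-* (ℤ.+ m) j) ⟩
      ⟦ j ℤ.+ ℤ.+ m ℤ.* j ⟧  ≈⟨ +-homo j (ℤ.+ m ℤ.* j) ⟩
      ⟦ j ⟧ + ⟦ ℤ.+ m ℤ.* j ⟧  ≈⟨ +-cong (sym (*-identityˡ _)) (pos-*-homo m j) ⟩
      1# * ⟦ j ⟧ + m · 1# * ⟦ j ⟧  ≈⟨ distribʳ _ _ _ ⟨
      (1# + m · 1#) * ⟦ j ⟧  ≈⟨ *-congʳ (1+× m 1#) ⟨
      suc m · 1# * ⟦ j ⟧  ∎

    *-homo : ∀ i j → ⟦ i ℤ.* j ⟧ ≈ ⟦ i ⟧ * ⟦ j ⟧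
    *-homo (ℤ.+ m)  j = pos-*-homo m j
    *-homo -[1+ m ] j = begin
      ⟦ -[1+ m ] ℤ.* j ⟧  ≡⟨ ≡.cong ⟦_⟧ (≡.sym (ℤ.neg-distribˡ-* (ℤ.+ suc m) j)) ⟩
      ⟦ ℤ.- (ℤ.+ suc m ℤ.* j) ⟧  ≈⟨ neg-homo (ℤ.+ suc m ℤ.* j) ⟩
      - ⟦ ℤ.+ suc m ℤ.* j ⟧  ≈⟨ -‿cong (pos-*-homo (suc m) j) ⟩
      - (suc m · 1# * ⟦ j ⟧)  ≈⟨ -‿distribˡ-* _ _ ⟩
      - (suc m · 1#) * ⟦ j ⟧  ∎

    -- Equality in `R` comes with no decision procedure; with integer coefficients the normal forms
    -- can be compared.
    homomorphism : ℤ.+-*-rawRing -Raw-AlmostCommutative⟶ fromCommutativeRing R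
    homomorphism = record
      { ⟦_⟧    = ⟦_⟧
      ; +-homo = +-homo
      ; *-homo = *-homo
      ; -‿homo = neg-homo
      ; 0-homo = refl
      ; 1-homo = refl
      }

    _coeff≟_ : ∀ i j → Maybe (⟦ i ⟧ ≈ ⟦ j ⟧)
    i coeff≟ j with i ℤ.≟ j
    ... | yes ≡.refl = just refl
    ... | no _       = nothing

  open import Algebra.Solver.Ring ℤ.+-*-rawRing (fromCommutativeRing R) homomorphism _coeff≟_
    public using (solve; _:=_; _:+_; _:*_; :-_; _:-_; con; Polynomial)

  :0 :1 : ∀ {n} → Polynomial n
  :0 = con (ℤ.+ 0)
  :1 = con (ℤ.+ 1)

-- Classical fields and linear algebra over subfields.

module Field {c ℓ₁ ℓ₂ : Level} (em : ∀ {a} → ExcludedMiddle a) (K̄ : HeytingField c ℓ₁ ℓ₂) where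
  open FieldTheory em K̄ hiding (r; s; l)

  R : CommutativeRing c ℓ₁
  R = HeytingCommutativeRing.commutativeRing (HeytingField.heytingCommutativeRing K̄)

  open CommutativeRing R hiding (zero) renaming (Carrier to C) public
  open IntegerCoefficientSolver R public
  open import Algebra.Properties.Semiring.Sum semiring public
    using (sum; sum-cong-≋; sum-replicate-zero; *-distribˡ-sum; *-distribʳ-sum; ∑-comm)
  open SetoidReasoning setoid public

  private
    u : Level
    u = c ⊔ ℓ₁

  infix 4 _≉0
  _≉0 : C → Set ℓ₁
  x ≉0 = ¬ x ≈ 0#

  x-y≈0⇒x≈y : ∀ {x y} → x - y ≈ 0# → x ≈ y
  x-y≈0⇒x≈y {x} {y} x-y≈0 = begin
    x  ≈⟨ solve 2 (λ x y → x := x :- y :+ y) refl x y ⟩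
    x - y + y  ≈⟨ +-congʳ x-y≈0 ⟩
    0# + y  ≈⟨ +-identityˡ y ⟩
    y  ∎

  x≈y⇒x-y≈0 : ∀ {x y} → x ≈ y → x - y ≈ 0#
  x≈y⇒x-y≈0 {x} {y} x≈y = trans (+-congʳ x≈y) (-‿inverseʳ y)

  choose-satisfies : ∀ {a p} {A : Set a} (d : A) (P : Pred A p) → ∃ P → P (choose d P)
  choose-satisfies d P ∃P with em {P = ∃ P}
  ... | yes (_ , Px) = Px
  ... | no ∄P        = contradiction ∃P ∄P

  by-cases : ∀ {p q} (P : Set p) {Q : Set q} → (P → Q) → (¬ P → Q) → Q
  by-cases P yes-case no-case with em {P = P}
  ... | yes p = yes-case p
  ... | no ¬p = no-case ¬p

  by-contradiction : ∀ {p} (P : Set p) → ¬ ¬ P → P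
  by-contradiction P ¬¬p = by-cases P (λ p → p) (λ ¬p → contradiction ¬p ¬¬p)

  -- Tightness turns failure of apartness from 0 into equality with 0, so excluded middle makes
  -- every nonzero element apart from 0 and hence invertible.
  inverse : ∀ {x} → x ≉0 → ∃[ y ] x * y ≈ 1#
  inverse {x} x≉0 with em {P = HeytingField._#_ K̄ x 0#}
  ... | no ¬x#0 = contradiction (proj₁ (HeytingField.tight K̄ x 0#) ¬x#0) x≉0
  ... | yes x#0 with HeytingField.#⇒invertible K̄ x#0
  ...   | y , _ , xy≈1 = y , trans (*-congʳ (solve 1 (λ x → x := x :- :0) refl x)) xy≈1

  -- In a trivial ring every element equals `1#`, so `1# - 0#` would be invertible and `1#` apart
  -- from `0#`, against irreflexivity.
  1≉0 : 1# ≉0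
  1≉0 1≈0 = HeytingField.#-irrefl K̄ 1≈0
    (HeytingField.invertible⇒# K̄ (1# , unit , unit))
    where
    unit : ∀ {x} → x ≈ 1#
    unit {x} = begin
      x  ≈⟨ *-identityʳ x ⟨
      x * 1#  ≈⟨ *-congˡ 1≈0 ⟩
      x * 0#  ≈⟨ zeroʳ x ⟩
      0#  ≈⟨ 1≈0 ⟨
      1#  ∎

  x≉0∧xy≈0⇒y≈0 : ∀ {x y} → x ≉0 → x * y ≈ 0# → y ≈ 0#
  x≉0∧xy≈0⇒y≈0 {x} {y} x≉0 xy≈0 with inverse x≉0
  ... | z , xz≈1 = begin
    y  ≈⟨ *-identityˡ y ⟨
    1# * y  ≈⟨ *-congʳ xz≈1 ⟨
    x * z * y  ≈⟨ solve 3 (λ x y z → x :* z :* y := z :* (x :* y)) refl x y z ⟩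
    z * (x * y)  ≈⟨ *-congˡ xy≈0 ⟩
    z * 0#  ≈⟨ zeroʳ z ⟩
    0#  ∎

  no-zero-divisors : ∀ {x y} → x * y ≈ 0# → x ≈ 0# ⊎ y ≈ 0#
  no-zero-divisors {x} xy≈0 with em {P = x ≈ 0#}
  ... | yes x≈0 = inj₁ x≈0
  ... | no x≉0  = inj₂ (x≉0∧xy≈0⇒y≈0 x≉0 xy≈0)

  open Subfield using (mem)

  module SubfieldProperties (E : Subfield) where
    open Subfield E public hiding (mem; rawRing)

    sub-closed : ∀ {x y} → x ∈ mem E → y ∈ mem E → x - y ∈ mem E
    sub-closed x∈E y∈E = +-closed x∈E (neg-closed y∈E)

    sum-closed : ∀ {n} {t : Vector C n} → (∀ i → t i ∈ mem E) → sum t ∈ mem E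
    sum-closed {zero}  t∈E = 0-closed
    sum-closed {suc n} t∈E = +-closed (t∈E zero) (sum-closed (λ i → t∈E (suc i)))

  -- Lets the linear algebra and the division of polynomials run with coefficients anywhere in K̄,
  -- as for systems built from values of embeddings.
  ⊤ᴱ : Subfield
  ⊤ᴱ = record
    { mem = λ _ → Lift u ⊤
    ; resp = λ _ _ → lift tt
    ; 0-closed = lift tt
    ; 1-closed = lift tt
    ; +-closed = λ _ _ → lift tt
    ; *-closed = λ _ _ → lift tt
    ; neg-closed = λ _ → lift tt
    ; inv-closed = λ _ _ → lift tt
    }

  sum-zero : ∀ {n} {t : Vector C n} → (∀ i → t i ≈ 0#) → sum t ≈ 0#
  sum-zero {n} t≈0 = trans (sum-cong-≋ t≈0) (sum-replicate-zero n)

  sum-*-assoc : ∀ {n} (p : Vector C n) y (q : Vector C n) →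
                sum (λ i → p i * (y * q i)) ≈ y * sum (λ i → p i * q i)
  sum-*-assoc p y q = trans
    (sum-cong-≋ (λ i → solve 3 (λ p y q → p :* (y :* q) := y :* (p :* q)) refl (p i) y (q i)))
    (sym (*-distribˡ-sum y (λ i → p i * q i)))

  sum-sub-scale : ∀ {n} y (p q x : Vector C n) →
    sum (λ j → (p j - y * q j) * x j) ≈ sum (λ j → p j * x j) - y * sum (λ j → q j * x j)
  sum-sub-scale {zero}  y p q x = solve 1 (λ y → :0 := :0 :- y :* :0) refl y
  sum-sub-scale {suc n} y p q x = trans
    (+-congˡ (sum-sub-scale y (λ j → p (suc j)) (λ j → q (suc j)) (λ j → x (suc j))))
    (solve 6 (λ y p q x s t → (p :- y :* q) :* x :+ (s :- y :* t)
                              := p :* x :+ s :- y :* (q :* x :+ t)) refl y _ _ _ _ _)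

  -- Gaussian elimination on the first column. If that column is zero, the first unit vector is a
  -- solution; otherwise the pivot row is used to clear the column, is deleted, and afterwards
  -- determines the first unknown. All operations stay inside `E`.
  kernel : ∀ E {m n} (A : Fin m → Fin n → C) → (∀ i j → A i j ∈ mem E) → m ℕ.< n →
           Σ (Fin n → C) λ x → (∀ j → x j ∈ mem E) × (∃[ j ] x j ≉0) ×
             (∀ i → sum (λ j → A i j * x j) ≈ 0#)
  kernel E {m} {suc n} A A∈E m<n with em {P = ∃[ i ] A i zero ≉0}
  ... | no ∄pivot = x , x∈E , (zero , 1≉0) , λ i → sum-zero (λ j → Ax≈0 i j)
    where
    open SubfieldProperties E
    x : Fin (suc n) → C
    x zero    = 1#
    x (suc _) = 0#
    x∈E : ∀ j → x j ∈ mem E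
    x∈E zero    = 1-closed
    x∈E (suc _) = 0-closed
    Ax≈0 : ∀ i j → A i j * x j ≈ 0#
    Ax≈0 i (suc j) = zeroʳ _
    Ax≈0 i zero with em {P = A i zero ≈ 0#}
    ... | yes Ai≈0 = trans (*-identityʳ _) Ai≈0
    ... | no Ai≉0  = contradiction (i , Ai≉0) ∄pivot
  kernel E {suc m} {suc n} A A∈E (ℕ.s≤s m<n) | yes (k , Ak≉0)
    with inverse Ak≉0
  ... | w , Akw≈1
    with kernel E (λ i j → A (punchIn k i) (suc j) - A (punchIn k i) zero * w * A k (suc j))
                  (λ i j → SubfieldProperties.sub-closed E (A∈E _ _)
                    (Subfield.*-closed E (Subfield.*-closed E (A∈E _ _) (Subfield.inv-closed E (A∈E _ _) Akw≈1)) (A∈E _ _)))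
                  m<n
  ...   | x′ , x′∈E , (j , x′j≉0) , A′x′≈0 = x , x∈E , (suc j , x′j≉0) , Ax≈0
    where
    open SubfieldProperties E
    S : Fin (suc m) → C
    S i = sum (λ j → A i (suc j) * x′ j)
    x : Fin (suc n) → C
    -- The value forced by the pivot row, `w` being the inverse of the pivot.
    x zero    = - (w * S k)
    x (suc j) = x′ j
    x∈E : ∀ j → x j ∈ mem E
    x∈E zero    = neg-closed (*-closed (inv-closed (A∈E _ _) Akw≈1)
                    (sum-closed (λ j → *-closed (A∈E _ _) (x′∈E j))))
    x∈E (suc j) = x′∈E j
    Ax≈0 : ∀ i → A i zero * - (w * S k) + S i ≈ 0#
    Ax≈0 i with k Fin.≟ i
    ... | yes ≡.refl = begin
      A k zero * - (w * S k) + S k ≈⟨ solve 3 (λ a w s → a :* :- (w :* s) :+ s := :- (a :* w) :* s :+ s) refl _ _ _ ⟩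
      - (A k zero * w) * S k + S k  ≈⟨ +-congʳ (*-congʳ (-‿cong Akw≈1)) ⟩
      - 1# * S k + S k  ≈⟨ solve 1 (λ s → :- :1 :* s :+ s := :0) refl _ ⟩
      0#  ∎
    ... | no k≢i = ≡.subst (λ i → A i zero * - (w * S k) + S i ≈ 0#) (Fin.punchIn-punchOut k≢i) (begin
      A i′ zero * - (w * S k) + S i′ ≈⟨ solve 4 (λ a w s t → a :* :- (w :* s) :+ t := t :- a :* w :* s) refl _ _ _ _ ⟩
      S i′ - A i′ zero * w * S k  ≈⟨ sum-sub-scale {n} _ _ _ _ ⟨
      _  ≈⟨ A′x′≈0 (punchOut k≢i) ⟩
      0#  ∎)
      where i′ = punchIn k (punchOut k≢i)

  Independent : Subfield → ∀ {n} → (Fin n → C) → Set u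
  Independent E {n} v = ∀ (a : Fin n → C) → (∀ i → a i ∈ mem E) → sum (λ i → a i * v i) ≈ 0# → ∀ i → a i ≈ 0#

  Span : Subfield → ∀ {n} → (Fin n → C) → Pred C u
  Span E {n} b x = Σ (Fin n → C) λ a → (∀ i → a i ∈ mem E) × x ≈ sum (λ i → a i * b i)

  -- The coordinate matrix has more columns than rows; a vector in its kernel is the relation, after
  -- exchanging the two sums.
  spanned-dependent : ∀ E {n k} {b : Fin n → C} {v : Fin k → C} → (∀ j → v j ∈ Span E b) → n ℕ.< k →
    Σ (Fin k → C) λ x → (∀ j → x j ∈ mem E) × (∃[ j ] x j ≉0) × sum (λ j → x j * v j) ≈ 0#
  spanned-dependent E {n} {k} {b} {v} v∈b n<k
    with kernel E (λ i j → proj₁ (v∈b j) i) (λ i j → proj₁ (proj₂ (v∈b j)) i) n<k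
  ... | x , x∈E , x≉0 , Ax≈0 = x , x∈E , x≉0 , (begin
    sum (λ j → x j * v j)
      ≈⟨ sum-cong-≋ (λ j → *-congˡ (proj₂ (proj₂ (v∈b j)))) ⟩
    sum (λ j → x j * sum (λ i → A i j * b i))
      ≈⟨ sum-cong-≋ (λ j → *-distribˡ-sum (x j) (λ i → A i j * b i)) ⟩
    sum (λ j → sum (λ i → x j * (A i j * b i)))
      ≈⟨ ∑-comm (λ j i → x j * (A i j * b i)) ⟩
    sum (λ i → sum (λ j → x j * (A i j * b i)))
      ≈⟨ sum-zero (λ i → begin
        sum (λ j → x j * (A i j * b i))
          ≈⟨ sum-cong-≋ (λ j → solve 3 (λ x a b → x :* (a :* b) := a :* x :* b) refl (x j) (A i j) (b i)) ⟩
        sum (λ j → A i j * x j * b i)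
          ≈⟨ *-distribʳ-sum (b i) (λ j → A i j * x j) ⟨
        sum (λ j → A i j * x j) * b i
          ≈⟨ *-congʳ (Ax≈0 i) ⟩
        0# * b i
          ≈⟨ zeroˡ _ ⟩
        0# ∎) ⟩
    0# ∎)
    where
    A : Fin n → Fin k → C
    A i j = proj₁ (v∈b j) i

  independent-≤ : ∀ E {n k} {b : Fin n → C} {v : Fin k → C} →
                  Independent E v → (∀ j → v j ∈ Span E b) → k ℕ.≤ n
  independent-≤ E {n} {k} ind v∈b with k ℕ.≤? n
  ... | yes k≤n = k≤n
  ... | no k≰n with spanned-dependent E v∈b (ℕ.≰⇒> k≰n)
  ...   | x , x∈E , (j , xj≉0) , Σ≈0 = contradiction (ind x x∈E Σ≈0 j) xj≉0

  ∷-independent : ∀ E {n x} {v : Fin n → C} → Independent E v → ¬ x ∈ Span E v → Independent E (x ∷ᵥ v)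
  ∷-independent E {n} {x} {v} ind x∉v a a∈E Σ≈0 with em {P = a zero ≈ 0#}
  ... | yes a₀≈0 = λ { zero → a₀≈0 ; (suc i) → ind (λ i → a (suc i)) (λ i → a∈E (suc i)) Σ′≈0 i }
    where
    Σ′≈0 : sum (λ i → a (suc i) * v i) ≈ 0#
    Σ′≈0 = begin
      sum (λ i → a (suc i) * v i) ≈⟨ solve 2 (λ x s → s := :0 :* x :+ s) refl x _ ⟩
      0# * x + sum (λ i → a (suc i) * v i)  ≈⟨ +-congʳ (*-congʳ a₀≈0) ⟨
      a zero * x + sum (λ i → a (suc i) * v i)  ≈⟨ Σ≈0 ⟩
      0#  ∎
  ... | no a₀≉0 = contradiction x∈v x∉v
    where
    open SubfieldProperties E
    w = proj₁ (inverse a₀≉0)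
    x∈v : x ∈ Span E v
    x∈v = (λ i → - w * a (suc i))
        , (λ i → *-closed (neg-closed (inv-closed (a∈E zero) (proj₂ (inverse a₀≉0)))) (a∈E (suc i)))
        , (begin
      x  ≈⟨ *-identityˡ x ⟨
      1# * x  ≈⟨ *-congʳ (proj₂ (inverse a₀≉0)) ⟨
      a zero * w * x ≈⟨ solve 4 (λ a w x s → a :* w :* x := w :* (a :* x :+ s) :+ :- w :* s) refl (a zero) w x s ⟩
      w * (a zero * x + s) + - w * s  ≈⟨ +-congʳ (*-congˡ Σ≈0) ⟩
      w * 0# + - w * s ≈⟨ solve 2 (λ w s → w :* :0 :+ s := s) refl w _ ⟩
      - w * s ≈⟨ *-distribˡ-sum (- w) (λ i → a (suc i) * v i) ⟩
      sum (λ i → - w * (a (suc i) * v i)) ≈⟨ sum-cong-≋ (λ i → *-assoc (- w) (a (suc i)) (v i)) ⟨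
      sum (λ i → - w * a (suc i) * v i)  ∎)
      where s = sum (λ i → a (suc i) * v i)

  -- Both families have `n` members, so a vector of the span of `b` missed by `v` would give `n + 1`
  -- independent vectors spanned by `n`. This is what later makes an embedding of a finite extension
  -- into itself surjective.
  independent-spans : ∀ E {n x} {b v : Fin n → C} → Independent E v → (∀ j → v j ∈ Span E b) →
                      x ∈ Span E b → x ∈ Span E v
  independent-spans E {n} {x} {b} {v} ind v∈b x∈b with em {P = x ∈ Span E v}
  ... | yes x∈v = x∈v
  ... | no x∉v = contradiction (independent-≤ E {v = x ∷ᵥ v} (∷-independent E ind x∉v) (λ { zero → x∈b ; (suc j) → v∈b j })) (ℕ.<⇒≱ ℕ.≤-refl)

  -- A maximal independent family is a basis
  bounded⇒finite : ∀ E L n →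
    (∀ {k} (v : Fin k → C) → (∀ i → v i ∈ mem L) → Independent E v → k ℕ.≤ n) →
    ∃[ m ] HasDegree E L m
  bounded⇒finite E L n bound = extend n {0} (λ ()) (λ ()) (λ _ _ _ ()) (ℕ.≤-reflexive (≡.sym (ℕ.+-identityʳ n)))
    where
    -- The invariant `n ≤ fuel + k` makes `fuel` a bound for the number of vectors that can still be
    -- added.
    extend : ∀ fuel {k} (v : Fin k → C) → (∀ i → v i ∈ mem L) → Independent E v → n ℕ.≤ fuel ℕ.+ k →
             ∃[ m ] HasDegree E L m
    extend fuel {k} v v∈L ind n≤ with em {P = ∃[ x ] x ∈ mem L × ¬ x ∈ Span E v}
    ... | no ∄x = k , v , record { members = v∈L ; independent = ind ; spanning = span }
      where
      span : ∀ x → x ∈ mem L → x ∈ Span E v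
      span x x∈L with em {P = x ∈ Span E v}
      ... | yes x∈v = x∈v
      ... | no x∉v  = contradiction (x , x∈L , x∉v) ∄x
    extend zero {k} v v∈L ind n≤ | yes (x , x∈L , x∉v) = contradiction
      (ℕ.≤-trans (bound (x ∷ᵥ v) (λ { zero → x∈L ; (suc i) → v∈L i }) (∷-independent E ind x∉v)) n≤) (ℕ.<⇒≱ ℕ.≤-refl)
    extend (suc fuel) {k} v v∈L ind n≤ | yes (x , x∈L , x∉v) =
      extend fuel (x ∷ᵥ v) (λ { zero → x∈L ; (suc i) → v∈L i }) (∷-independent E ind x∉v)
        (ℕ.≤-trans n≤ (ℕ.≤-reflexive (≡.sym (ℕ.+-suc fuel k))))

  -- Degrees and the tower law.

  degree-bound : ∀ {E L n k} {v : Fin k → C} → HasDegree E L n → (∀ i → v i ∈ mem L) →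
                 Independent E v → k ℕ.≤ n
  degree-bound {E} (b , isBasis) v∈L ind = independent-≤ E ind (λ j → IsBasis.spanning isBasis _ (v∈L j))

  degree-unique : ∀ {E L m n} → HasDegree E L m → HasDegree E L n → m ≡ n
  degree-unique d@(b , B) d′@(b′ , B′) = ℕ.≤-antisym
    (degree-bound d′ (IsBasis.members B) (IsBasis.independent B))
    (degree-bound d (IsBasis.members B′) (IsBasis.independent B′))

  [_∶_]-satisfies : ∀ {E L n} → HasDegree E L n → HasDegree E L [ L ∶ E ]
  [_∶_]-satisfies {E} {L} d = choose-satisfies 0 (HasDegree E L) (_ , d)

  [_∶_]-unique : ∀ {E L n} → HasDegree E L n → [ L ∶ E ] ≡ n
  [_∶_]-unique d = degree-unique ([_∶_]-satisfies d) d

  -- Independence over a larger field is a stronger condition.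
  intermediate-finite : ∀ {E M L n} → E ≤ M → M ≤ L → HasDegree E L n →
                        ∃ (HasDegree E M) × ∃ (HasDegree M L)
  intermediate-finite {E} {M} {L} {n} E≤M M≤L d =
    bounded⇒finite E M n (λ v v∈M ind → degree-bound d (λ i → M≤L (v∈M i)) ind) ,
    bounded⇒finite M L n (λ v v∈L ind → degree-bound d v∈L (λ a a∈E → ind a (λ i → E≤M (a∈E i))))

  sum-↑ : ∀ m {n} (t : Fin (m ℕ.+ n) → C) → sum t ≈ sum (λ i → t (i ↑ˡ n)) + sum (λ j → t (m ↑ʳ j))
  sum-↑ zero    t = sym (+-identityˡ _)
  sum-↑ (suc m) t = trans (+-congˡ (sum-↑ m (λ i → t (suc i)))) (sym (+-assoc _ _ _))

  sum-combine : ∀ m {n} (t : Fin (m ℕ.* n) → C) →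
                sum t ≈ sum (λ (j : Fin m) → sum (λ (i : Fin n) → t (combine j i)))
  sum-combine zero        t = refl
  sum-combine (suc m) {n} t = trans (sum-↑ n t) (+-congˡ (sum-combine m (λ k → t (n ↑ʳ k))))

  -- The basis consists of the products of the two bases. Regrouping by `sum-v` turns a combination
  -- of products over `E` into a combination of `w` whose coefficients, being combinations of `b`
  -- over `E`, lie in `M`.
  tower : ∀ {E M L n m} → E ≤ M → M ≤ L → HasDegree E M n → HasDegree M L m → HasDegree E L (m ℕ.* n)
  tower {E} {M} {L} {n} {m} E≤M M≤L (b , B) (w , W) = v , record
    { members     = λ k → Subfield.*-closed L (W.members _) (M≤L (B.members _))
    ; independent = λ a a∈E Σ≈0 k → ≡.subst (λ k → a k ≈ 0#) (Fin.combine-remQuot {m} n k)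
        (B.independent (λ i → a (combine (proj₁ (remQuot {m} n k)) i)) (λ _ → a∈E _)
          (W.independent (λ j → sum (λ i → a (combine j i) * b i))
            (λ j → SubfieldProperties.sum-closed M (λ i → Subfield.*-closed M (E≤M (a∈E _)) (B.members i)))
            (trans (sym (sum-v a)) Σ≈0) _) _)
    ; spanning = λ x x∈L →
        let (a , a∈M , x≈) = W.spanning x x∈L
            e j = B.spanning (a j) (a∈M j)
            a′ : Fin (m ℕ.* n) → C
            a′ = λ k → proj₁ (e (proj₁ (remQuot {m} n k))) (proj₂ (remQuot {m} n k))
        in a′ , (λ k → proj₁ (proj₂ (e _)) _) , (begin
          x  ≈⟨ x≈ ⟩
          sum (λ j → a j * w j) ≈⟨ sum-cong-≋ (λ j → *-congʳ (proj₂ (proj₂ (e j)))) ⟩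
          sum (λ j → sum (λ i → proj₁ (e j) i * b i) * w j)  ≡⟨⟩
          _ ≈⟨ sum-cong-≋ (λ j → *-congʳ (sum-cong-≋ (λ i → *-congʳ
                                                                      (reflexive (≡.sym (≡.cong (λ p → proj₁ (e (proj₁ p)) (proj₂ p)) (Fin.remQuot-combine {m} {n} j i))))))) ⟩
          sum (λ (j : Fin m) → sum (λ (i : Fin n) → a′ (combine j i) * b i) * w j) ≈⟨ sum-v a′ ⟨
          sum (λ k → a′ k * v k)  ∎)
    }
    where
    module B = IsBasis B
    module W = IsBasis W
    v : Fin (m ℕ.* n) → C
    v k = w (proj₁ (remQuot {m} n k)) * b (proj₂ (remQuot {m} n k))
    sum-v : ∀ (a : Fin (m ℕ.* n) → C) →
            sum (λ k → a k * v k) ≈ sum (λ (j : Fin m) → sum (λ (i : Fin n) → a (combine j i) * b i) * w j)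
    sum-v a = begin
      sum (λ k → a k * v k) ≈⟨ sum-combine m {n} (λ k → a k * v k) ⟩
      sum (λ (j : Fin m) → sum (λ (i : Fin n) → a (combine j i) * v (combine j i)))
        ≈⟨ sum-cong-≋ {m} (λ j → trans
             (sum-cong-≋ {n} (λ i → trans
               (*-congˡ (reflexive (≡.cong (λ p → w (proj₁ p) * b (proj₂ p)) (Fin.remQuot-combine {m} {n} j i))))
               (solve 3 (λ a w b → a :* (w :* b) := a :* b :* w) refl (a (combine j i)) (w j) (b i))))
             (sym (*-distribʳ-sum (w j) (λ i → a (combine j i) * b i)))) ⟩
      sum (λ (j : Fin m) → sum (λ (i : Fin n) → a (combine j i) * b i) * w j)  ∎

  trivial-degree : ∀ {E L} → E ≤ L → L ≤ E → HasDegree E L 1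
  trivial-degree {E} {L} E≤L L≤E = (λ _ → 1#) , record
    { members     = λ _ → Subfield.1-closed L
    ; independent = λ { a a∈E Σ≈0 zero → trans (solve 1 (λ a → a := a :* :1 :+ :0) refl _) Σ≈0 }
    ; spanning = λ x x∈L → (λ _ → x) , (λ _ → L≤E x∈L) , solve 1 (λ a → a := a :* :1 :+ :0) refl _
    }

  -- Expanding `1#` shows that the only basis vector is the inverse of an element of `E`, and so
  -- lies in `E`.
  degree-1 : ∀ {E L} → E ≤ L → HasDegree E L 1 → L ≤ E
  degree-1 {E} {L} E≤L (b , B) {x} x∈L with IsBasis.spanning B 1# (Subfield.1-closed L) | IsBasis.spanning B x x∈L
  ... | a , a∈E , 1≈ab | a′ , a′∈E , x≈a′b =
    resp (sym x≈a′b) (+-closed (*-closed (a′∈E zero)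
      (inv-closed (a∈E zero) (trans (solve 1 (λ a → a := a :+ :0) refl _) (sym 1≈ab)))) 0-closed)
    where open SubfieldProperties E

-- Arithmetic and roots of polynomials.

module Polynomials {c ℓ₁ ℓ₂ : Level} (em : ∀ {a} → ExcludedMiddle a) (K̄ : HeytingField c ℓ₁ ℓ₂) where
  open FieldTheory em K̄ hiding (r; s; l)
  open Field em K̄
  open Subfield using (mem)
  open import Algebra.Properties.Semiring.Mult semiring public
    using () renaming (_×_ to _·_; ×-congʳ to ·-congʳ)

  eval-zero : ∀ p x → p ≈ₚ [] → eval p x ≈ 0#
  eval-zero []      x p≈0 = refl
  eval-zero (a ∷ p) x p≈0 = begin
    a + x * eval p x  ≈⟨ +-cong (p≈0 0) (*-congˡ (eval-zero p x (λ n → p≈0 (suc n)))) ⟩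
    0# + x * 0#  ≈⟨ solve 1 (λ x → :0 :+ x :* :0 := :0) refl x ⟩
    0#  ∎

  eval-cong : ∀ p q {x y} → p ≈ₚ q → x ≈ y → eval p x ≈ eval q y
  eval-cong []      q       {y = y} p≈q x≈y = sym (eval-zero q y (λ n → sym (p≈q n)))
  eval-cong (a ∷ p) []      p≈q x≈y = eval-zero (a ∷ p) _ p≈q
  eval-cong (a ∷ p) (b ∷ q) p≈q x≈y =
    +-cong (p≈q 0) (*-cong x≈y (eval-cong p q (λ n → p≈q (suc n)) x≈y))

  eval-congˡ : ∀ p {x y} → x ≈ y → eval p x ≈ eval p y
  eval-congˡ p = eval-cong p p (λ _ → refl)

  eval-congʳ : ∀ p q → p ≈ₚ q → ∀ x → eval p x ≈ eval q x
  eval-congʳ p q p≈q x = eval-cong p q p≈q refl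

  coeff-+ : ∀ p q n → coeff (p +ₚ q) n ≈ coeff p n + coeff q n
  coeff-+ []      q       n       = sym (+-identityˡ _)
  coeff-+ (a ∷ p) []      n       = sym (+-identityʳ _)
  coeff-+ (a ∷ p) (b ∷ q) zero    = refl
  coeff-+ (a ∷ p) (b ∷ q) (suc n) = coeff-+ p q n

  coeff-scale : ∀ a p n → coeff (map (a *_) p) n ≈ a * coeff p n
  coeff-scale a []      n       = sym (zeroʳ a)
  coeff-scale a (b ∷ p) zero    = refl
  coeff-scale a (b ∷ p) (suc n) = coeff-scale a p n

  eval-+ : ∀ p q x → eval (p +ₚ q) x ≈ eval p x + eval q x
  eval-+ []      q       x = sym (+-identityˡ _)
  eval-+ (a ∷ p) []      x = sym (+-identityʳ _)
  eval-+ (a ∷ p) (b ∷ q) x = trans (+-congˡ (*-congˡ (eval-+ p q x)))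
    (solve 5 (λ a b x p q → (a :+ b) :+ x :* (p :+ q) := (a :+ x :* p) :+ (b :+ x :* q)) refl a b x _ _)

  eval-scale : ∀ a p x → eval (map (a *_) p) x ≈ a * eval p x
  eval-scale a []      x = sym (zeroʳ a)
  eval-scale a (b ∷ p) x = trans (+-congˡ (*-congˡ (eval-scale a p x)))
    (solve 4 (λ a b x p → a :* b :+ x :* (a :* p) := a :* (b :+ x :* p)) refl a b x _)

  eval-* : ∀ p q x → eval (p *ₚ q) x ≈ eval p x * eval q x
  eval-* []      q x = sym (zeroˡ _)
  eval-* (a ∷ p) q x = begin
    eval (map (a *_) q +ₚ (0# ∷ p *ₚ q)) x  ≈⟨ eval-+ (map (a *_) q) (0# ∷ p *ₚ q) x ⟩
    eval (map (a *_) q) x + (0# + x * eval (p *ₚ q) x) ≈⟨ +-cong (eval-scale a q x) (+-congˡ (*-congˡ (eval-* p q x))) ⟩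
    a * eval q x + (0# + x * (eval p x * eval q x)) ≈⟨ solve 4 (λ a x p q → a :* q :+ (:0 :+ x :* (p :* q)) := (a :+ x :* p) :* q) refl a x _ _ ⟩
    (a + x * eval p x) * eval q x  ∎

  infixl 6 _-ₚ_
  _-ₚ_ : Poly → Poly → Poly
  p -ₚ q = p +ₚ map (- 1# *_) q

  eval-- : ∀ p q x → eval (p -ₚ q) x ≈ eval p x - eval q x
  eval-- p q x = trans (eval-+ p _ x) (trans (+-congˡ (eval-scale (- 1#) q x))
    (solve 2 (λ a b → a :+ :- :1 :* b := a :- b) refl _ _))

  coeff-- : ∀ p q n → coeff (p -ₚ q) n ≈ coeff p n - coeff q n
  coeff-- p q n = trans (coeff-+ p _ n) (trans (+-congˡ (coeff-scale (- 1#) q n))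
    (solve 2 (λ a b → a :+ :- :1 :* b := a :- b) refl _ _))

  module _ (E : Subfield) where
    open SubfieldProperties E

    scale-closed : ∀ {a p} → a ∈ mem E → p ∈ E [X] → map (a *_) p ∈ E [X]
    scale-closed a∈E []          = []
    scale-closed a∈E (b∈E ∷ p∈E) = *-closed a∈E b∈E ∷ scale-closed a∈E p∈E

    +ₚ-closed : ∀ {p q} → p ∈ E [X] → q ∈ E [X] → (p +ₚ q) ∈ E [X]
    +ₚ-closed []          q∈E         = q∈E
    +ₚ-closed (a∈E ∷ p∈E) []          = a∈E ∷ p∈E
    +ₚ-closed (a∈E ∷ p∈E) (b∈E ∷ q∈E) = +-closed a∈E b∈E ∷ +ₚ-closed p∈E q∈E

    *ₚ-closed : ∀ {p q} → p ∈ E [X] → q ∈ E [X] → (p *ₚ q) ∈ E [X]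
    *ₚ-closed []          q∈E = []
    *ₚ-closed (a∈E ∷ p∈E) q∈E = +ₚ-closed (scale-closed a∈E q∈E) (0-closed ∷ *ₚ-closed p∈E q∈E)

    -ₚ-closed : ∀ {p q} → p ∈ E [X] → q ∈ E [X] → (p -ₚ q) ∈ E [X]
    -ₚ-closed p∈E q∈E = +ₚ-closed p∈E (scale-closed (neg-closed 1-closed) q∈E)

    coeff-closed : ∀ {p} → p ∈ E [X] → ∀ n → coeff p n ∈ mem E
    coeff-closed []          n       = 0-closed
    coeff-closed (a∈E ∷ p∈E) zero    = a∈E
    coeff-closed (a∈E ∷ p∈E) (suc n) = coeff-closed p∈E n

    eval-closed : ∀ {p x} → p ∈ E [X] → x ∈ mem E → eval p x ∈ mem E
    eval-closed []          x∈E = 0-closed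
    eval-closed (a∈E ∷ p∈E) x∈E = +-closed a∈E (*-closed x∈E (eval-closed p∈E x∈E))

  Deg< : ℕ → Poly → Set ℓ₁
  Deg< n p = ∀ m → n ℕ.≤ m → coeff p m ≈ 0#

  MonicOf : ℕ → Poly → Set ℓ₁
  MonicOf n p = coeff p n ≈ 1# × Deg< (suc n) p

  Deg<-length : ∀ p → Deg< (length p) p
  Deg<-length []      m       _           = refl
  Deg<-length (a ∷ p) (suc m) (ℕ.s≤s n≤m) = Deg<-length p m n≤m

  Deg<-weaken : ∀ {p m n} → m ℕ.≤ n → Deg< m p → Deg< n p
  Deg<-weaken m≤n p< k n≤k = p< k (ℕ.≤-trans m≤n n≤k)

  Deg<-- : ∀ {n} p q → Deg< n p → Deg< n q → Deg< n (p -ₚ q)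
  Deg<-- p q p< q< m n≤m = trans (coeff-- p q m) (x≈y⇒x-y≈0 (trans (p< m n≤m) (sym (q< m n≤m))))

  -- Horner's scheme: the quotient by `X - a`, with remainder `eval p a`. The list keeps its length,
  -- a nonempty one ending in a padding zero.
  quo : C → Poly → Poly
  quo a []      = []
  quo a (b ∷ p) = eval p a ∷ quo a p

  eval-quo : ∀ a p x → eval p x ≈ eval p a + (x - a) * eval (quo a p) x
  eval-quo a []      x = solve 2 (λ x a → :0 := :0 :+ (x :- a) :* :0) refl x a
  eval-quo a (b ∷ p) x = trans (+-congˡ (*-congˡ (eval-quo a p x)))
    (solve 5 (λ a b x p q → b :+ x :* (p :+ (x :- a) :* q) := (b :+ a :* p) :+ (x :- a) :* (p :+ x :* q))
      refl a b x _ _)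

  coeff-quo : ∀ a p n → coeff p (suc n) ≈ coeff (quo a p) n - a * coeff (quo a p) (suc n)
  coeff-quo a []          n       = solve 1 (λ a → :0 := :0 :- a :* :0) refl a
  coeff-quo a (b ∷ [])    zero    = solve 1 (λ a → :0 := :0 :- a :* :0) refl a
  coeff-quo a (b ∷ d ∷ p) zero    = solve 3 (λ a d p → d := d :+ a :* p :- a :* p) refl a d _
  coeff-quo a (b ∷ p)     (suc n) = coeff-quo a p n

  Deg<-quo : ∀ a p n → Deg< (suc n) p → Deg< n (quo a p)
  Deg<-quo a []      n       p< m       n≤m         = refl
  Deg<-quo a (b ∷ p) zero p< zero n≤m = eval-zero p a (λ m → p< (suc m) (ℕ.s≤s ℕ.z≤n))
  Deg<-quo a (b ∷ p) zero    p< (suc m) n≤m         =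
    Deg<-quo a p zero (λ k 1≤k → p< (suc k) (ℕ.s≤s ℕ.z≤n)) m ℕ.z≤n
  Deg<-quo a (b ∷ p) (suc n) p< (suc m) (ℕ.s≤s n≤m) =
    Deg<-quo a p n (λ k n<k → p< (suc k) (ℕ.s≤s n<k)) m n≤m

  root-factor : ∀ {a} p → eval p a ≈ 0# → ∀ x → eval p x ≈ (x - a) * eval (quo a p) x
  root-factor {a} p pa≈0 x = trans (eval-quo a p x) (trans (+-congʳ pa≈0) (+-identityˡ _))

  x-y≉0 : ∀ {x y} → ¬ x ≈ y → (x - y) ≉0
  x-y≉0 x≉y x-y≈0 = x≉y (x-y≈0⇒x≈y x-y≈0)

  -- Division by `X - β` lowers the degree bound and keeps the other roots, as `γ - β` is nonzero
  -- for each of them. The quotient then vanishes by induction, hence so do all higher coefficients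
  -- of `p`, and `eval p β ≈ 0#` disposes of the constant one.
  many-roots⇒zero : ∀ {βs} p → Unique setoid βs → All (λ β → eval p β ≈ 0#) βs →
                    Deg< (length βs) p → p ≈ₚ []
  many-roots⇒zero {[]}     p _            _          p< n = p< n ℕ.z≤n
  many-roots⇒zero {β ∷ βs} p (β∉βs ∷ uniq) (pβ≈0 ∷ pβs≈0) p< = zero-coeff p ≡.refl
    where
    quo≈0 : quo β p ≈ₚ []
    quo≈0 = many-roots⇒zero (quo β p) uniq
      (All.zipWith (λ {γ} (β≉γ , pγ≈0) → x≉0∧xy≈0⇒y≈0 (x-y≉0 (λ γ≈β → β≉γ (sym γ≈β)))
        (trans (sym (root-factor p pβ≈0 γ)) pγ≈0)) (β∉βs , pβs≈0))
      (Deg<-quo β p _ p<)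
    high : ∀ n → coeff p (suc n) ≈ 0#
    high n = trans (coeff-quo β p n) (trans (+-cong (quo≈0 n) (-‿cong (*-congˡ (quo≈0 (suc n)))))
      (solve 1 (λ a → :0 :- a :* :0 := :0) refl β))
    zero-coeff : ∀ q → q ≡.≡ p → p ≈ₚ []
    zero-coeff q _ (suc n) = high n
    zero-coeff []      ≡.refl zero = refl
    zero-coeff (b ∷ q) ≡.refl zero = begin
      b  ≈⟨ solve 2 (λ b a → b := b :+ a :* :0) refl b β ⟩
      b + β * 0#  ≈⟨ +-congˡ (*-congˡ (eval-zero q β high)) ⟨
      b + β * eval q β  ≈⟨ pβ≈0 ⟩
      0#  ∎

-- Factorisation over an algebraically closed field.

module ClosedField {c ℓ₁ ℓ₂ : Level} (em : ∀ {a} → ExcludedMiddle a) (K̄ : HeytingField c ℓ₁ ℓ₂)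
  {K₀ : FieldTheory.Subfield em K̄} (closure : FieldTheory.IsAlgebraicClosureOf em K̄ K₀) where
  open FieldTheory em K̄ hiding (r; s; l)
  open Field em K̄
  open Polynomials em K̄
  open IsAlgebraicClosureOf closure using (algebraicallyClosed)

  eval-const : ∀ a x → eval (a ∷ []) x ≈ a
  eval-const a x = trans (+-congˡ (zeroʳ x)) (+-identityʳ a)

  *ₚ-zeroˡ : ∀ p q → p ≈ₚ [] → p *ₚ q ≈ₚ []
  *ₚ-zeroˡ []      q p≈0 n = refl
  *ₚ-zeroˡ (a ∷ p) q p≈0 n = begin
    coeff (map (a *_) q +ₚ (0# ∷ p *ₚ q)) n  ≈⟨ coeff-+ (map (a *_) q) _ n ⟩
    coeff (map (a *_) q) n + coeff (0# ∷ p *ₚ q) n  ≈⟨ +-cong (coeff-scale a q n) (low n) ⟩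
    a * coeff q n + 0#  ≈⟨ +-congʳ (*-congʳ (p≈0 0)) ⟩
    0# * coeff q n + 0# ≈⟨ solve 1 (λ b → :0 :* b :+ :0 := :0) refl _ ⟩
    0#  ∎
    where
    low : ∀ n → coeff (0# ∷ p *ₚ q) n ≈ 0#
    low zero    = refl
    low (suc n) = *ₚ-zeroˡ p q (λ n → p≈0 (suc n)) n

  -- No leading coefficient is assumed nonzero, so the induction may pass to the tail of `p`; when
  -- the bound on `p` is 1 that tail contributes nothing.
  coeff-*-top : ∀ {m n} p q → Deg< (suc m) p → Deg< (suc n) q →
                coeff (p *ₚ q) (m ℕ.+ n) ≈ coeff p m * coeff q n × Deg< (suc (m ℕ.+ n)) (p *ₚ q)
  coeff-*-top {m} {n} []      q p< q< = sym (zeroˡ _) , λ _ _ → refl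
  coeff-*-top {m} {n} (a ∷ p) q p< q< = top m p< , high m p<
    where
    expand : ∀ k → coeff ((a ∷ p) *ₚ q) k ≈ a * coeff q k + coeff (0# ∷ p *ₚ q) k
    expand k = trans (coeff-+ (map (a *_) q) _ k) (+-congʳ (coeff-scale a q k))
    constant : Deg< 1 (a ∷ p) → p *ₚ q ≈ₚ []
    constant p< = *ₚ-zeroˡ p q (λ k → p< (suc k) (ℕ.s≤s ℕ.z≤n))
    low : Deg< 1 (a ∷ p) → ∀ k → coeff (0# ∷ p *ₚ q) k ≈ 0#
    low p< zero    = refl
    low p< (suc k) = constant p< k
    tail< : ∀ {m} → Deg< (suc (suc m)) (a ∷ p) → Deg< (suc m) p
    tail< p< k m<k = p< (suc k) (ℕ.s≤s m<k)
    top : ∀ m → Deg< (suc m) (a ∷ p) → coeff ((a ∷ p) *ₚ q) (m ℕ.+ n) ≈ coeff (a ∷ p) m * coeff q n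
    top zero    p< = trans (expand n) (trans (+-congˡ (low p< n)) (+-identityʳ _))
    top (suc m) p< = begin
      coeff ((a ∷ p) *ₚ q) (suc m ℕ.+ n)  ≈⟨ expand (suc m ℕ.+ n) ⟩
      a * coeff q (suc m ℕ.+ n) + coeff (p *ₚ q) (m ℕ.+ n) ≈⟨ +-cong (*-congˡ (q< (suc m ℕ.+ n) (ℕ.s≤s (ℕ.m≤n+m n m)))) (proj₁ (coeff-*-top p q (tail< p<) q<)) ⟩
      a * 0# + coeff p m * coeff q n ≈⟨ solve 2 (λ a b → a :* :0 :+ b := b) refl a _ ⟩
      coeff p m * coeff q n  ∎
    high : ∀ m → Deg< (suc m) (a ∷ p) → Deg< (suc (m ℕ.+ n)) ((a ∷ p) *ₚ q)
    high zero p< k n<k = trans (expand k) (trans (+-cong (*-congˡ (q< k n<k)) (low p< k))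
      (solve 1 (λ a → a :* :0 :+ :0 := :0) refl a))
    high (suc m) p< (suc k) (ℕ.s≤s n<k) = trans (expand (suc k)) (trans
      (+-cong (*-congˡ (q< (suc k) (ℕ.s≤s (ℕ.≤-trans (ℕ.m≤n+m n (suc m)) n<k)))) (proj₂ (coeff-*-top p q (tail< p<) q<) k n<k))
      (solve 1 (λ a → a :* :0 :+ :0 := :0) refl a))

  eval-∏ : ∀ β βs x → eval ∏[X- β ∷ βs ] x ≈ (x - β) * eval ∏[X- βs ] x
  eval-∏ β βs x = trans (eval-* (- β ∷ 1# ∷ []) ∏[X- βs ] x)
    (*-congʳ (solve 2 (λ b x → :- b :+ x :* (:1 :+ x :* :0) := x :- b) refl β x))

  ∏-monic : ∀ βs → MonicOf (length βs) ∏[X- βs ]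
  ∏-monic []       = refl , λ { (suc m) _ → refl }
  ∏-monic (β ∷ βs) with ∏-monic βs
  ... | lead , bound with coeff-*-top {1} (- β ∷ 1# ∷ []) ∏[X- βs ] (λ { (suc zero) (ℕ.s≤s ()) ; (suc (suc m)) _ → refl }) bound
  ...   | lead′ , bound′ = trans lead′ (trans (*-congˡ lead) (*-identityˡ 1#)) , bound′

  ∏-root : ∀ {βs β x} → β ∈ˡ βs → x ≈ β → eval ∏[X- βs ] x ≈ 0#
  ∏-root {β ∷ βs} {x = x} (here ≡.refl) x≈β = trans (eval-∏ β βs x) (trans (*-congʳ (x≈y⇒x-y≈0 x≈β)) (zeroˡ _))
  ∏-root {β ∷ βs} {x = x} (there β∈βs) x≈β = trans (eval-∏ β βs x) (trans (*-congˡ (∏-root β∈βs x≈β)) (zeroʳ _))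

  ∏-roots : ∀ βs → All (λ β → eval ∏[X- βs ] β ≈ 0#) βs
  ∏-roots βs = All.tabulate (λ β∈βs → ∏-root β∈βs refl)

  root-∏ : ∀ βs {x} → eval ∏[X- βs ] x ≈ 0# → ∃[ β ] β ∈ˡ βs × x ≈ β
  root-∏ []       {x} eq = contradiction (trans (sym (eval-const 1# x)) eq) 1≉0
  root-∏ (β ∷ βs) {x} eq = split (no-zero-divisors (trans (sym (eval-∏ β βs x)) eq))
    where
    split : x - β ≈ 0# ⊎ eval ∏[X- βs ] x ≈ 0# → ∃[ γ ] γ ∈ˡ β ∷ βs × x ≈ γ
    split (inj₁ x-β≈0) = β , here ≡.refl , x-y≈0⇒x≈y x-β≈0
    split (inj₂ eq′)   = let (γ , γ∈βs , x≈γ) = root-∏ βs eq′ in γ , there γ∈βs , x≈γ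

  -- Euclid's argument: a root of 1 + ∏[X- βs ] differs from every element of βs.
  infinite : ∀ n → ∃[ βs ] Unique setoid βs × length βs ≡ n
  infinite zero          = [] , [] , ≡.refl
  infinite (suc zero)    = 0# ∷ [] , [] ∷ [] , ≡.refl
  infinite (suc (suc n)) with infinite (suc n)
  ... | βs , uniq , len with algebraicallyClosed (∏[X- βs ] +ₚ (1# ∷ []))
          (λ const → 1≉0 (begin
            1#  ≈⟨ proj₁ (∏-monic βs) ⟨
            coeff ∏[X- βs ] (length βs)  ≡⟨ ≡.cong (coeff ∏[X- βs ]) len ⟩
            coeff ∏[X- βs ] (suc n)  ≈⟨ +-identityʳ _ ⟨
            coeff ∏[X- βs ] (suc n) + 0#  ≈⟨ coeff-+ ∏[X- βs ] (1# ∷ []) (suc n) ⟨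
            coeff (∏[X- βs ] +ₚ (1# ∷ [])) (suc n) ≈⟨ const n ⟩
            0#  ∎))
  ...   | x , root = x ∷ βs , All.tabulate (λ β∈βs x≈β → 1≉0 (begin
            1# ≈⟨ trans (+-identityˡ _) (eval-const 1# x) ⟨
            0# + (1# + x * 0#)  ≈⟨ +-congʳ (∏-root β∈βs x≈β) ⟨
            eval ∏[X- βs ] x + (1# + x * 0#)  ≈⟨ eval-+ ∏[X- βs ] (1# ∷ []) x ⟨
            eval (∏[X- βs ] +ₚ (1# ∷ [])) x  ≈⟨ root ⟩
            0#  ∎)) ∷ uniq , ≡.cong suc len

  -- K̄ is infinite, so `p -ₚ q` has as many distinct roots as it has entries. Polynomial identities
  -- can thus be checked on values, where the ring solver applies.
  poly-ext : ∀ p q → (∀ x → eval p x ≈ eval q x) → p ≈ₚ q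
  poly-ext p q eq n with infinite (length (p -ₚ q))
  ... | βs , uniq , len = x-y≈0⇒x≈y (trans (sym (coeff-- p q n))
    (many-roots⇒zero (p -ₚ q) uniq
      (All.tabulate (λ {β} _ → trans (eval-- p q β) (x≈y⇒x-y≈0 (eq β))))
      (≡.subst (λ k → Deg< k (p -ₚ q)) (≡.sym len) (Deg<-length (p -ₚ q))) n))

  *ₚ-ext : ∀ {f g h} → (∀ x → eval f x ≈ eval g x * eval h x) → f ≈ₚ g *ₚ h
  *ₚ-ext {f} {g} {h} eq = poly-ext f (g *ₚ h) (λ x → trans (eq x) (sym (eval-* g h x)))

  -- The leading terms cancel in the difference, which is left with more roots than its degree
  -- allows.
  monic-unique : ∀ {βs} f g → Unique setoid βs → MonicOf (length βs) f → MonicOf (length βs) g →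
                 All (λ β → eval f β ≈ 0#) βs → All (λ β → eval g β ≈ 0#) βs → f ≈ₚ g
  monic-unique {βs} f g uniq (f₁ , f<) (g₁ , g<) fβs≈0 gβs≈0 n =
    x-y≈0⇒x≈y (trans (sym (coeff-- f g n)) (many-roots⇒zero (f -ₚ g) uniq
      (All.zipWith (λ {β} (fβ≈0 , gβ≈0) → trans (eval-- f g β) (x≈y⇒x-y≈0 (trans fβ≈0 (sym gβ≈0)))) (fβs≈0 , gβs≈0))
      bound n))
    where
    bound : Deg< (length βs) (f -ₚ g)
    bound m n≤m with ℕ.m≤n⇒m<n∨m≡n n≤m
    ... | inj₁ n<m    = Deg<-- f g f< g< m n<m
    ... | inj₂ ≡.refl = trans (coeff-- f g m) (x≈y⇒x-y≈0 (trans f₁ (sym g₁)))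

  splitting : ∀ n f → MonicOf n f → ∃[ βs ] length βs ≡ n × f ≈ₚ ∏[X- βs ]
  splitting zero f (f₁ , f<) = [] , ≡.refl , λ { zero → f₁ ; (suc n) → f< (suc n) (ℕ.s≤s ℕ.z≤n) }
  splitting (suc n) f (f₁ , f<) with algebraicallyClosed f (λ const → 1≉0 (trans (sym f₁) (const n)))
  ... | β , root with splitting n (quo β f) (quo-lead , Deg<-quo β f (suc n) f<)
    where
    quo-lead : coeff (quo β f) n ≈ 1#
    quo-lead = begin
      coeff (quo β f) n ≈⟨ solve 2 (λ a b → a := a :- b :* :0) refl _ β ⟩
      coeff (quo β f) n - β * 0# ≈⟨ +-congˡ (-‿cong (*-congˡ (Deg<-quo β f (suc n) f< (suc n) ℕ.≤-refl))) ⟨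
      coeff (quo β f) n - β * coeff (quo β f) (suc n)  ≈⟨ coeff-quo β f n ⟨
      coeff f (suc n)  ≈⟨ f₁ ⟩
      1#  ∎
  ...   | βs , len , eq = β ∷ βs , ≡.cong suc len , poly-ext f ∏[X- β ∷ βs ] (λ x → begin
          eval f x  ≈⟨ root-factor f root x ⟩
          (x - β) * eval (quo β f) x  ≈⟨ *-congˡ (eval-congʳ (quo β f) ∏[X- βs ] eq x) ⟩
          (x - β) * eval ∏[X- βs ] x  ≈⟨ eval-∏ β βs x ⟨
          eval ∏[X- β ∷ βs ] x  ∎)

  -- Formal derivatives and multiple roots.

  -- The product rule for `a + X p` gives `p + X p′`.
  deriv : Poly → Poly
  deriv []      = []
  deriv (a ∷ p) = p +ₚ (0# ∷ deriv p)

  coeff-deriv : ∀ p n → coeff (deriv p) n ≈ suc n · coeff p (suc n)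
  coeff-deriv []      n       = trans (solve 0 (:0 := :0 :+ :0) refl) (+-congˡ (0·n n))
    where
    0·n : ∀ n → 0# ≈ n · 0#
    0·n zero    = refl
    0·n (suc n) = trans (0·n n) (sym (+-identityˡ _))
  coeff-deriv (a ∷ p) zero    = coeff-+ p (0# ∷ deriv p) zero
  coeff-deriv (a ∷ p) (suc n) = trans (coeff-+ p (0# ∷ deriv p) (suc n)) (+-congˡ (coeff-deriv p n))

  deriv-cong : ∀ {p q} → p ≈ₚ q → deriv p ≈ₚ deriv q
  deriv-cong {p} {q} p≈q n = trans (coeff-deriv p n) (trans (·-congʳ (suc n) (p≈q (suc n))) (sym (coeff-deriv q n)))

  deriv-closed : ∀ E {p} → p ∈ E [X] → deriv p ∈ E [X]
  deriv-closed E []          = []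
  deriv-closed E (a∈E ∷ p∈E) = +ₚ-closed E p∈E (Subfield.0-closed E ∷ deriv-closed E p∈E)

  Deg<-deriv : ∀ {n} p → Deg< (suc n) p → Deg< n (deriv p)
  Deg<-deriv p p< m n≤m = trans (coeff-deriv p m) (trans (·-congʳ (suc m) (p< (suc m) (ℕ.s≤s n≤m))) (sym (coeff-deriv [] m)))

  eval-deriv-+ : ∀ p q x → eval (deriv (p +ₚ q)) x ≈ eval (deriv p) x + eval (deriv q) x
  eval-deriv-+ []      q       x = sym (+-identityˡ _)
  eval-deriv-+ (a ∷ p) []      x = sym (+-identityʳ _)
  eval-deriv-+ (a ∷ p) (b ∷ q) x = begin
    eval ((p +ₚ q) +ₚ (0# ∷ deriv (p +ₚ q))) x
      ≈⟨ eval-+ (p +ₚ q) _ x ⟩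
    eval (p +ₚ q) x + (0# + x * eval (deriv (p +ₚ q)) x)
      ≈⟨ +-cong (eval-+ p q x) (+-congˡ (*-congˡ (eval-deriv-+ p q x))) ⟩
    eval p x + eval q x + (0# + x * (eval (deriv p) x + eval (deriv q) x))
      ≈⟨ solve 5 (λ x p q p′ q′ → p :+ q :+ (:0 :+ x :* (p′ :+ q′)) := p :+ (:0 :+ x :* p′) :+ (q :+ (:0 :+ x :* q′))) refl x _ _ _ _ ⟩
    eval p x + (0# + x * eval (deriv p) x) + (eval q x + (0# + x * eval (deriv q) x))
      ≈⟨ +-cong (eval-+ p _ x) (eval-+ q _ x) ⟨
    eval (deriv (a ∷ p)) x + eval (deriv (b ∷ q)) x ∎

  eval-deriv-scale : ∀ a p x → eval (deriv (map (a *_) p)) x ≈ a * eval (deriv p) x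
  eval-deriv-scale a []      x = sym (zeroʳ a)
  eval-deriv-scale a (b ∷ p) x = begin
    eval (map (a *_) p +ₚ (0# ∷ deriv (map (a *_) p))) x
      ≈⟨ eval-+ (map (a *_) p) _ x ⟩
    eval (map (a *_) p) x + (0# + x * eval (deriv (map (a *_) p)) x)
      ≈⟨ +-cong (eval-scale a p x) (+-congˡ (*-congˡ (eval-deriv-scale a p x))) ⟩
    a * eval p x + (0# + x * (a * eval (deriv p) x))
      ≈⟨ solve 4 (λ a x p p′ → a :* p :+ (:0 :+ x :* (a :* p′)) := a :* (p :+ (:0 :+ x :* p′))) refl a x _ _ ⟩
    a * (eval p x + (0# + x * eval (deriv p) x))
      ≈⟨ *-congˡ (eval-+ p _ x) ⟨
    a * eval (deriv (b ∷ p)) x ∎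

  eval-deriv-* : ∀ p q x →
    eval (deriv (p *ₚ q)) x ≈ eval (deriv p) x * eval q x + eval p x * eval (deriv q) x
  eval-deriv-* []      q x = solve 2 (λ q q′ → :0 := :0 :* q :+ :0 :* q′) refl _ _
  eval-deriv-* (a ∷ p) q x = begin
    eval (deriv (map (a *_) q +ₚ (0# ∷ p *ₚ q))) x
      ≈⟨ eval-deriv-+ (map (a *_) q) (0# ∷ p *ₚ q) x ⟩
    eval (deriv (map (a *_) q)) x + eval (p *ₚ q +ₚ (0# ∷ deriv (p *ₚ q))) x
      ≈⟨ +-cong (eval-deriv-scale a q x) (trans (eval-+ (p *ₚ q) _ x) (+-cong (eval-* p q x) (+-congˡ (*-congˡ (eval-deriv-* p q x))))) ⟩
    a * eval (deriv q) x + (eval p x * eval q x + (0# + x * (eval (deriv p) x * eval q x + eval p x * eval (deriv q) x)))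
      ≈⟨ solve 6 (λ a x p p′ q q′ → a :* q′ :+ (p :* q :+ (:0 :+ x :* (p′ :* q :+ p :* q′)))
           := (p :+ (:0 :+ x :* p′)) :* q :+ (a :+ x :* p) :* q′) refl a x _ _ _ _ ⟩
    (eval p x + (0# + x * eval (deriv p) x)) * eval q x + (a + x * eval p x) * eval (deriv q) x
      ≈⟨ +-congʳ (*-congʳ (eval-+ p _ x)) ⟨
    eval (deriv (a ∷ p)) x * eval q x + eval (a ∷ p) x * eval (deriv q) x ∎

  CommonRoot : Poly → C → Set ℓ₁
  CommonRoot f x = eval f x ≈ 0# × eval (deriv f) x ≈ 0#

  -- Over an algebraically closed field this excludes multiple roots. It refers to no list of roots,
  -- and so passes readily to factors and to images under embeddings.
  Squarefree : Poly → Set (c ⊔ ℓ₁)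
  Squarefree f = ∀ x → ¬ CommonRoot f x

  commonRoot-cong : ∀ {f g x} → f ≈ₚ g → CommonRoot f x → CommonRoot g x
  commonRoot-cong {f} {g} {x} f≈g (root , root′) =
    trans (sym (eval-congʳ f g f≈g x)) root ,
    trans (sym (eval-congʳ (deriv f) (deriv g) (deriv-cong {f} {g} f≈g) x)) root′

  commonRoot-*ʳ : ∀ g h {x} → CommonRoot h x → CommonRoot (g *ₚ h) x
  commonRoot-*ʳ g h {x} (root , root′) =
    trans (eval-* g h x) (trans (*-congˡ root) (zeroʳ _)) ,
    trans (eval-deriv-* g h x) (trans (+-cong (*-congˡ root) (*-congˡ root′))
      (solve 2 (λ a b → a :* :0 :+ b :* :0 := :0) refl _ _))

  eval-deriv-∏ : ∀ β βs x →
    eval (deriv ∏[X- β ∷ βs ]) x ≈ eval ∏[X- βs ] x + (x - β) * eval (deriv ∏[X- βs ]) x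
  eval-deriv-∏ β βs x = begin
    eval (deriv ((- β ∷ 1# ∷ []) *ₚ P)) x
      ≈⟨ eval-deriv-* (- β ∷ 1# ∷ []) P x ⟩
    ((1# + 0#) + x * (0# + x * 0#)) * eval P x + (- β + x * (1# + x * 0#)) * eval (deriv P) x
      ≈⟨ linear (eval P x) (eval (deriv P) x) ⟩
    eval P x + (x - β) * eval (deriv P) x ∎
    where
    P = ∏[X- βs ]
    linear : ∀ p p′ → ((1# + 0#) + x * (0# + x * 0#)) * p + (- β + x * (1# + x * 0#)) * p′ ≈ p + (x - β) * p′
    linear = solve 4 (λ b x p p′ → ((:1 :+ :0) :+ x :* (:0 :+ x :* :0)) :* p :+ (:- b :+ x :* (:1 :+ x :* :0)) :* p′
                           := p :+ (x :- b) :* p′) refl β x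

  -- At `β` the derivative equals the product of the remaining factors, so a common root there would
  -- repeat `β` among `βs`; away from `β` the factor `x - β` can be cancelled.
  unique⇒squarefree : ∀ {βs} → Unique setoid βs → Squarefree ∏[X- βs ]
  unique⇒squarefree {[]} _ x (root , _) = 1≉0 (trans (sym (eval-const 1# x)) root)
  unique⇒squarefree {β ∷ βs} (β∉βs ∷ uniq) x (root , root′) with em {P = x ≈ β}
  ... | no x≉β = unique⇒squarefree uniq x (rest , x≉0∧xy≈0⇒y≈0 (x-y≉0 x≉β) (begin
    (x - β) * eval (deriv ∏[X- βs ]) x  ≈⟨ +-identityˡ _ ⟨
    0# + (x - β) * eval (deriv ∏[X- βs ]) x  ≈⟨ +-congʳ rest ⟨
    eval ∏[X- βs ] x + (x - β) * eval (deriv ∏[X- βs ]) x  ≈⟨ eval-deriv-∏ β βs x ⟨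
    eval (deriv ∏[X- β ∷ βs ]) x  ≈⟨ root′ ⟩
    0#  ∎))
    where
    rest : eval ∏[X- βs ] x ≈ 0#
    rest = x≉0∧xy≈0⇒y≈0 (x-y≉0 x≉β) (trans (sym (eval-∏ β βs x)) root)
  ... | yes x≈β = let (γ , γ∈βs , x≈γ) = root-∏ βs rest in All.lookup β∉βs γ∈βs (trans (sym x≈β) x≈γ)
    where
    rest : eval ∏[X- βs ] x ≈ 0#
    rest = begin
      eval ∏[X- βs ] x  ≈⟨ +-identityʳ _ ⟨
      eval ∏[X- βs ] x + 0#  ≈⟨ +-congˡ (zeroˡ _) ⟨
      eval ∏[X- βs ] x + 0# * eval (deriv ∏[X- βs ]) x ≈⟨ +-congˡ (*-congʳ (x≈y⇒x-y≈0 x≈β)) ⟨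
      eval ∏[X- βs ] x + (x - β) * eval (deriv ∏[X- βs ]) x  ≈⟨ eval-deriv-∏ β βs x ⟨
      eval (deriv ∏[X- β ∷ βs ]) x  ≈⟨ root′ ⟩
      0#  ∎

  squarefree⇒unique : ∀ βs → Squarefree ∏[X- βs ] → Unique setoid βs
  squarefree⇒unique []       sqf = []
  squarefree⇒unique (β ∷ βs) sqf = All.tabulate distinct ∷
    squarefree⇒unique βs (λ x common → sqf x (commonRoot-*ʳ (- β ∷ 1# ∷ []) ∏[X- βs ] common))
    where
    distinct : ∀ {γ} → γ ∈ˡ βs → ¬ β ≈ γ
    distinct γ∈βs β≈γ = sqf β (∏-root {β ∷ βs} (here ≡.refl) refl ,
      trans (eval-deriv-∏ β βs β) (trans (+-cong (∏-root γ∈βs β≈γ) (*-congʳ (-‿inverseʳ β)))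
        (solve 1 (λ a → :0 :+ :0 :* a := :0) refl _)))

  squarefree-splitting : ∀ {n} f → MonicOf n f → Squarefree f →
    ∃[ βs ] Unique setoid βs × length βs ≡ n × f ≈ₚ ∏[X- βs ]
  squarefree-splitting {n} f monic sqf with splitting n f monic
  ... | βs , len , eq = βs ,
    squarefree⇒unique βs (λ x common → sqf x (commonRoot-cong {∏[X- βs ]} {f} (λ n → sym (eq n)) common)) , len , eq

-- Minimal polynomials and separable elements.

module MinimalPolynomials {c ℓ₁ ℓ₂ : Level} (em : ∀ {a} → ExcludedMiddle a) (K̄ : HeytingField c ℓ₁ ℓ₂)
  {K₀ : FieldTheory.Subfield em K̄} (closure : FieldTheory.IsAlgebraicClosureOf em K̄ K₀) where
  open FieldTheory em K̄ hiding (r; s; l)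
  open Field em K̄
  open Polynomials em K̄
  open ClosedField em K̄ closure

  least : ∀ {a} {P : ℕ → Set a} → ∃ P → ∃[ n ] P n × (∀ k → k ℕ.< n → ¬ P k)
  least {P = P} (n , Pn) = <-rec (λ n → P n → ∃[ n ] P n × (∀ k → k ℕ.< n → ¬ P k)) step n Pn
    where
    step : ∀ n → (∀ {k} → k ℕ.< n → P k → ∃[ n ] P n × (∀ k → k ℕ.< n → ¬ P k)) →
           P n → ∃[ n ] P n × (∀ k → k ℕ.< n → ¬ P k)
    step n rec Pn with em {P = ∃[ k ] k ℕ.< n × P k}
    ... | yes (k , k<n , Pk) = rec k<n Pk
    ... | no ∄k              = n , Pn , λ k k<n Pk → ∄k (k , k<n , Pk)

  HasDeg : ℕ → Poly → Set ℓ₁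
  HasDeg n p = coeff p n ≉0 × Deg< (suc n) p

  zero-or-degree : ∀ p → p ≈ₚ [] ⊎ ∃[ n ] HasDeg n p
  zero-or-degree []      = inj₁ (λ _ → refl)
  zero-or-degree (a ∷ p) with zero-or-degree p
  ... | inj₂ (n , lead , p<) = inj₂ (suc n , lead , λ { (suc m) (ℕ.s≤s n<m) → p< m n<m })
  ... | inj₁ p≈0 with em {P = a ≈ 0#}
  ...   | yes a≈0 = inj₁ λ { zero → a≈0 ; (suc n) → p≈0 n }
  ...   | no a≉0  = inj₂ (0 , a≉0 , λ { (suc m) _ → p≈0 m })

  monic⇒hasDeg : ∀ {n p} → MonicOf n p → HasDeg n p
  monic⇒hasDeg (lead , p<) = (λ lead≈0 → 1≉0 (trans (sym lead) lead≈0)) , p<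

  hasDeg-unique : ∀ {m n} p q → p ≈ₚ q → HasDeg m p → HasDeg n q → m ≡ n
  hasDeg-unique {m} {n} p q p≈q (pₘ≉0 , p<) (qₙ≉0 , q<) with ℕ.<-cmp m n
  ... | tri< m<n _ _ = contradiction (trans (sym (p≈q n)) (p< n m<n)) qₙ≉0
  ... | tri≈ _ m≡n _ = m≡n
  ... | tri> _ _ n<m = contradiction (trans (p≈q m) (q< m n<m)) pₘ≉0

  hasDeg-* : ∀ {m n} p q → HasDeg m p → HasDeg n q → HasDeg (m ℕ.+ n) (p *ₚ q)
  hasDeg-* p q (pₘ≉0 , p<) (qₙ≉0 , q<) =
    (λ eq → qₙ≉0 (x≉0∧xy≈0⇒y≈0 pₘ≉0 (trans (sym (proj₁ (coeff-*-top p q p< q<))) eq))) ,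
    proj₂ (coeff-*-top p q p< q<)

  hasDeg-0⇒constant : ∀ {p} → HasDeg 0 p → Constant p
  hasDeg-0⇒constant (_ , p<) n = p< (suc n) (ℕ.s≤s ℕ.z≤n)

  eval-constant : ∀ p x → Constant p → eval p x ≈ coeff p 0
  eval-constant []      x const = refl
  eval-constant (a ∷ p) x const = trans (+-congˡ (*-congˡ (eval-zero p x const)))
    (trans (+-congˡ (zeroʳ x)) (+-identityʳ a))

  -- If `t` is the remainder of `p`, then `a + X t` has degree at most `d`, and subtracting its
  -- coefficient at `d` times the monic `f` lowers the degree again.
  division : ∀ E {d f} → f ∈ E [X] → MonicOf d f → ∀ {p} → p ∈ E [X] →
    ∃[ q ] ∃[ t ] q ∈ E [X] × t ∈ E [X] × Deg< d t × (∀ x → eval p x ≈ eval q x * eval f x + eval t x)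
  division E {d} {f} f∈E (f₁ , f<) []  = [] , [] , [] , [] , (λ _ _ → refl) ,
    λ x → solve 1 (λ f → :0 := :0 :* f :+ :0) refl (eval f x)
  division E {d} {f} f∈E (f₁ , f<) {a ∷ p} (a∈E ∷ p∈E) =
    let (q , t , q∈E , t∈E , t< , eq) = division E f∈E (f₁ , f<) p∈E
        at = a ∷ t
        k  = coeff at d
        at< : Deg< (suc d) at
        at< = λ { (suc m) (ℕ.s≤s d≤m) → t< m d≤m }
        k∈E = coeff-closed E (a∈E ∷ t∈E) d
    in k ∷ q , at -ₚ map (k *_) f , k∈E ∷ q∈E , -ₚ-closed E (a∈E ∷ t∈E) (scale-closed E k∈E f∈E)
     , (λ m d≤m → trans (coeff-- at (map (k *_) f) m) (trans (+-congˡ (-‿cong (coeff-scale k f m))) (bound at at< m d≤m)))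
     , (λ x → trans (+-congˡ (*-congˡ (eq x))) (trans (rearrange a x (eval q x) (eval f x) (eval t x) k)
         (+-congˡ (sym (trans (eval-- at (map (k *_) f) x) (+-congˡ (-‿cong (eval-scale k f x))))))))
    where
    bound : ∀ at → Deg< (suc d) at → ∀ m → d ℕ.≤ m → coeff at m - coeff at d * coeff f m ≈ 0#
    bound at at< m d≤m with ℕ.m≤n⇒m<n∨m≡n d≤m
    ... | inj₂ ≡.refl = trans (+-congˡ (-‿cong (*-congˡ f₁))) (solve 1 (λ a → a :- a :* :1 := :0) refl _)
    ... | inj₁ d<m = trans (+-cong (at< m d<m) (-‿cong (*-congˡ (f< m d<m)))) (solve 1 (λ a → :0 :- a :* :0 := :0) refl _)
    rearrange : ∀ a x q f t k → a + x * (q * f + t) ≈ (k + x * q) * f + (a + x * t - k * f)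
    rearrange = solve 6 (λ a x q f t k → a :+ x :* (q :* f :+ t) := (k :+ x :* q) :* f :+ (a :+ x :* t :- k :* f)) refl

  -- The minimal polynomial described by least degree instead of irreducibility. In this form the
  -- powers of `x` below `d` are independent at once, and the degree is available as an index.
  record IsMin (E : Subfield) (f : Poly) (x : C) (d : ℕ) : Set (c ⊔ ℓ₁) where
    field
      over    : f ∈ E [X]
      monic   : MonicOf d f
      root    : eval f x ≈ 0#
      minimal : ∀ {g} → g ∈ E [X] → Deg< d g → eval g x ≈ 0# → g ≈ₚ []

  normalise : ∀ E {g n} → g ∈ E [X] → HasDeg n g → ∃[ w ] map (w *_) g ∈ E [X] × MonicOf n (map (w *_) g)
  normalise E {g} {n} g∈E (gₙ≉0 , g<) =
    let (w , gₙw≈1) = inverse gₙ≉0 in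
    w , scale-closed E (Subfield.inv-closed E (coeff-closed E g∈E n) gₙw≈1) g∈E
      , trans (coeff-scale w g n) (trans (*-comm _ _) gₙw≈1)
      , λ m n<m → trans (coeff-scale w g m) (trans (*-congˡ (g< m n<m)) (zeroʳ w))

  -- The degree is minimised over the monic polynomials vanishing at `x`; a nonzero one of smaller
  -- degree could be normalised to a monic one.
  isMin-exists : ∀ E {x} → AlgebraicElement E x → ∃[ f ] ∃[ d ] IsMin E f x d
  isMin-exists E {x} (p , p∈E , p≉0 , px≈0) =
    let (d , (f , f∈E , f-monic , fx≈0) , min) = least (some p∈E p≉0 px≈0) in
    f , d , record { over = f∈E ; monic = f-monic ; root = fx≈0
                   ; minimal = λ {g} g∈E g< gx≈0 → minimal d min g g∈E g< gx≈0 (zero-or-degree g) }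
    where
    MonicRoot : ℕ → Set (c ⊔ ℓ₁)
    MonicRoot d = ∃[ f ] f ∈ E [X] × MonicOf d f × eval f x ≈ 0#
    from-degree : ∀ {g n} → g ∈ E [X] → HasDeg n g → eval g x ≈ 0# → MonicRoot n
    from-degree {g} g∈E deg gx≈0 = let (w , wg∈E , monic) = normalise E g∈E deg in
      map (w *_) g , wg∈E , monic , trans (eval-scale w g x) (trans (*-congˡ gx≈0) (zeroʳ w))
    some : ∀ {p} → p ∈ E [X] → ¬ p ≈ₚ [] → eval p x ≈ 0# → ∃ MonicRoot
    some {p} p∈E p≉0 px≈0 with zero-or-degree p
    ... | inj₁ p≈0       = contradiction p≈0 p≉0
    ... | inj₂ (n , deg) = n , from-degree p∈E deg px≈0
    minimal : ∀ d → (∀ k → k ℕ.< d → ¬ MonicRoot k) → ∀ g → g ∈ E [X] → Deg< d g → eval g x ≈ 0# →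
              g ≈ₚ [] ⊎ (∃[ n ] HasDeg n g) → g ≈ₚ []
    minimal d min g g∈E g< gx≈0 (inj₁ g≈0) = g≈0
    minimal d min g g∈E g< gx≈0 (inj₂ (n , gₙ≉0 , g<′)) with n ℕ.<? d
    ... | yes n<d = contradiction (from-degree g∈E (gₙ≉0 , g<′) gx≈0) (min n n<d)
    ... | no n≮d  = contradiction (g< n (ℕ.≮⇒≥ n≮d)) gₙ≉0

  isMin⇒algebraic : ∀ {E f x d} → IsMin E f x d → AlgebraicElement E x
  isMin⇒algebraic {f = f} {d = d} m = f , over , (λ f≈0 → 1≉0 (trans (sym (proj₁ monic)) (f≈0 d))) , root
    where open IsMin m

  isMin-divides : ∀ {E f x d g} → IsMin E f x d → g ∈ E [X] → eval g x ≈ 0# →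
                  ∃[ q ] q ∈ E [X] × (∀ y → eval g y ≈ eval q y * eval f y)
  isMin-divides {E} {f} {x} {d} {g} m g∈E gx≈0 =
    let (q , t , q∈E , t∈E , t< , eq) = division E over monic g∈E
        t≈0 : t ≈ₚ []
        t≈0 = minimal t∈E t< (begin
          eval t x  ≈⟨ +-identityˡ _ ⟨
          0# + eval t x  ≈⟨ +-congʳ (trans (*-congˡ root) (zeroʳ _)) ⟨
          eval q x * eval f x + eval t x  ≈⟨ eq x ⟨
          eval g x  ≈⟨ gx≈0 ⟩
          0#  ∎)
    in q , q∈E , λ y → trans (eq y) (trans (+-congˡ (eval-zero t y t≈0)) (+-identityʳ _))
    where open IsMin m

  isMin-positive : ∀ {E f x d} → IsMin E f x d → ¬ d ≡ 0
  isMin-positive {f = f} {x} m ≡.refl = 1≉0 (begin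
    1#  ≈⟨ proj₁ monic ⟨
    coeff f 0  ≈⟨ eval-constant f x (λ n → proj₂ monic (suc n) (ℕ.s≤s ℕ.z≤n)) ⟨
    eval f x  ≈⟨ root ⟩
    0#  ∎)
    where open IsMin m

  isMin⇒¬constant : ∀ {E f x d} → IsMin E f x d → ¬ Constant f
  isMin⇒¬constant {d = zero}  m const = isMin-positive m ≡.refl
  isMin⇒¬constant {d = suc d} m const = 1≉0 (trans (sym (proj₁ (IsMin.monic m))) (const d))

  -- One of the two factors vanishes at `x`. By minimality its degree is already `d`, which leaves
  -- degree 0 for the other.
  isMin⇒irreducible : ∀ {E f x d} → IsMin E f x d → Irreducible E f
  isMin⇒irreducible {E} {f} {x} {d} m = record
    { over = over
    ; nonconstant = isMin⇒¬constant m
    ; indecomposable = λ g h g∈E h∈E f≈gh → decompose g∈E h∈E f≈gh (zero-or-degree g) (zero-or-degree h)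
    }
    where
    open IsMin m
    vanish : ∀ {g a b} → g ∈ E [X] → HasDeg a g → a ℕ.+ b ≡ d → eval g x ≈ 0# → b ≡ 0
    vanish {b = zero}  g∈E (gₐ≉0 , g<) ≡.refl gx≈0 = ≡.refl
    vanish {g} {a} {suc b} g∈E (gₐ≉0 , g<) ≡.refl gx≈0 = contradiction
      (minimal {g} g∈E (Deg<-weaken {g} (ℕ.≤-trans (ℕ.m≤m+n (suc a) b) (ℕ.≤-reflexive (≡.sym (ℕ.+-suc a b)))) g<) gx≈0 a) gₐ≉0
    decompose : ∀ {g h} → g ∈ E [X] → h ∈ E [X] → f ≈ₚ g *ₚ h →
                g ≈ₚ [] ⊎ (∃[ n ] HasDeg n g) → h ≈ₚ [] ⊎ (∃[ n ] HasDeg n h) → Constant g ⊎ Constant h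
    decompose g∈E h∈E f≈gh (inj₁ g≈0) _ = inj₁ (λ n → g≈0 (suc n))
    decompose g∈E h∈E f≈gh (inj₂ _) (inj₁ h≈0) = inj₂ (λ n → h≈0 (suc n))
    decompose {g} {h} g∈E h∈E f≈gh (inj₂ (a , deg-g)) (inj₂ (b , deg-h)) =
      split (no-zero-divisors (trans (sym (trans (eval-congʳ f (g *ₚ h) f≈gh x) (eval-* g h x))) root))
      where
      a+b≡d : a ℕ.+ b ≡ d
      a+b≡d = hasDeg-unique (g *ₚ h) f (λ n → sym (f≈gh n)) (hasDeg-* g h deg-g deg-h) (monic⇒hasDeg {p = f} monic)
      split : eval g x ≈ 0# ⊎ eval h x ≈ 0# → Constant g ⊎ Constant h
      split (inj₁ gx≈0) = inj₂ (hasDeg-0⇒constant {h} (≡.subst (λ n → HasDeg n h) (vanish g∈E deg-g a+b≡d gx≈0) deg-h))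
      split (inj₂ hx≈0) = inj₁ (hasDeg-0⇒constant {g} (≡.subst (λ n → HasDeg n g)
        (vanish h∈E deg-h (≡.trans (ℕ.+-comm b a) a+b≡d) hx≈0) deg-g))

  -- The minimal polynomial divides `f` and is not constant, so irreducibility makes the quotient
  -- constant.
  irreducible-associate : ∀ {E f g x d} → Irreducible E f → eval f x ≈ 0# → IsMin E g x d →
                          ∃[ a ] f ≈ₚ map (a *_) g
  irreducible-associate {E} {f} {g} {x} irr fx≈0 m =
    let (q , q∈E , eq) = isMin-divides m (Irreducible.over irr) fx≈0
    in split q eq (Irreducible.indecomposable irr q g q∈E (IsMin.over m) (*ₚ-ext {f} {q} {g} eq))
    where
    split : ∀ q → (∀ y → eval f y ≈ eval q y * eval g y) → Constant q ⊎ Constant g → ∃[ a ] f ≈ₚ map (a *_) g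
    split q eq (inj₁ const) = coeff q 0 , poly-ext f (map (coeff q 0 *_) g) (λ y →
      trans (eq y) (trans (*-congʳ (eval-constant q y const)) (sym (eval-scale (coeff q 0) g y))))
    split q eq (inj₂ const) = contradiction const (isMin⇒¬constant m)

  minimalPolynomial-unique : ∀ {E f g x d} → IsMinimalPolynomial E f x → IsMin E g x d → f ≈ₚ g
  minimalPolynomial-unique {E} {f} {g} {x} {d} mp m =
    let (a , f≈ag) = irreducible-associate irreducible root m
        (n , fₙ≈1 , f<) = monic
        (g₁ , g<) = IsMin.monic m
        a≉0 : a ≉0
        a≉0 = λ a≈0 → 1≉0 (begin
          1#  ≈⟨ fₙ≈1 ⟨
          coeff f n  ≈⟨ f≈ag n ⟩
          coeff (map (a *_) g) n  ≈⟨ coeff-scale a g n ⟩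
          a * coeff g n  ≈⟨ *-congʳ a≈0 ⟩
          0# * coeff g n  ≈⟨ zeroˡ _ ⟩
          0#  ∎)
        ag-deg : HasDeg d (map (a *_) g)
        ag-deg = (λ eq → 1≉0 (trans (sym g₁) (x≉0∧xy≈0⇒y≈0 a≉0 (trans (sym (coeff-scale a g d)) eq))))
               , (λ k d<k → trans (coeff-scale a g k) (trans (*-congˡ (g< k d<k)) (zeroʳ a)))
        n≡d = hasDeg-unique f (map (a *_) g) f≈ag (monic⇒hasDeg {n} {f} (fₙ≈1 , f<)) ag-deg
        a≈1 : a ≈ 1#
        a≈1 = begin
          a  ≈⟨ *-identityʳ a ⟨
          a * 1#  ≈⟨ *-congˡ g₁ ⟨
          a * coeff g d  ≈⟨ coeff-scale a g d ⟨
          coeff (map (a *_) g) d  ≈⟨ f≈ag d ⟨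
          coeff f d  ≡⟨ ≡.cong (coeff f) n≡d ⟨
          coeff f n  ≈⟨ fₙ≈1 ⟩
          1#  ∎
    in λ k → trans (f≈ag k) (trans (coeff-scale a g k) (trans (*-congʳ a≈1) (*-identityˡ _)))
    where open IsMinimalPolynomial mp

  isMin⇒minimalPolynomial : ∀ {E f x d} → IsMin E f x d → IsMinimalPolynomial E f x
  isMin⇒minimalPolynomial {d = d} m = record
    { irreducible = isMin⇒irreducible m ; monic = d , IsMin.monic m ; root = IsMin.root m }

  -- The minimal polynomial of `y` divides `f`, which is irreducible, so the two are associates.
  -- Hence whatever vanishes at `y` vanishes at `x`, where minimality is known.
  isMin-conjugate : ∀ {E f x y d} → IsMin E f x d → eval f y ≈ 0# → IsMin E f y d
  isMin-conjugate {E} {f} {x} {y} {d} m fy≈0 = record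
    { over = over ; monic = monic ; root = fy≈0
    ; minimal = λ {g} g∈E g< gy≈0 → minimal g∈E g< (transfer g g∈E gy≈0 (isMin-exists E (f , over , proj₁ (proj₂ (proj₂ (isMin⇒algebraic m))) , fy≈0)))
    }
    where
    open IsMin m
    transfer : ∀ g → g ∈ E [X] → eval g y ≈ 0# → (∃[ h ] ∃[ e ] IsMin E h y e) → eval g x ≈ 0#
    transfer g g∈E gy≈0 (h , e , mₕ) =
      let (q , _ , eq) = isMin-divides mₕ g∈E gy≈0
          (a , f≈ah) = irreducible-associate (isMin⇒irreducible m) fy≈0 mₕ
          fx≈a*hx = trans (eval-congʳ f (map (a *_) h) f≈ah x) (eval-scale a h x)
          a≉0 : a ≉0
          a≉0 = λ a≈0 → isMin⇒¬constant m (λ n → trans (f≈ah (suc n))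
            (trans (coeff-scale a h (suc n)) (trans (*-congʳ a≈0) (zeroˡ _))))
      in trans (eq x) (trans (*-congˡ (x≉0∧xy≈0⇒y≈0 a≉0 (trans (sym fx≈a*hx) root))) (zeroʳ _))

  isMin-over : ∀ {E M f x d} → E ≤ M → IsMin E f x d → ∃[ g ] ∃[ e ] IsMin M g x e
  isMin-over {M = M} E≤M m =
    let (f , f∈E , f≉0 , fx≈0) = isMin⇒algebraic m
    in isMin-exists M (f , All.map E≤M f∈E , f≉0 , fx≈0)

  -- A common root of `f` and `deriv f` again has `f` as its minimal polynomial, and `deriv f` has
  -- smaller degree.
  isMin-squarefree : ∀ {E f x d} → IsMin E f x d → ¬ Squarefree f → deriv f ≈ₚ []
  isMin-squarefree {E} {f} {x} {suc d} m ¬sqf with em {P = ∃[ y ] CommonRoot f y}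
  ... | no ∄y = contradiction (λ y common → ∄y (y , common)) ¬sqf
  ... | yes (y , fy≈0 , f′y≈0) = IsMin.minimal (isMin-conjugate m fy≈0) (deriv-closed E over)
          (Deg<-deriv f (λ k 2+d≤k → proj₂ monic k 2+d≤k) ) f′y≈0
    where open IsMin m
  isMin-squarefree {d = zero} m = contradiction ≡.refl (isMin-positive m)

  SeparableOver : Subfield → C → Set (c ⊔ ℓ₁)
  SeparableOver E x = ∃[ f ] ∃[ d ] IsMin E f x d × Squarefree f

  separable-to : ∀ {E x} → SeparableElement E x → SeparableOver E x
  separable-to {E} {x} (f , mp , βs , uniq , f≈∏) =
    let (n , fₙ≈1 , _) = IsMinimalPolynomial.monic mp
        (g , d , m) = isMin-exists E (f , Irreducible.over (IsMinimalPolynomial.irreducible mp) ,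
                        (λ f≈0 → 1≉0 (trans (sym fₙ≈1) (f≈0 n))) , IsMinimalPolynomial.root mp)
        f≈g = minimalPolynomial-unique mp m
    in g , d , m , λ y common → unique⇒squarefree uniq y
         (commonRoot-cong {g} {∏[X- βs ]} (λ k → trans (sym (f≈g k)) (f≈∏ k)) common)

  separable-from : ∀ {E x} → SeparableOver E x → SeparableElement E x
  separable-from (f , d , m , sqf) =
    let (βs , uniq , _ , f≈∏) = squarefree-splitting f (IsMin.monic m) sqf
    in f , isMin⇒minimalPolynomial m , βs , uniq , f≈∏

  separable-over : ∀ {E M x} → E ≤ M → SeparableOver E x → SeparableOver M x
  separable-over {E} {M} {x} E≤M (f , d , m , sqf) =
    let (g , e , mg) = isMin-over E≤M m
        (q , _ , eq) = isMin-divides mg (All.map E≤M (IsMin.over m)) (IsMin.root m)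
    in g , e , mg , λ y common → sqf y (commonRoot-cong {q *ₚ g} {f}
         (λ n → sym (*ₚ-ext {f} {q} {g} eq n)) (commonRoot-*ʳ q g common))

-- Embeddings into the algebraic closure.

module Homomorphisms {c ℓ₁ ℓ₂ : Level} (em : ∀ {a} → ExcludedMiddle a) (K̄ : HeytingField c ℓ₁ ℓ₂)
  {K₀ : FieldTheory.Subfield em K̄} (closure : FieldTheory.IsAlgebraicClosureOf em K̄ K₀) where
  open FieldTheory em K̄ hiding (r; s; l)
  open Field em K̄
  open Polynomials em K̄
  open ClosedField em K̄ closure
  open MinimalPolynomials em K̄ closure
  open Subfield using (mem)
  open import Algebra.Properties.Semiring.Exp semiring public using (_^_)

  private
    u : Level
    u = c ⊔ ℓ₁

  -- Homomorphisms from L to K̄, extended by arbitrary values outside L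
  record Hom (L : Subfield) : Set u where
    field
      fun    : C → C
      cong   : ∀ {x y} → x ∈ mem L → x ≈ y → fun x ≈ fun y
      +-homo : ∀ {x y} → x ∈ mem L → y ∈ mem L → fun (x + y) ≈ fun x + fun y
      *-homo : ∀ {x y} → x ∈ mem L → y ∈ mem L → fun (x * y) ≈ fun x * fun y
      1-homo : fun 1# ≈ 1#

    open SubfieldProperties L

    0-homo : fun 0# ≈ 0#
    0-homo = begin
      fun 0#  ≈⟨ solve 1 (λ a → a := (a :+ a) :- a) refl _ ⟩
      (fun 0# + fun 0#) - fun 0# ≈⟨ x≈y⇒x-y≈0 (trans (sym (+-homo 0-closed 0-closed)) (cong (+-closed 0-closed 0-closed) (+-identityˡ 0#))) ⟩
      0#  ∎

    neg-homo : ∀ {x} → x ∈ mem L → fun (- x) ≈ - fun x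
    neg-homo {x} x∈L = begin
      fun (- x)  ≈⟨ solve 2 (λ a b → a := a :+ b :- b) refl _ _ ⟩
      fun (- x) + fun x - fun x  ≈⟨ +-congʳ (trans (sym (+-homo (neg-closed x∈L) x∈L))
                                       (trans (cong (+-closed (neg-closed x∈L) x∈L) (-‿inverseˡ x)) 0-homo)) ⟩
      0# - fun x  ≈⟨ +-identityˡ _ ⟩
      - fun x  ∎

    nonzero : ∀ {x} → x ∈ mem L → x ≉0 → fun x ≉0
    nonzero {x} x∈L x≉0 φx≈0 = let (y , xy≈1) = inverse x≉0 ; y∈L = inv-closed x∈L xy≈1 in 1≉0 (begin
      1#  ≈⟨ 1-homo ⟨
      fun 1#  ≈⟨ cong (*-closed x∈L y∈L) xy≈1 ⟨
      fun (x * y)  ≈⟨ *-homo x∈L y∈L ⟩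
      fun x * fun y  ≈⟨ *-congʳ φx≈0 ⟩
      0# * fun y  ≈⟨ zeroˡ _ ⟩
      0#  ∎)

    injective : ∀ {x y} → x ∈ mem L → y ∈ mem L → fun x ≈ fun y → x ≈ y
    injective {x} {y} x∈L y∈L φx≈φy with em {P = x - y ≈ 0#}
    ... | yes x-y≈0 = x-y≈0⇒x≈y x-y≈0
    ... | no x-y≉0  = contradiction (begin
      fun (x - y)  ≈⟨ +-homo x∈L (neg-closed y∈L) ⟩
      fun x + fun (- y)  ≈⟨ +-congˡ (neg-homo y∈L) ⟩
      fun x - fun y  ≈⟨ x≈y⇒x-y≈0 φx≈φy ⟩
      0#  ∎) (nonzero (sub-closed x∈L y∈L) x-y≉0)

    sum-homo : ∀ {n} {t : Vector C n} → (∀ i → t i ∈ mem L) → fun (sum t) ≈ sum (λ i → fun (t i))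
    sum-homo {zero}  t∈L = 0-homo
    sum-homo {suc n} t∈L = trans (+-homo (t∈L zero) (sum-closed (λ i → t∈L (suc i)))) (+-congˡ (sum-homo (λ i → t∈L (suc i))))

    linear-homo : ∀ {n} {a b : Vector C n} → (∀ i → a i ∈ mem L) → (∀ i → b i ∈ mem L) →
                  fun (sum (λ i → a i * b i)) ≈ sum (λ i → fun (a i) * fun (b i))
    linear-homo a∈L b∈L = trans (sum-homo (λ i → *-closed (a∈L i) (b∈L i)))
      (sum-cong-≋ (λ i → *-homo (a∈L i) (b∈L i)))

    eval-homo : ∀ {p x} → p ∈ L [X] → x ∈ mem L → fun (eval p x) ≈ eval (map fun p) (fun x)
    eval-homo []          x∈L = 0-homo
    eval-homo (a∈L ∷ p∈L) x∈L = trans (+-homo a∈L (*-closed x∈L (eval-closed L p∈L x∈L)))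
      (+-congˡ (trans (*-homo x∈L (eval-closed L p∈L x∈L)) (*-congˡ (eval-homo p∈L x∈L))))

    coeff-map : ∀ {p} → p ∈ L [X] → ∀ n → coeff (map fun p) n ≈ fun (coeff p n)
    coeff-map []          n       = sym 0-homo
    coeff-map (a∈L ∷ p∈L) zero    = refl
    coeff-map (a∈L ∷ p∈L) (suc n) = coeff-map p∈L n

    map-cong : ∀ {p q} → p ∈ L [X] → q ∈ L [X] → p ≈ₚ q → map fun p ≈ₚ map fun q
    map-cong p∈L q∈L p≈q n = trans (coeff-map p∈L n) (trans (cong (coeff-closed L p∈L n) (p≈q n)) (sym (coeff-map q∈L n)))

    map-monic : ∀ {p n} → p ∈ L [X] → MonicOf n p → MonicOf n (map fun p)
    map-monic {p} {n} p∈L (pₙ≈1 , p<) =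
      trans (coeff-map p∈L n) (trans (cong (coeff-closed L p∈L n) pₙ≈1) 1-homo) ,
      λ m n<m → trans (coeff-map p∈L m) (trans (cong (coeff-closed L p∈L m) (p< m n<m)) 0-homo)

    eval-map-+ : ∀ {p q} y → p ∈ L [X] → q ∈ L [X] →
                 eval (map fun (p +ₚ q)) y ≈ eval (map fun p) y + eval (map fun q) y
    eval-map-+ y []          q∈L         = sym (+-identityˡ _)
    eval-map-+ y (a∈L ∷ p∈L) []          = sym (+-identityʳ _)
    eval-map-+ y (a∈L ∷ p∈L) (b∈L ∷ q∈L) = trans (+-cong (+-homo a∈L b∈L) (*-congˡ (eval-map-+ y p∈L q∈L)))
      (solve 5 (λ a b x p q → (a :+ b) :+ x :* (p :+ q) := (a :+ x :* p) :+ (b :+ x :* q)) refl _ _ y _ _)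

    eval-map-scale : ∀ {a p} y → a ∈ mem L → p ∈ L [X] →
                     eval (map fun (map (a *_) p)) y ≈ fun a * eval (map fun p) y
    eval-map-scale y a∈L []          = sym (zeroʳ _)
    eval-map-scale y a∈L (b∈L ∷ p∈L) = trans (+-cong (*-homo a∈L b∈L) (*-congˡ (eval-map-scale y a∈L p∈L)))
      (solve 4 (λ a b x p → a :* b :+ x :* (a :* p) := a :* (b :+ x :* p)) refl _ _ y _)

    eval-map-* : ∀ {p q} y → p ∈ L [X] → q ∈ L [X] →
                 eval (map fun (p *ₚ q)) y ≈ eval (map fun p) y * eval (map fun q) y
    eval-map-* y []          q∈L = sym (zeroˡ _)
    eval-map-* {a ∷ p} {q} y (a∈L ∷ p∈L) q∈L = trans
      (eval-map-+ y (scale-closed L a∈L q∈L) (0-closed ∷ *ₚ-closed L p∈L q∈L))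
      (trans (+-cong (eval-map-scale y a∈L q∈L) (+-cong 0-homo (*-congˡ (eval-map-* y p∈L q∈L))))
        (solve 4 (λ a x p q → a :* q :+ (:0 :+ x :* (p :* q)) := (a :+ x :* p) :* q) refl _ y _ _))

    eval-map-- : ∀ {p q} y → p ∈ L [X] → q ∈ L [X] →
                 eval (map fun (p -ₚ q)) y ≈ eval (map fun p) y - eval (map fun q) y
    eval-map-- y p∈L q∈L = trans (eval-map-+ y p∈L (scale-closed L (neg-closed 1-closed) q∈L))
      (+-congˡ (trans (eval-map-scale y (neg-closed 1-closed) q∈L) (trans (*-congʳ (trans (neg-homo 1-closed) (-‿cong 1-homo)))
        (solve 1 (λ a → :- :1 :* a := :- a) refl _))))

    deriv-map : ∀ {p} → p ∈ L [X] → map fun (deriv p) ≈ₚ deriv (map fun p)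
    deriv-map {p} p∈L n = begin
      coeff (map fun (deriv p)) n  ≈⟨ coeff-map (deriv-closed L p∈L) n ⟩
      fun (coeff (deriv p) n) ≈⟨ cong (coeff-closed L (deriv-closed L p∈L) n) (coeff-deriv p n) ⟩
      fun (suc n · coeff p (suc n))  ≈⟨ ·-homo (suc n) (coeff-closed L p∈L (suc n)) ⟩
      suc n · fun (coeff p (suc n))  ≈⟨ ·-congʳ (suc n) (coeff-map p∈L (suc n)) ⟨
      suc n · coeff (map fun p) (suc n)  ≈⟨ coeff-deriv (map fun p) n ⟨
      coeff (deriv (map fun p)) n  ∎
      where
      ·-closed : ∀ n {x} → x ∈ mem L → (n · x) ∈ mem L
      ·-closed zero    x∈L = 0-closed
      ·-closed (suc n) x∈L = +-closed x∈L (·-closed n x∈L)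
      ·-homo : ∀ n {x} → x ∈ mem L → fun (n · x) ≈ n · fun x
      ·-homo zero    x∈L = 0-homo
      ·-homo (suc n) x∈L = trans (+-homo x∈L (·-closed n x∈L)) (+-congˡ (·-homo n x∈L))

  open Hom using (fun)

  infix 4 _≈[_]_
  _≈[_]_ : (C → C) → Subfield → (C → C) → Set u
  φ ≈[ E ] ψ = ∀ {x} → x ∈ mem E → φ x ≈ ψ x

  Fixes : Subfield → ∀ {L} → Hom L → Set u
  Fixes E φ = fun φ ≈[ E ] (λ x → x)

  restrict : ∀ {M L} → M ≤ L → Hom L → Hom M
  restrict M≤L φ = record
    { fun    = φ.fun
    ; cong   = λ x∈M → φ.cong (M≤L x∈M)
    ; +-homo = λ x∈M y∈M → φ.+-homo (M≤L x∈M) (M≤L y∈M)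
    ; *-homo = λ x∈M y∈M → φ.*-homo (M≤L x∈M) (M≤L y∈M)
    ; 1-homo = φ.1-homo
    }
    where module φ = Hom φ

  inclusion : ∀ L → Hom L
  inclusion L = record
    { fun = λ x → x ; cong = λ _ x≈y → x≈y ; +-homo = λ _ _ → refl ; *-homo = λ _ _ → refl ; 1-homo = refl }

  eval-fixed : ∀ {E L p x} (φ : Hom L) → E ≤ L → Fixes E φ → p ∈ E [X] → x ∈ mem L →
               fun φ (eval p x) ≈ eval p (fun φ x)
  eval-fixed {E} {L} {p} {x} φ E≤L fix p∈E x∈L = trans (Hom.eval-homo φ (All.map E≤L p∈E) x∈L)
    (eval-congʳ (map (fun φ) p) p (λ n → trans (Hom.coeff-map φ (All.map E≤L p∈E) n) (fix (coeff-closed E p∈E n))) _)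

  eval-tabulate : ∀ {n} (a : Fin n → C) x → eval (List.tabulate a) x ≈ sum (λ i → a i * x ^ Fin.toℕ i)
  eval-tabulate {zero}  a x = refl
  eval-tabulate {suc n} a x = +-cong (sym (*-identityʳ _)) (trans (*-congˡ (eval-tabulate (λ i → a (suc i)) x))
    (trans (*-distribˡ-sum x (λ i → a (suc i) * x ^ Fin.toℕ i))
      (sum-cong-≋ (λ i → solve 3 (λ x a y → x :* (a :* y) := a :* (x :* y)) refl x (a (suc i)) (x ^ Fin.toℕ i)))))

  coeff-tabulate : ∀ {n} (a : Fin n → C) i → coeff (List.tabulate a) (Fin.toℕ i) ≡ a i
  coeff-tabulate a zero    = ≡.refl
  coeff-tabulate a (suc i) = coeff-tabulate (λ i → a (suc i)) i

  Deg<-tabulate : ∀ {n} (a : Fin n → C) → Deg< n (List.tabulate a)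
  Deg<-tabulate {zero}  a m       _           = refl
  Deg<-tabulate {suc n} a (suc m) (ℕ.s≤s n≤m) = Deg<-tabulate (λ i → a (suc i)) m n≤m

  eval-coeffs : ∀ n p x → Deg< n p → eval p x ≈ sum {n} (λ i → coeff p (Fin.toℕ i) * x ^ Fin.toℕ i)
  eval-coeffs n p x p< = trans
    (eval-congʳ p (List.tabulate a) (λ m → eq m (m ℕ.<? n)) x) (eval-tabulate a x)
    where
    a : Fin n → C
    a i = coeff p (Fin.toℕ i)
    eq : ∀ m → _ → coeff p m ≈ coeff (List.tabulate a) m
    eq m (yes m<n) = reflexive (≡.subst (λ k → coeff p k ≡ coeff (List.tabulate a) k) (Fin.toℕ-fromℕ< m<n)
                       (≡.sym (coeff-tabulate a (Fin.fromℕ< m<n))))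
    eq m (no m≮n)  = trans (p< m (ℕ.≮⇒≥ m≮n)) (sym (Deg<-tabulate a m (ℕ.≮⇒≥ m≮n)))

  ^-closed : ∀ L {x} n → x ∈ mem L → x ^ n ∈ mem L
  ^-closed L zero    x∈L = Subfield.1-closed L
  ^-closed L (suc n) x∈L = Subfield.*-closed L x∈L (^-closed L n x∈L)

  -- Of the powers of `x`, `n + 1` lie in a span of `n` vectors, and a relation between them is the
  -- polynomial. Only the powers have to be spanned, so the lemma applies to `Adjoined` before that
  -- is known to be a field.
  powers-spanned⇒algebraic : ∀ E {n x} {b : Fin n → C} → (∀ i → x ^ i ∈ Span E b) → AlgebraicElement E x
  powers-spanned⇒algebraic E {n} {x} {b} powers =
    let (a , a∈E , (j , aj≉0) , Σ≈0) = spanned-dependent E {v = λ (i : Fin (suc n)) → x ^ Fin.toℕ i} (λ i → powers (Fin.toℕ i)) ℕ.≤-refl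
    in List.tabulate a , All.tabulate⁺ a∈E
     , (λ a≈0 → aj≉0 (trans (reflexive (≡.sym (coeff-tabulate a j))) (a≈0 (Fin.toℕ j))))
     , trans (eval-tabulate a x) Σ≈0

  finite⇒algebraic : ∀ {E L n x} → HasDegree E L n → x ∈ mem L → AlgebraicElement E x
  finite⇒algebraic {E} {L} (b , B) x∈L = powers-spanned⇒algebraic E (λ i → IsBasis.spanning B _ (^-closed L i x∈L))

  -- Simple extensions.

  module SimpleExtension {E f x d} (m : IsMin E f x d) where
    open SubfieldProperties E
    open IsMin m

    private
      -- The ring `E[x]`; it is a field because its elements are algebraic over `E`.
      Adjoined : Pred C u
      Adjoined y = ∃[ g ] g ∈ E [X] × y ≈ eval g x

      constant : ∀ {a} → a ∈ mem E → Adjoined a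
      constant {a} a∈E = a ∷ [] , a∈E ∷ [] , sym (eval-const a x)

      respects : ∀ {y z} → y ≈ z → Adjoined y → Adjoined z
      respects y≈z (g , g∈E , y≈gx) = g , g∈E , trans (sym y≈z) y≈gx

      +-adjoined : ∀ {y z} → Adjoined y → Adjoined z → Adjoined (y + z)
      +-adjoined (g , g∈E , y≈) (h , h∈E , z≈) = g +ₚ h , +ₚ-closed E g∈E h∈E ,
        trans (+-cong y≈ z≈) (sym (eval-+ g h x))

      *-adjoined : ∀ {y z} → Adjoined y → Adjoined z → Adjoined (y * z)
      *-adjoined (g , g∈E , y≈) (h , h∈E , z≈) = g *ₚ h , *ₚ-closed E g∈E h∈E ,
        trans (*-cong y≈ z≈) (sym (eval-* g h x))

      eval-adjoined : ∀ {p y} → p ∈ E [X] → Adjoined y → Adjoined (eval p y)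
      eval-adjoined []          y∈ = constant 0-closed
      eval-adjoined (a∈E ∷ p∈E) y∈ = +-adjoined (constant a∈E) (*-adjoined y∈ (eval-adjoined p∈E y∈))

      powers : Fin d → C
      powers i = x ^ Fin.toℕ i

      spanned : ∀ {y} → Adjoined y → y ∈ Span E powers
      spanned {y} (g , g∈E , y≈gx) =
        let (q , t , q∈E , t∈E , t< , eq) = division E over monic g∈E
        in (λ i → coeff t (Fin.toℕ i)) , (λ i → coeff-closed E t∈E (Fin.toℕ i)) , (begin
          y  ≈⟨ y≈gx ⟩
          eval g x  ≈⟨ eq x ⟩
          eval q x * eval f x + eval t x  ≈⟨ +-congʳ (trans (*-congˡ root) (zeroʳ _)) ⟩
          0# + eval t x  ≈⟨ +-identityˡ _ ⟩
          eval t x  ≈⟨ eval-coeffs d t x t< ⟩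
          sum (λ i → coeff t (Fin.toℕ i) * powers i) ∎)

      ^-adjoined : ∀ {y} n → Adjoined y → Adjoined (y ^ n)
      ^-adjoined zero    y∈ = constant 1-closed
      ^-adjoined (suc n) y∈ = *-adjoined y∈ (^-adjoined n y∈)

      -- From h₀ + y h₁(y) = 0 with h₀ ≠ 0 one reads off the inverse - h₁(y) / h₀ of y.
      inverse-adjoined : ∀ {y z} → Adjoined y → y * z ≈ 1# → Adjoined z
      inverse-adjoined {y} {z} y∈ yz≈1 =
        let (h , e , mₕ) = isMin-exists E (powers-spanned⇒algebraic E (λ i → spanned (^-adjoined i y∈))) in invert h e mₕ
        where
        y≉0 : y ≉0
        y≉0 y≈0 = 1≉0 (trans (sym yz≈1) (trans (*-congʳ y≈0) (zeroˡ z)))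
        invert : ∀ h e → IsMin E h y e → Adjoined z
        invert h zero mₕ = contradiction ≡.refl (isMin-positive mₕ)
        invert [] (suc e) mₕ = contradiction (sym (proj₁ (IsMin.monic mₕ))) 1≉0
        invert (a ∷ h) (suc e) mₕ with IsMin.over mₕ | em {P = a ≈ 0#}
        -- With constant coefficient 0, the nonzero `y` would be a root of the tail, whose degree is
        -- smaller.
        ... | a∈E ∷ h∈E | yes a≈0 = contradiction
          (trans (sym (proj₁ (IsMin.monic mₕ))) (IsMin.minimal mₕ h∈E (λ k e<k → Deg<-tail k e<k) hy≈0 e)) 1≉0
          where
          Deg<-tail : Deg< (suc e) h
          Deg<-tail k e<k = proj₂ (IsMin.monic mₕ) (suc k) (ℕ.s≤s e<k)
          hy≈0 : eval h y ≈ 0#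
          hy≈0 = x≉0∧xy≈0⇒y≈0 y≉0 (trans (sym (trans (+-congʳ a≈0) (+-identityˡ _))) (IsMin.root mₕ))
        ... | a∈E ∷ h∈E | no a≉0 =
          let (w , aw≈1) = inverse a≉0 in
          respects (begin
            - w * eval h y ≈⟨ solve 4 (λ w h y z → :- w :* h := :- w :* (h :* :1)) refl w (eval h y) y z ⟩
            - w * (eval h y * 1#)  ≈⟨ *-congˡ (*-congˡ yz≈1) ⟨
            - w * (eval h y * (y * z)) ≈⟨ solve 5 (λ a w h y z → :- w :* (h :* (y :* z)) := a :* w :* z :- w :* z :* (a :+ y :* h)) refl a w (eval h y) y z ⟩
            a * w * z - w * z * (a + y * eval h y) ≈⟨ +-cong (*-congʳ aw≈1) (-‿cong (*-congˡ (IsMin.root mₕ))) ⟩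
            1# * z - w * z * 0# ≈⟨ solve 2 (λ w z → :1 :* z :- w :* z :* :0 := z) refl w z ⟩
            z  ∎)
            (*-adjoined (constant (neg-closed (inv-closed a∈E aw≈1))) (eval-adjoined h∈E y∈))

    adjoin : Subfield
    adjoin = record
      { mem        = Adjoined
      ; resp       = respects
      ; 0-closed   = constant 0-closed
      ; 1-closed   = constant 1-closed
      ; +-closed   = +-adjoined
      ; *-closed   = *-adjoined
      ; neg-closed = λ {y} y∈ → respects (solve 1 (λ y → :- :1 :* y := :- y) refl y)
                       (*-adjoined (constant (neg-closed 1-closed)) y∈)
      ; inv-closed = inverse-adjoined
      }

    base≤adjoin : E ≤ adjoin
    base≤adjoin = constant

    generator : x ∈ mem adjoin
    generator = 0# ∷ 1# ∷ [] , 0-closed ∷ 1-closed ∷ [] , solve 1 (λ x → x := :0 :+ x :* (:1 :+ x :* :0)) refl x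

    adjoin≤ : ∀ {L} → E ≤ L → x ∈ mem L → adjoin ≤ L
    adjoin≤ {L} E≤L x∈L (g , g∈E , y≈) = Subfield.resp L (sym y≈) (eval-closed L (All.map E≤L g∈E) x∈L)

    adjoin-degree : HasDegree E adjoin d
    adjoin-degree = powers , record
      { members     = λ i → ^-closed adjoin (Fin.toℕ i) generator
      ; independent = λ a a∈E Σ≈0 i → trans (reflexive (≡.sym (coeff-tabulate a i)))
          (minimal (All.tabulate⁺ a∈E) (Deg<-tabulate a) (trans (eval-tabulate a x) Σ≈0) (Fin.toℕ i))
      ; spanning    = λ y y∈ → spanned y∈
      }

    module _ (φ : Hom E) {y} (φf-root : eval (map (fun φ) f) y ≈ 0#) where
      private
        module φ = Hom φ

        vanishing : ∀ {g} → g ∈ E [X] → eval g x ≈ 0# → eval (map φ.fun g) y ≈ 0#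
        vanishing {g} g∈E gx≈0 =
          let (q , q∈E , eq) = isMin-divides m g∈E gx≈0 in begin
          eval (map φ.fun g) y ≈⟨ eval-congʳ (map φ.fun g) (map φ.fun (q *ₚ f)) (φ.map-cong g∈E (*ₚ-closed E q∈E over) (*ₚ-ext {g} {q} {f} eq)) y ⟩
          eval (map φ.fun (q *ₚ f)) y  ≈⟨ φ.eval-map-* y q∈E over ⟩
          eval (map φ.fun q) y * eval (map φ.fun f) y ≈⟨ *-congˡ φf-root ⟩
          eval (map φ.fun q) y * 0#  ≈⟨ zeroʳ _ ⟩
          0#  ∎

        representative : C → Poly
        representative z = choose [] (λ g → g ∈ E [X] × z ≈ eval g x)

        value : C → C
        value z = eval (map φ.fun (representative z)) y

        -- Two polynomials with the same value at `x` differ by a multiple of `f`, and `y` is a root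
        -- of the image of `f`. The choice of representative is therefore immaterial.
        value-eval : ∀ {z g} → g ∈ E [X] → z ≈ eval g x → value z ≈ eval (map φ.fun g) y
        value-eval {z} {g} g∈E z≈gx =
          let (g′∈E , z≈g′x) = choose-satisfies [] (λ g → g ∈ E [X] × z ≈ eval g x) (g , g∈E , z≈gx) in
          x-y≈0⇒x≈y (trans (sym (φ.eval-map-- y g′∈E g∈E)) (vanishing (-ₚ-closed E g′∈E g∈E)
            (trans (eval-- (representative z) g x) (x≈y⇒x-y≈0 (trans (sym z≈g′x) z≈gx)))))

      extend : Hom adjoin
      extend = record
        { fun    = value
        ; cong = λ (g , g∈E , z≈) z≈w → trans (value-eval g∈E z≈) (sym (value-eval g∈E (trans (sym z≈w) z≈)))
        ; +-homo = λ z∈@(g , g∈E , z≈) w∈@(h , h∈E , w≈) →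
            trans (value-eval (proj₁ (proj₂ (+-adjoined z∈ w∈))) (proj₂ (proj₂ (+-adjoined z∈ w∈))))
            (trans (φ.eval-map-+ y g∈E h∈E) (sym (+-cong (value-eval g∈E z≈) (value-eval h∈E w≈))))
        ; *-homo = λ z∈@(g , g∈E , z≈) w∈@(h , h∈E , w≈) →
            trans (value-eval (proj₁ (proj₂ (*-adjoined z∈ w∈))) (proj₂ (proj₂ (*-adjoined z∈ w∈))))
            (trans (φ.eval-map-* y g∈E h∈E) (sym (*-cong (value-eval g∈E z≈) (value-eval h∈E w≈))))
        ; 1-homo = trans (value-eval (1-closed ∷ []) (sym (eval-const 1# x))) (trans (eval-const _ y) φ.1-homo)
        }

      extend-agrees : fun extend ≈[ E ] φ.fun
      extend-agrees {a} a∈E = trans (value-eval (a∈E ∷ []) (sym (eval-const a x))) (eval-const _ y)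

      extend-generator : fun extend x ≈ y
      extend-generator = trans (value-eval (0-closed ∷ 1-closed ∷ []) (proj₂ (proj₂ generator)))
        (trans (+-cong φ.0-homo (*-congˡ (+-cong φ.1-homo (zeroʳ y)))) (solve 1 (λ y → :0 :+ y :* (:1 :+ :0) := y) refl y))

  degree-positive : ∀ {E L n} → HasDegree E L n → 0 ℕ.< n
  degree-positive {n = suc n} _       = ℕ.s≤s ℕ.z≤n
  degree-positive {L = L} {zero} (b , B) =
    contradiction (proj₂ (proj₂ (IsBasis.spanning B 1# (Subfield.1-closed L)))) 1≉0

  Generation : Subfield → Subfield → ℕ → C → Set u
  Generation E L n x = ∃[ f ] ∃[ d ] Σ (IsMin E f x d) λ m →
    ∃[ k ] HasDegree (SimpleExtension.adjoin m) L k × n ≡ k ℕ.* d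

  module _ {E L n} (E≤L : E ≤ L) (deg : HasDegree E L n) {x} (x∈L : x ∈ mem L) where
    open SimpleExtension

    generated : Generation E L n x
    generated =
      let (f , d , m) = isMin-exists E (finite⇒algebraic deg x∈L)
          (_ , (k , deg′)) = intermediate-finite (base≤adjoin m) (adjoin≤ m {L} E≤L x∈L) deg
      in f , d , m , k , deg′ , degree-unique {E} {L} deg (tower (base≤adjoin m) (adjoin≤ m {L} E≤L x∈L) (adjoin-degree m) deg′)

    -- An element outside `E` has a minimal polynomial of degree at least 2. This is the measure for
    -- the inductions that climb from `E` to `L`.
    degree-drops : ∀ {f d k} (m : IsMin E f x d) → ¬ x ∈ mem E → HasDegree (adjoin m) L k → n ≡ k ℕ.* d → k ℕ.< n
    degree-drops {d = zero}        m x∉E deg′ _ = contradiction ≡.refl (isMin-positive m)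
    degree-drops {d = suc zero} m x∉E deg′ _ = contradiction (degree-1 (base≤adjoin m) (adjoin-degree m) (generator m)) x∉E
    degree-drops {d = suc (suc d)} {k} m x∉E deg′ ≡.refl =
      ℕ.m<m*n k (suc (suc d)) {{ℕ.>-nonZero (degree-positive deg′)}} (ℕ.s≤s (ℕ.s≤s ℕ.z≤n))

  abstract
    -- An element outside `E` is sent to a root of the image of its minimal polynomial, which exists
    -- in K̄, and the induction continues over the larger base.
    extension-exists : ∀ {E L n} → E ≤ L → HasDegree E L n → (φ : Hom E) → ∃[ ψ ] fun {L} ψ ≈[ E ] fun φ
    extension-exists {E} {L} {n} E≤L deg = <-rec Extendable step n E E≤L deg
      where
      Extendable : ℕ → Set (Level.suc u)
      Extendable n = ∀ E → E ≤ L → HasDegree E L n → (φ : Hom E) → ∃[ ψ ] fun {L} ψ ≈[ E ] fun φ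
      step : ∀ n → (∀ {k} → k ℕ.< n → Extendable k) → Extendable n
      step n rec E E≤L deg φ = by-cases (∃[ x ] x ∈ mem L × ¬ x ∈ mem E)
        (λ (x , x∈L , x∉E) → through x∈L x∉E (generated {E} {L} {n} E≤L deg {x} x∈L))
        (λ ∄x → restrict {L} {E} (λ {x} x∈L → by-contradiction (x ∈ mem E) (λ x∉E → ∄x (x , x∈L , x∉E))) φ , λ _ → refl)
        where
        nonconstant : ∀ d g → ¬ d ≡ 0 → MonicOf d g → ¬ Constant g
        nonconstant zero    g d≢0 _          _     = d≢0 ≡.refl
        nonconstant (suc d) g _   (lead , _) const = 1≉0 (trans (sym lead) (const d))
        through : ∀ {x} → x ∈ mem L → ¬ x ∈ mem E →
                  Generation E L n x →
                  ∃[ ψ ] fun {L} ψ ≈[ E ] fun φ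
        through {x} x∈L x∉E (f , d , m , k , deg′ , n≡kd) =
          along (IsAlgebraicClosureOf.algebraicallyClosed closure (map (fun φ) f)
            (nonconstant d (map (fun φ) f) (isMin-positive m) (Hom.map-monic φ (IsMin.over m) (IsMin.monic m))))
          where
          open SimpleExtension m
          along : ∃[ y ] eval (map (fun φ) f) y ≈ 0# → ∃[ ψ ] fun {L} ψ ≈[ E ] fun φ
          along (y , root) = continue (rec (degree-drops {E} {L} {n} E≤L deg x∈L m x∉E deg′ n≡kd) adjoin (adjoin≤ {L} E≤L x∈L) deg′ (extend φ root))
            where
            continue : ∃[ ψ ] fun {L} ψ ≈[ adjoin ] fun (extend φ root) → ∃[ ψ ] fun {L} ψ ≈[ E ] fun φ
            continue (ψ , agrees) = ψ , λ {a} a∈E → trans (agrees (base≤adjoin a∈E)) (extend-agrees φ root a∈E)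

  -- Independence of homomorphisms.

  Distinct : ∀ {n} L → (Fin n → Hom L) → Set u
  Distinct L Φ = ∀ i j → fun (Φ i) ≈[ L ] fun (Φ j) → i ≡ j

  -- Taking the relation at `x * y` and subtracting `φ₀ y` times the relation at `x` eliminates
  -- `Φ zero`. By induction each `a (suc j)` is annihilated by all `fun (Φ (suc j)) y - φ₀ y`, one
  -- of which is nonzero; evaluation at `1#` then settles `a zero`.
  dedekind : ∀ {n L} (Φ : Fin n → Hom L) → Distinct L Φ → (a : Fin n → C) →
             (∀ {x} → x ∈ mem L → sum (λ i → a i * fun (Φ i) x) ≈ 0#) → ∀ i → a i ≈ 0#
  dedekind {suc n} {L} Φ distinct a relation = λ { zero → head≈0 ; (suc j) → tail≈0 j }
    where
    φ₀ = fun (Φ zero)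
    shorter : ∀ y → y ∈ mem L → ∀ j → a (suc j) * (fun (Φ (suc j)) y - φ₀ y) ≈ 0#
    shorter y y∈L = dedekind (λ j → Φ (suc j)) (λ i j agree → Fin.suc-injective (distinct (suc i) (suc j) agree)) _ λ {x} x∈L → begin
      sum (λ j → a (suc j) * (fun (Φ (suc j)) y - φ₀ y) * fun (Φ (suc j)) x)
        ≈⟨ difference (λ j → a (suc j)) (λ j → fun (Φ (suc j)) y) (φ₀ y) (λ j → fun (Φ (suc j)) x) ⟩
      sum (λ j → a (suc j) * (fun (Φ (suc j)) x * fun (Φ (suc j)) y)) - φ₀ y * sum (λ j → a (suc j) * fun (Φ (suc j)) x)
        ≈⟨ solve 5 (λ a x y s t → s :- y :* t := (a :* (x :* y) :+ s) :- y :* (a :* x :+ t)) refl (a zero) (φ₀ x) (φ₀ y) _ _ ⟩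
      sum (λ j → a j * (fun (Φ j) x * fun (Φ j) y)) - φ₀ y * sum (λ j → a j * fun (Φ j) x)
        ≈⟨ +-cong (trans (sum-cong-≋ {suc n} (λ j → *-congˡ {a j} (sym (Hom.*-homo (Φ j) x∈L y∈L)))) (relation (Subfield.*-closed L x∈L y∈L)))
                  (-‿cong (*-congˡ (relation x∈L))) ⟩
      0# - φ₀ y * 0#
        ≈⟨ solve 1 (λ y → :0 :- y :* :0 := :0) refl (φ₀ y) ⟩
      0# ∎
      where
      difference : ∀ {n} (a p : Fin n → C) y (q : Fin n → C) →
        sum (λ j → a j * (p j - y) * q j) ≈ sum (λ j → a j * (q j * p j)) - y * sum (λ j → a j * q j)
      difference {zero}  a p y q = solve 1 (λ y → :0 := :0 :- y :* :0) refl y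
      difference {suc n} a p y q = trans (+-congˡ (difference (λ j → a (suc j)) (λ j → p (suc j)) y (λ j → q (suc j))))
        (solve 6 (λ a p y q s t → a :* (p :- y) :* q :+ (s :- y :* t) := (a :* (q :* p) :+ s) :- y :* (a :* q :+ t))
          refl (a zero) (p zero) y (q zero) _ _)
    tail≈0 : ∀ j → a (suc j) ≈ 0#
    tail≈0 j with em {P = a (suc j) ≈ 0#}
    ... | yes a≈0 = a≈0
    ... | no a≉0  = contradiction
      (distinct (suc j) zero (λ {y} y∈L → x-y≈0⇒x≈y (x≉0∧xy≈0⇒y≈0 a≉0 (shorter y y∈L j)))) (λ ())
    head≈0 : a zero ≈ 0#
    head≈0 = begin
      a zero ≈⟨ solve 1 (λ a → a := a :* :1 :+ :0) refl _ ⟩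
      a zero * 1# + 0# ≈⟨ +-cong (*-congˡ (Hom.1-homo (Φ zero))) (sum-zero {n} (λ j → trans (*-congʳ (tail≈0 j)) (zeroˡ _))) ⟨
      sum (λ j → a j * fun (Φ j) 1#)  ≈⟨ relation (Subfield.1-closed L) ⟩
      0#  ∎

  -- With more than `n` homomorphisms, the `n` equations that impose a relation on the basis vectors
  -- have a nonzero solution. As all `Φ j` agree on `E`, the relation spreads from the basis to `L`,
  -- against `dedekind`.
  distinct-bound : ∀ {k n E L} {φ : C → C} (Φ : Fin k → Hom L) → E ≤ L → (∀ j → fun (Φ j) ≈[ E ] φ) →
                   Distinct L Φ → HasDegree E L n → k ℕ.≤ n
  distinct-bound {k} {n} {E} {L} {φ} Φ E≤L agree distinct (b , B) with k ℕ.≤? n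
  ... | yes k≤n = k≤n
  ... | no k≰n  =
    let (a , _ , (j , aj≉0) , Aa≈0) = kernel ⊤ᴱ A (λ _ _ → lift tt) (ℕ.≰⇒> k≰n)
    in contradiction (dedekind Φ distinct a (λ {x} x∈L → relation a Aa≈0 x (B.spanning x x∈L)) j) aj≉0
    where
    module B = IsBasis B
    A : Fin n → Fin k → C
    A i j = fun (Φ j) (b i)
    relation : ∀ a → (∀ i → sum (λ j → A i j * a j) ≈ 0#) → ∀ x → x ∈ Span E b → sum (λ j → a j * fun (Φ j) x) ≈ 0#
    relation a Aa≈0 x (e , e∈E , x≈) = begin
      sum (λ j → a j * fun (Φ j) x)
        ≈⟨ sum-cong-≋ {k} (λ j → *-congˡ (trans
             (sym (Hom.cong (Φ j) (SubfieldProperties.sum-closed L (λ i → Subfield.*-closed L (E≤L (e∈E i)) (B.members i))) (sym x≈)))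
             (trans (Hom.linear-homo (Φ j) (λ i → E≤L (e∈E i)) B.members) (sum-cong-≋ {n} (λ i → *-congʳ (agree j (e∈E i))))))) ⟩
      sum (λ j → a j * sum (λ i → φ (e i) * A i j))
        ≈⟨ sum-cong-≋ {k} (λ j → *-distribˡ-sum (a j) (λ i → φ (e i) * A i j)) ⟩
      sum (λ j → sum (λ i → a j * (φ (e i) * A i j)))
        ≈⟨ ∑-comm (λ j i → a j * (φ (e i) * A i j)) ⟩
      sum (λ i → sum (λ j → a j * (φ (e i) * A i j)))
        ≈⟨ sum-zero {n} (λ i → begin
          sum (λ j → a j * (φ (e i) * A i j)) ≈⟨ sum-cong-≋ {k} (λ j → solve 3 (λ a e A → a :* (e :* A) := e :* (A :* a)) refl (a j) (φ (e i)) (A i j)) ⟩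
          sum (λ j → φ (e i) * (A i j * a j)) ≈⟨ *-distribˡ-sum (φ (e i)) (λ j → A i j * a j) ⟨
          φ (e i) * sum (λ j → A i j * a j)  ≈⟨ *-congˡ (Aa≈0 i) ⟩
          φ (e i) * 0#  ≈⟨ zeroʳ _ ⟩
          0#  ∎) ⟩
      0# ∎

-- Injectivity of the Frobenius map.

module Frobenius {c ℓ₁ ℓ₂ : Level} (em : ∀ {a} → ExcludedMiddle a) (K̄ : HeytingField c ℓ₁ ℓ₂) where
  open Field em K̄
  open Polynomials em K̄
  open import Algebra.Properties.Semiring.Exp semiring using (_^_; ^-congˡ)
  open import Algebra.Properties.Semiring.Mult semiring
    using () renaming (×-assoc-* to ·-assoc-*; ×1-homo-* to ·1-homo-*; ×-congˡ to ·-congˡ)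
  open import Algebra.Properties.Monoid.Sum +-monoid using (sum-init-last)
  import Algebra.Properties.CommutativeSemiring.Binomial commutativeSemiring as Binomial
  open import Data.Nat.Combinatorics using (nCn≡1; k![n∸k]!∣n!) renaming (_C_ to _choose_)
  open import Data.Nat.Combinatorics.Specification using (nCk≡n!/k![n-k]!)
  open import Data.Nat.DivMod using (m/n*n≡m)
  open import Data.Nat.Properties using (_!*_!≢0)
  open import Data.Nat.Base using (_!; _∸_)

  ·-* : ∀ n x → n · x ≈ (n · 1#) * x
  ·-* n x = trans (·-congʳ n (sym (*-identityˡ x))) (sym (·-assoc-* n 1# x))

  ^-≈0 : ∀ n {x} → x ^ n ≈ 0# → x ≈ 0#
  ^-≈0 zero    1≈0 = contradiction 1≈0 1≉0
  ^-≈0 (suc n) eq with no-zero-divisors eq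
  ... | inj₁ x≈0 = x≈0
  ... | inj₂ eq′ = ^-≈0 n eq′

  -- The characteristic is suc p.
  module _ {p} (char : suc p · 1# ≈ 0#) (least : ∀ k → k ℕ.< p → (suc k · 1#) ≉0) where

    !·1≉0 : ∀ {k} → k ℕ.≤ p → ((k !) · 1#) ≉0
    !·1≉0 {zero}  k≤p eq = 1≉0 (trans (sym (+-identityʳ 1#)) eq)
    !·1≉0 {suc k} k<p eq = !·1≉0 (ℕ.<⇒≤ k<p) (x≉0∧xy≈0⇒y≈0 (least k k<p) (trans (sym (·1-homo-* (suc k) (k !))) eq))

    -- Primality of the characteristic enters only as its leastness: the binomial coefficient times
    -- two factorials is `suc p !`, which vanishes in the field, while the factorials do not.
    C·1≈0 : ∀ {k} → k ℕ.< p → (suc p choose suc k) · 1# ≈ 0#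
    C·1≈0 {k} k<p = x≉0∧xy≈0⇒y≈0 (!·1≉0 k<p) (x≉0∧xy≈0⇒y≈0 (!·1≉0 {p ∸ k} (ℕ.m∸n≤m p k)) (begin
      ((p ∸ k) !) · 1# * (((suc k !) · 1#) * ((suc p choose suc k) · 1#)) ≈⟨ solve 3 (λ a b c → a :* (b :* c) := c :* (b :* a)) refl _ _ _ ⟩
      ((suc p choose suc k) · 1#) * (((suc k !) · 1#) * (((p ∸ k) !) · 1#)) ≈⟨ *-congˡ (·1-homo-* (suc k !) ((p ∸ k) !)) ⟨
      ((suc p choose suc k) · 1#) * ((suc k ! ℕ.* (p ∸ k) !) · 1#) ≈⟨ ·1-homo-* (suc p choose suc k) (suc k ! ℕ.* (p ∸ k) !) ⟨
      (((suc p choose suc k) ℕ.* (suc k ! ℕ.* (p ∸ k) !)) · 1#)  ≈⟨ ·-congˡ C*!*!≡! ⟩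
      (suc p !) · 1#  ≈⟨ ·1-homo-* (suc p) (p !) ⟩
      (suc p · 1#) * ((p !) · 1#)  ≈⟨ *-congʳ char ⟩
      0# * ((p !) · 1#)  ≈⟨ zeroˡ _ ⟩
      0#  ∎))
      where
      instance _ = (suc k) !* (p ∸ k) !≢0
      C*!*!≡! : (suc p choose suc k) ℕ.* (suc k ! ℕ.* (p ∸ k) !) ≡ suc p !
      C*!*!≡! = ≡.trans (≡.cong (ℕ._* (suc k ! ℕ.* (p ∸ k) !)) (nCk≡n!/k![n-k]! {suc p} {suc k} (ℕ.s≤s (ℕ.<⇒≤ k<p))))
        (m/n*n≡m (k![n∸k]!∣n! {suc p} {suc k} (ℕ.s≤s (ℕ.<⇒≤ k<p))))

    frobenius-+ : ∀ x y → (x + y) ^ suc p ≈ y ^ suc p + x ^ suc p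
    frobenius-+ x y = begin
      (x + y) ^ suc p
        ≈⟨ Binomial.theorem (suc p) x y ⟩
      term 0 + sum {suc p} (λ i → term (suc (Fin.toℕ i)))
        ≈⟨ +-congˡ (sum-init-last {p} (λ i → term (suc (Fin.toℕ i)))) ⟩
      term 0 + (sum {p} (λ i → term (suc (Fin.toℕ (Fin.inject₁ i)))) + term (suc (Fin.toℕ (Fin.fromℕ p))))
        ≈⟨ +-cong first (+-cong (sum-zero {p} middle) final) ⟩
      y ^ suc p + (0# + x ^ suc p)
        ≈⟨ +-congˡ (+-identityˡ _) ⟩
      y ^ suc p + x ^ suc p ∎
      where
      term : ℕ → C
      term k = (suc p choose k) · (x ^ k * y ^ (suc p ∸ k))
      first : term 0 ≈ y ^ suc p
      first = trans (+-identityʳ _) (*-identityˡ _)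
      middle : ∀ i → term (suc (Fin.toℕ (Fin.inject₁ i))) ≈ 0#
      middle i = trans (·-* (suc p choose suc k) _) (trans (*-congʳ (C·1≈0 (≡.subst (ℕ._< p) (≡.sym (Fin.toℕ-inject₁ i)) (Fin.toℕ<n i)))) (zeroˡ _))
        where k = Fin.toℕ (Fin.inject₁ i)
      final : term (suc (Fin.toℕ (Fin.fromℕ p))) ≈ x ^ suc p
      final = begin
        term (suc (Fin.toℕ (Fin.fromℕ p))) ≡⟨ ≡.cong (λ k → term (suc k)) (Fin.toℕ-fromℕ p) ⟩
        term (suc p) ≡⟨ ≡.cong₂ (λ n k → n · (x ^ suc p * y ^ k)) (nCn≡1 (suc p)) (ℕ.n∸n≡0 p) ⟩
        x ^ suc p * 1# + 0#  ≈⟨ trans (+-identityʳ _) (*-identityʳ _) ⟩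
        x ^ suc p  ∎

    -- Additivity applied to `(x - y) + y` yields the power of `x - y` without a discussion of the
    -- sign of a power of `- 1#`.
    frobenius-injective : ∀ {x y} → x ^ suc p ≈ y ^ suc p → x ≈ y
    frobenius-injective {x} {y} eq = x-y≈0⇒x≈y (^-≈0 (suc p) (begin
      (x - y) ^ suc p ≈⟨ solve 2 (λ a b → a := (b :+ a) :- b) refl _ (y ^ suc p) ⟩
      (y ^ suc p + (x - y) ^ suc p) - y ^ suc p ≈⟨ +-congʳ (frobenius-+ (x - y) y) ⟨
      (x - y + y) ^ suc p - y ^ suc p ≈⟨ +-congʳ (^-congˡ (suc p) (solve 2 (λ x y → x :- y :+ y := x) refl x y)) ⟩
      x ^ suc p - y ^ suc p  ≈⟨ x≈y⇒x-y≈0 eq ⟩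
      0#  ∎))

-- Separability in terms of the number of embeddings.

module Separability {c ℓ₁ ℓ₂ : Level} (em : ∀ {a} → ExcludedMiddle a) (K̄ : HeytingField c ℓ₁ ℓ₂)
  {K₀ : FieldTheory.Subfield em K̄} (closure : FieldTheory.IsAlgebraicClosureOf em K̄ K₀) where
  open FieldTheory em K̄ hiding (r; s; l)
  open Field em K̄
  open Polynomials em K̄
  open ClosedField em K̄ closure
  open MinimalPolynomials em K̄ closure
  open Homomorphisms em K̄ closure
  open Subfield using (mem)
  open Hom using (fun)

  open import Data.List.Membership.Propositional.Properties using (∈-lookup)

  private
    u : Level
    u = c ⊔ ℓ₁

  -- Demanded for every embedding of `E`, and not just the inclusion, so that the numbers multiply
  -- in towers.
  ManyExtensions : Subfield → Subfield → ℕ → Set u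
  ManyExtensions E L n = (φ : Hom E) → Σ (Fin n → Hom L) λ Φ → (∀ i → fun (Φ i) ≈[ E ] fun φ) × Distinct L Φ

  unique-lookup : ∀ {βs} → Unique setoid βs → ∀ i j → List.lookup βs i ≈ List.lookup βs j → i ≡ j
  unique-lookup (β∉βs ∷ uniq) zero    zero    eq = ≡.refl
  unique-lookup (β∉βs ∷ uniq) zero (suc j) eq = contradiction eq (All.lookup β∉βs (∈-lookup j))
  unique-lookup (β∉βs ∷ uniq) (suc i) zero eq = contradiction (sym eq) (All.lookup β∉βs (∈-lookup i))
  unique-lookup (β∉βs ∷ uniq) (suc i) (suc j) eq = ≡.cong suc (unique-lookup uniq i j eq)

  module _ {E f x d} (m : IsMin E f x d) (sqf : Squarefree f) where
    open SimpleExtension m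
    open IsMin m

    -- If `y` were a multiple root of the image of `f`, the extension of `φ` sending `x` to `y`
    -- would send `eval (deriv f) x` to 0, and it is injective.
    map-squarefree : (φ : Hom E) → Squarefree (map (fun φ) f)
    map-squarefree φ y (root-y , root′-y) = sqf x (root , τ-injective (begin
      fun τ (eval (deriv f) x) ≈⟨ Hom.eval-homo τ (All.map base≤adjoin f′∈E) generator ⟩
      eval (map (fun τ) (deriv f)) (fun τ x) ≈⟨ eval-cong (map (fun τ) (deriv f)) (deriv (map (fun φ) f)) coeffs (extend-generator φ root-y) ⟩
      eval (deriv (map (fun φ) f)) y  ≈⟨ root′-y ⟩
      0#  ∎))
      where
      τ = extend φ root-y
      f′∈E = deriv-closed E over
      coeffs : map (fun τ) (deriv f) ≈ₚ deriv (map (fun φ) f)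
      coeffs n = begin
        coeff (map (fun τ) (deriv f)) n  ≈⟨ Hom.coeff-map τ (All.map base≤adjoin f′∈E) n ⟩
        fun τ (coeff (deriv f) n)  ≈⟨ extend-agrees φ root-y (coeff-closed E f′∈E n) ⟩
        fun φ (coeff (deriv f) n)  ≈⟨ Hom.coeff-map φ f′∈E n ⟨
        coeff (map (fun φ) (deriv f)) n  ≈⟨ Hom.deriv-map φ over n ⟩
        coeff (deriv (map (fun φ) f)) n  ∎
      τ-injective : fun τ (eval (deriv f) x) ≈ 0# → eval (deriv f) x ≈ 0#
      τ-injective eq = by-contradiction _ (λ ≉0 →
        Hom.nonzero τ (eval-closed adjoin (All.map base≤adjoin f′∈E) generator) ≉0 eq)

    adjoin-many : ManyExtensions E adjoin d
    adjoin-many φ = from-roots (squarefree-splitting (map (fun φ) f) (Hom.map-monic φ over monic) (map-squarefree φ))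
      where
      from-roots : ∃[ βs ] Unique setoid βs × length βs ≡ d × map (fun φ) f ≈ₚ ∏[X- βs ] →
                   Σ (Fin d → Hom adjoin) λ Φ → (∀ i → fun (Φ i) ≈[ E ] fun φ) × Distinct adjoin Φ
      from-roots (βs , uniq , ≡.refl , eq) =
        (λ i → extend φ (root-at i)) , (λ i → extend-agrees φ (root-at i)) ,
        λ i j agree → unique-lookup uniq i j
          (trans (sym (extend-generator φ (root-at i))) (trans (agree generator) (extend-generator φ (root-at j))))
        where
        root-at : ∀ i → eval (map (fun φ) f) (List.lookup βs i) ≈ 0#
        root-at i = trans (eval-congʳ (map (fun φ) f) ∏[X- βs ] eq _) (All.lookup (∏-roots βs) (∈-lookup i))

  many-trans : ∀ {E M L m n} → E ≤ M → M ≤ L → ManyExtensions E M n → ManyExtensions M L m → ManyExtensions E L (m ℕ.* n)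
  many-trans {E} {M} {L} {m} {n} E≤M M≤L ext-M ext-L φ = compose (ext-M φ)
    where
    compose : Σ (Fin n → Hom M) (λ Φ → (∀ i → fun (Φ i) ≈[ E ] fun φ) × Distinct M Φ) →
              Σ (Fin (m ℕ.* n) → Hom L) λ Φ → (∀ i → fun (Φ i) ≈[ E ] fun φ) × Distinct L Φ
    compose (Φ , agree , distinct) = Ψ
      , (λ k x∈E → trans (Ψ-agree _ _ (E≤M x∈E)) (agree _ x∈E))
      , λ k k′ eq → distinct-pairs k k′ (remQuot {m} n k) (remQuot {m} n k′)
          (Fin.combine-remQuot {m} n k) (Fin.combine-remQuot {m} n k′) eq
      where
      Ψ² : Fin m × Fin n → Hom L
      Ψ² (j , i) = proj₁ (ext-L (Φ i)) j
      Ψ-agree : ∀ j i → fun (Ψ² (j , i)) ≈[ M ] fun (Φ i)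
      Ψ-agree j i = proj₁ (proj₂ (ext-L (Φ i))) j
      Ψ : Fin (m ℕ.* n) → Hom L
      Ψ k = Ψ² (remQuot {m} n k)
      distinct-pairs : ∀ k k′ (p p′ : Fin m × Fin n) → uncurry combine p ≡ k → uncurry combine p′ ≡ k′ →
                       fun (Ψ² p) ≈[ L ] fun (Ψ² p′) → k ≡ k′
      distinct-pairs k k′ (j , i) (j′ , i′) ≡.refl ≡.refl eq
        with distinct i i′ (λ x∈M → trans (sym (Ψ-agree j i x∈M)) (trans (eq (M≤L x∈M)) (Ψ-agree j′ i′ x∈M)))
      ... | ≡.refl = ≡.cong (λ j → combine j i) (proj₂ (proj₂ (ext-L (Φ i))) j j′ eq)

  abstract
    -- One element is adjoined at a time. The others stay separable over the larger base, since
    -- their minimal polynomials there divide the old ones.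
    separable⇒many : ∀ {E L n} → E ≤ L → HasDegree E L n → (∀ {x} → x ∈ mem L → SeparableOver E x) → ManyExtensions E L n
    separable⇒many {E} {L} {n} E≤L deg sep = <-rec Many step n E E≤L deg sep
      where
      Many : ℕ → Set (Level.suc u)
      Many n = ∀ E → E ≤ L → HasDegree E L n → (∀ {x} → x ∈ mem L → SeparableOver E x) → ManyExtensions E L n
      step : ∀ n → (∀ {k} → k ℕ.< n → Many k) → Many n
      step n rec E E≤L deg sep = by-cases (∃[ x ] x ∈ mem L × ¬ x ∈ mem E)
        (λ (x , x∈L , x∉E) → through x∈L x∉E (generated {E} {L} {n} E≤L deg {x} x∈L) (sep x∈L))
        (λ ∄x → trivial (λ {x} x∈L → by-contradiction (x ∈ mem E) (λ x∉E → ∄x (x , x∈L , x∉E))))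
        where
        trivial : L ≤ E → ManyExtensions E L n
        trivial L≤E φ = (λ _ → restrict {L} {E} L≤E φ) , (λ _ _ → refl) ,
          λ i j _ → all-equal (degree-unique {E} {L} deg (trivial-degree {E} {L} E≤L L≤E)) i j
          where
          all-equal : ∀ {n} → n ≡ 1 → (i j : Fin n) → i ≡ j
          all-equal ≡.refl zero zero = ≡.refl
        through : ∀ {x} → x ∈ mem L → ¬ x ∈ mem E →
                  Generation E L n x →
                  SeparableOver E x → ManyExtensions E L n
        through {x} x∈L x∉E (f , d , m , k , deg′ , n≡kd) (g , e , m′ , sqf) =
          ≡.subst (ManyExtensions E L) (≡.sym n≡kd) (many-trans {E} {adjoin} {L} base≤adjoin (adjoin≤ {L} E≤L x∈L)
            (adjoin-many m (λ y common → sqf y (commonRoot-cong {f} {g} f≈g common)))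
            (rec (degree-drops {E} {L} {n} E≤L deg x∈L m x∉E deg′ n≡kd) adjoin (adjoin≤ {L} E≤L x∈L) deg′
              (λ y∈L → separable-over {E} {adjoin} base≤adjoin (sep y∈L))))
          where
          open SimpleExtension m
          f≈g : f ≈ₚ g
          f≈g = minimalPolynomial-unique (isMin⇒minimalPolynomial m) m′

  -- Discards repetitions and the entries outside `Q`. It serves to list the distinct roots of a
  -- polynomial, and also to list an orbit inside a list of roots.
  distinct-elements : ∀ {q} (Q : Pred C q) → (∀ {x y} → x ≈ y → Q x → Q y) → ∀ βs →
    ∃[ αs ] Unique setoid αs × All Q αs × length αs ℕ.≤ length βs ×
      (∀ {x} → Q x → (∃[ β ] β ∈ˡ βs × x ≈ β) → ∃[ α ] α ∈ˡ αs × x ≈ α)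
  distinct-elements Q Q-resp []       = [] , [] , [] , ℕ.z≤n , λ { _ (_ , () , _) }
  distinct-elements Q Q-resp (β ∷ βs) = insert (distinct-elements Q Q-resp βs)
    where
    insert : _ → _
    insert (αs , uniq , all , len , covers) = by-cases (∃[ α ] α ∈ˡ αs × β ≈ α)
      (λ (α , α∈αs , β≈α) → αs , uniq , all , ℕ.m≤n⇒m≤1+n len ,
        λ { Qx (_ , here ≡.refl , x≈β) → α , α∈αs , trans x≈β β≈α
          ; Qx (γ , there γ∈βs , x≈γ) → covers Qx (γ , γ∈βs , x≈γ) })
      (λ β∉αs → by-cases (Q β)
        (λ Qβ → β ∷ αs , All.tabulate (λ α∈αs β≈α → β∉αs (_ , α∈αs , β≈α)) ∷ uniq , Qβ ∷ all , ℕ.s≤s len ,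
          λ { Qx (_ , here ≡.refl , x≈β) → β , here ≡.refl , x≈β
            ; Qx (γ , there γ∈βs , x≈γ) → let (α , α∈αs , x≈α) = covers Qx (γ , γ∈βs , x≈γ) in α , there α∈αs , x≈α })
        (λ ¬Qβ → αs , uniq , all , ℕ.m≤n⇒m≤1+n len ,
          λ { Qx (_ , here ≡.refl , x≈β) → contradiction (Q-resp x≈β Qx) ¬Qβ
            ; Qx (γ , there γ∈βs , x≈γ) → covers Qx (γ , γ∈βs , x≈γ) }))

  -- Carries a relation from powers to polynomials, and from basis vectors to the whole field.
  relation-combine : ∀ {n k} (a X : Fin n → C) (B : Fin k → Fin n → C) → (∀ j → X j ≈ sum (λ i → B i j)) →
                     (∀ i → sum (λ j → a j * B i j) ≈ 0#) → sum (λ j → a j * X j) ≈ 0#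
  relation-combine {n} {k} a X B X≈ Σ≈0 = begin
    sum (λ j → a j * X j) ≈⟨ sum-cong-≋ {n} (λ j → trans (*-congˡ (X≈ j)) (*-distribˡ-sum (a j) (λ i → B i j))) ⟩
    sum (λ j → sum (λ i → a j * B i j))  ≈⟨ ∑-comm (λ j i → a j * B i j) ⟩
    sum (λ i → sum (λ j → a j * B i j))  ≈⟨ sum-zero {k} Σ≈0 ⟩
    0#  ∎

  -- Were the minimal polynomial f of z ∈ L to have only e < d distinct roots, the e [L : E(z)] equations
  -- Σⱼ aⱼ Φⱼ(z)ⁱ Φⱼ(wₗ) = 0 would have a nontrivial solution, making the [L : E] homomorphisms Φⱼ dependent.
  many⇒separable : ∀ {E L n} → E ≤ L → HasDegree E L n → ManyExtensions E L n → ∀ {z} → z ∈ mem L → SeparableOver E z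
  many⇒separable {E} {L} {n} E≤L deg many {z} z∈L = analyse (generated {E} {L} {n} E≤L deg {z} z∈L) (many (inclusion E))
    where
    analyse : Generation E L n z →
              Σ (Fin n → Hom L) (λ Φ → (∀ i → Fixes E (Φ i)) × Distinct L Φ) → SeparableOver E z
    analyse (f , d , m , k , deg′@(w , W) , n≡kd) (Φ , fixed , distinct) = f , d , m ,
      count (splitting d f monic)
      where
      open IsMin m
      open SimpleExtension m
      module W = IsBasis W
      v : Fin n → C
      v j = fun (Φ j) z
      v-root : ∀ j → eval f (v j) ≈ 0#
      v-root j = trans (sym (eval-fixed {E} {L} (Φ j) E≤L (fixed j) over z∈L))
        (trans (Hom.cong (Φ j) (eval-closed L (All.map E≤L over) z∈L) root) (Hom.0-homo (Φ j)))
      dependent : ∀ αs → length αs ℕ.< d → (∀ j → eval ∏[X- αs ] (v j) ≈ 0#) → ⊥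
      dependent αs e<d vanish = solution (kernel ⊤ᴱ A (λ _ _ → lift tt)
        (≡.subst (k ℕ.* e ℕ.<_) (≡.sym n≡kd) (ℕ.*-monoʳ-< k {{ℕ.>-nonZero (degree-positive deg′)}} e<d)))
        where
        e = length αs
        entry : Fin k × Fin e → Fin n → C
        entry (l , i) j = v j ^ Fin.toℕ i * fun (Φ j) (w l)
        A : Fin (k ℕ.* e) → Fin n → C
        A q = entry (remQuot {k} e q)
        solution : (Σ (Fin n → C) λ a → (∀ j → a j ∈ mem ⊤ᴱ) × (∃[ j ] a j ≉0) × (∀ q → sum (λ j → A q j * a j) ≈ 0#)) → ⊥
        solution (a , _ , (j₀ , a≉0) , Aa≈0) = a≉0 (dedekind Φ distinct a (λ {y} y∈L → relation y (W.spanning y y∈L)) j₀)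
          where
          entries : ∀ l i → sum (λ j → a j * (v j ^ Fin.toℕ i * fun (Φ j) (w l))) ≈ 0#
          entries l i = begin
            sum (λ j → a j * entry (l , i) j) ≈⟨ sum-cong-≋ {n} (λ j → *-comm (a j) (entry (l , i) j)) ⟩
            sum (λ j → entry (l , i) j * a j) ≡⟨ ≡.cong (λ p → sum (λ j → entry p j * a j)) (Fin.remQuot-combine {k} {e} l i) ⟨
            sum (λ j → A (combine l i) j * a j)  ≈⟨ Aa≈0 (combine l i) ⟩
            0#  ∎
          polynomial : ∀ l {g} → g ∈ E [X] → sum (λ j → a j * (eval g (v j) * fun (Φ j) (w l))) ≈ 0#
          -- Dividing by the product over the distinct roots instead of `f` leaves a remainder of
          -- degree below `e` with the same values at all `v j`. That product may have coefficients
          -- outside `E`, hence `⊤ᴱ`.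
          polynomial l {g} g∈E = reduce (division ⊤ᴱ {e} {∏[X- αs ]} (All.universal (λ _ → lift tt) _) (∏-monic αs)
                                          {g} (All.universal (λ _ → lift tt) _))
            where
            reduce : (∃[ q ] ∃[ t ] q ∈ ⊤ᴱ [X] × t ∈ ⊤ᴱ [X] × Deg< e t × (∀ x → eval g x ≈ eval q x * eval ∏[X- αs ] x + eval t x)) →
                     sum (λ j → a j * (eval g (v j) * fun (Φ j) (w l))) ≈ 0#
            reduce (q , t , _ , _ , t< , eq) = relation-combine a (λ j → eval g (v j) * fun (Φ j) (w l))
              (λ (i : Fin e) j → coeff t (Fin.toℕ i) * (v j ^ Fin.toℕ i * fun (Φ j) (w l)))
              (λ j → begin
                eval g (v j) * fun (Φ j) (w l)
                  ≈⟨ *-congʳ (trans (eq (v j)) (trans (+-congʳ (trans (*-congˡ (vanish j)) (zeroʳ _))) (+-identityˡ _))) ⟩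
                eval t (v j) * fun (Φ j) (w l)
                  ≈⟨ *-congʳ (eval-coeffs e t (v j) t<) ⟩
                sum {e} (λ i → coeff t (Fin.toℕ i) * v j ^ Fin.toℕ i) * fun (Φ j) (w l)
                  ≈⟨ *-distribʳ-sum {e} (fun (Φ j) (w l)) (λ i → coeff t (Fin.toℕ i) * v j ^ Fin.toℕ i) ⟩
                sum {e} (λ i → coeff t (Fin.toℕ i) * v j ^ Fin.toℕ i * fun (Φ j) (w l))
                  ≈⟨ sum-cong-≋ {e} (λ i → *-assoc _ _ _) ⟩
                sum {e} (λ i → coeff t (Fin.toℕ i) * (v j ^ Fin.toℕ i * fun (Φ j) (w l))) ∎)
              (λ i → trans (sum-*-assoc a (coeff t (Fin.toℕ i)) (λ j → v j ^ Fin.toℕ i * fun (Φ j) (w l)))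
                (trans (*-congˡ (entries l i)) (zeroʳ _)))
          relation : ∀ y → y ∈ Span adjoin w → sum (λ j → a j * fun (Φ j) y) ≈ 0#
          relation y (e′ , e′∈ , y≈) = relation-combine a (λ j → fun (Φ j) y)
            (λ l j → fun (Φ j) (e′ l) * fun (Φ j) (w l))
            (λ j → trans (sym (Hom.cong (Φ j) (SubfieldProperties.sum-closed L (λ l → Subfield.*-closed L (e′∈L l) (W.members l))) (sym y≈)))
                     (Hom.linear-homo (Φ j) e′∈L W.members))
            (λ l → trans (sum-cong-≋ {n} (λ j → *-congˡ (*-congʳ (image j (e′∈ l))))) (polynomial l (proj₁ (proj₂ (e′∈ l)))))
            where
            e′∈L : ∀ l → e′ l ∈ mem L
            e′∈L l = adjoin≤ {L} E≤L z∈L (e′∈ l)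
            image : ∀ {y} j (y∈ : y ∈ mem adjoin) → fun (Φ j) y ≈ eval (proj₁ y∈) (v j)
            image j y∈@(g , g∈E , y≈) = trans (Hom.cong (Φ j) (adjoin≤ {L} E≤L z∈L y∈) y≈)
              (eval-fixed {E} {L} (Φ j) E≤L (fixed j) g∈E z∈L)
      count : ∃[ βs ] length βs ≡ d × f ≈ₚ ∏[X- βs ] → Squarefree f
      count (βs , len , f≈∏) = conclude (distinct-elements (λ x → eval f x ≈ 0#)
          (λ x≈y fx≈0 → trans (sym (eval-congˡ f x≈y)) fx≈0) βs)
        where
        conclude : ∃[ αs ] Unique setoid αs × All (λ x → eval f x ≈ 0#) αs × length αs ℕ.≤ length βs ×
          (∀ {x} → eval f x ≈ 0# → (∃[ β ] β ∈ˡ βs × x ≈ β) → ∃[ α ] α ∈ˡ αs × x ≈ α) → Squarefree f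
        conclude (αs , uniq , roots , len′ , covers) = from-size (ℕ.m≤n⇒m<n∨m≡n (≡.subst (length αs ℕ.≤_) len len′))
          where
          from-size : length αs ℕ.< d ⊎ length αs ≡ d → Squarefree f
          from-size (inj₁ e<d) = ⊥-elim (dependent αs e<d λ j →
            let (α , α∈αs , vj≈α) = covers (v-root j) (root-∏ βs (trans (sym (eval-congʳ f ∏[X- βs ] f≈∏ (v j))) (v-root j)))
            in ∏-root α∈αs vj≈α)
          -- With `d` distinct roots, the monic `f` is the product over them.
          from-size (inj₂ e≡d) x common = unique⇒squarefree uniq x (commonRoot-cong {f} {∏[X- αs ]}
            (monic-unique f ∏[X- αs ] uniq (≡.subst (λ k → MonicOf k f) (≡.sym e≡d) monic) (∏-monic αs) roots (∏-roots αs)) common)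

-- The maximal separable subextension.

module MaximalSeparable {c ℓ₁ ℓ₂ : Level} (em : ∀ {a} → ExcludedMiddle a) (K̄ : HeytingField c ℓ₁ ℓ₂)
  {K₀ : FieldTheory.Subfield em K̄} (closure : FieldTheory.IsAlgebraicClosureOf em K̄ K₀) where
  open FieldTheory em K̄ hiding (r; s; l)
  open Field em K̄
  open Polynomials em K̄
  open ClosedField em K̄ closure
  open MinimalPolynomials em K̄ closure
  open Homomorphisms em K̄ closure
  open Frobenius em K̄
  open Separability em K̄ closure
  open Subfield using (mem)
  open Hom using (fun)
  open import Algebra.Properties.Semiring.Mult semiring
    using () renaming (×-homo-+ to ·-homo-+; ×1-homo-* to ·1-homo-*)
  open import Data.Nat.DivMod using (_/_; _%_; m≡m%n+[m/n]*n; m%n<n)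

  private
    u : Level
    u = c ⊔ ℓ₁

  isMin-resp : ∀ {E f x y d} → x ≈ y → IsMin E f x d → IsMin E f y d
  isMin-resp {f = f} x≈y m = isMin-conjugate m (trans (eval-congˡ f (sym x≈y)) (IsMin.root m))

  separable-resp : ∀ {E x y} → x ≈ y → SeparableOver E x → SeparableOver E y
  separable-resp x≈y (f , d , m , sqf) = f , d , isMin-resp x≈y m , sqf

  base-separable : ∀ {E a} → a ∈ mem E → SeparableOver E a
  base-separable {E} {a} a∈E = ∏[X- a ∷ [] ] , 1 , record
    { over    = *ₚ-closed E (neg-closed a∈E ∷ 1-closed ∷ []) (1-closed ∷ [])
    ; monic   = ∏-monic (a ∷ [])
    ; root    = ∏-root {a ∷ []} (here ≡.refl) refl
    ; minimal = λ {g} _ g< ga≈0 → many-roots⇒zero g ([] ∷ []) (ga≈0 ∷ []) g<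
    } , unique⇒squarefree ([] ∷ [])
    where open SubfieldProperties E

  -- This gives closure under the field operations. Adjoining `x` and then `y` produces as many
  -- embeddings as the degree, so by `many⇒separable` every element of the resulting field is
  -- separable.
  two-separable : ∀ {E x y} → SeparableOver E x → SeparableOver E y →
                  ∃[ F ] E ≤ F × x ∈ mem F × y ∈ mem F × (∀ {z} → z ∈ mem F → SeparableOver E z)
  two-separable {E} {x} {y} (f , d , m , sqf) sep-y = second (separable-over {E} {F₁.adjoin} F₁.base≤adjoin sep-y)
    where
    module F₁ = SimpleExtension m
    second : SeparableOver F₁.adjoin y →
             ∃[ F ] E ≤ F × x ∈ mem F × y ∈ mem F × (∀ {z} → z ∈ mem F → SeparableOver E z)
    second (g , e , m′ , sqf′) = F₂.adjoin , E≤F₂ , F₂.base≤adjoin F₁.generator , F₂.generator ,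
      many⇒separable {E} {F₂.adjoin} E≤F₂
        (tower {E} {F₁.adjoin} {F₂.adjoin} F₁.base≤adjoin F₂.base≤adjoin F₁.adjoin-degree F₂.adjoin-degree)
        (many-trans {E} {F₁.adjoin} {F₂.adjoin} F₁.base≤adjoin F₂.base≤adjoin (adjoin-many m sqf) (adjoin-many m′ sqf′))
      where
      module F₂ = SimpleExtension m′
      E≤F₂ : E ≤ F₂.adjoin
      E≤F₂ a∈E = F₂.base≤adjoin (F₁.base≤adjoin a∈E)

  separableClosure : ∀ {E L} → E ≤ L → Subfield
  separableClosure {E} {L} E≤L = record
    { mem        = λ x → x ∈ mem L × SeparableOver E x
    ; resp       = λ x≈y (x∈L , sep) → L.resp x≈y x∈L , separable-resp x≈y sep
    ; 0-closed   = L.0-closed , base-separable E.0-closed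
    ; 1-closed   = L.1-closed , base-separable E.1-closed
    ; +-closed   = λ (x∈L , sep-x) (y∈L , sep-y) → L.+-closed x∈L y∈L ,
        within sep-x sep-y (λ F x∈F y∈F → Subfield.+-closed F x∈F y∈F)
    ; *-closed   = λ (x∈L , sep-x) (y∈L , sep-y) → L.*-closed x∈L y∈L ,
        within sep-x sep-y (λ F x∈F y∈F → Subfield.*-closed F x∈F y∈F)
    ; neg-closed = λ (x∈L , sep-x) → L.neg-closed x∈L ,
        within sep-x sep-x (λ F x∈F _ → Subfield.neg-closed F x∈F)
    ; inv-closed = λ (x∈L , sep-x) xy≈1 → L.inv-closed x∈L xy≈1 ,
        within sep-x sep-x (λ F x∈F _ → Subfield.inv-closed F x∈F xy≈1)
    }
    where
    module E = Subfield E
    module L = Subfield L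
    within : ∀ {x y z} → SeparableOver E x → SeparableOver E y →
             (∀ F → x ∈ mem F → y ∈ mem F → z ∈ mem F) → SeparableOver E z
    within sep-x sep-y z∈F = let (F , _ , x∈F , y∈F , sep-F) = two-separable sep-x sep-y in sep-F (z∈F F x∈F y∈F)

  separableClosure-maximal : ∀ {E L} (E≤L : E ≤ L) → IsMaximalSeparable E L (separableClosure {E} {L} E≤L)
  separableClosure-maximal E≤L = record
    { lower     = λ a∈E → E≤L a∈E , base-separable a∈E
    ; upper     = proj₁
    ; separable = λ x (_ , sep) → separable-from sep
    ; greatest  = λ N _ N≤L sep {x} x∈N → N≤L x∈N , separable-to (sep x x∈N)
    }

  maximalSeparable-isMaximal : ∀ {E L} → E ≤ L → IsMaximalSeparable E L (maximalSeparable E L)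
  maximalSeparable-isMaximal {E} {L} E≤L = choose-satisfies E (IsMaximalSeparable E L)
    (separableClosure {E} {L} E≤L , separableClosure-maximal {E} {L} E≤L)

  maximalSeparable-contains : ∀ {E L x} → E ≤ L → x ∈ mem L → SeparableOver E x → x ∈ mem (maximalSeparable E L)
  maximalSeparable-contains {E} {L} E≤L x∈L sep =
    IsMaximalSeparable.greatest (maximalSeparable-isMaximal {E} {L} E≤L) (separableClosure {E} {L} E≤L)
      S.lower S.upper S.separable (x∈L , sep)
    where module S = IsMaximalSeparable (separableClosure-maximal {E} {L} E≤L)

  -- Uniqueness alone; for finite extensions existence is `extension-exists`.
  UniqueExtensions : Subfield → Subfield → Set u
  UniqueExtensions M L = ∀ (φ ψ : Hom L) → fun φ ≈[ M ] fun ψ → fun φ ≈[ L ] fun ψ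

  drop : ℕ → Poly → Poly
  drop = List.drop

  coeff-drop : ∀ q f n → coeff (drop q f) n ≡ coeff f (q ℕ.+ n)
  coeff-drop zero    f       n = ≡.refl
  coeff-drop (suc q) []      n = ≡.refl
  coeff-drop (suc q) (a ∷ f) n = coeff-drop q f n

  drop-closed : ∀ {E} q {f} → f ∈ E [X] → drop q f ∈ E [X]
  drop-closed     zero    f∈E         = f∈E
  drop-closed     (suc q) []          = []
  drop-closed {E} (suc q) (a∈E ∷ f∈E) = drop-closed {E} q f∈E

  eval-drop : ∀ q f x → (∀ i → i ℕ.< q → coeff f i ≈ 0#) → eval f x ≈ x ^ q * eval (drop q f) x
  eval-drop zero    f       x low≈0 = sym (*-identityˡ _)
  eval-drop (suc q) []      x low≈0 = sym (zeroʳ _)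
  eval-drop (suc q) (a ∷ f) x low≈0 = begin
    a + x * eval f x ≈⟨ +-cong (low≈0 0 (ℕ.s≤s ℕ.z≤n)) (*-congˡ (eval-drop q f x (λ i i<q → low≈0 (suc i) (ℕ.s≤s i<q)))) ⟩
    0# + x * (x ^ q * eval (drop q f) x) ≈⟨ solve 3 (λ x y z → :0 :+ x :* (y :* z) := x :* y :* z) refl x (x ^ q) _ ⟩
    x * x ^ q * eval (drop q f) x  ∎

  module Contract (p : ℕ) where

    -- The numbers q (p + 1) + (t + 1) with t < p are those not divisible by p + 1.
    Vanishing : Poly → Set ℓ₁
    Vanishing f = ∀ q t → t ℕ.< p → coeff f (q ℕ.* suc p ℕ.+ suc t) ≈ 0#

    -- For vanishing `f` of degree below `k * suc p`, the polynomial `g` with `f = g(X^(p+1))`. The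
    -- number `k` of coefficients to collect makes the recursion structural.
    contract : ℕ → Poly → Poly
    contract zero    f = []
    contract (suc k) f = coeff f 0 ∷ contract k (drop (suc p) f)

    contract-length : ∀ k f → length (contract k f) ≡ k
    contract-length zero    f = ≡.refl
    contract-length (suc k) f = ≡.cong suc (contract-length k _)

    coeff-contract : ∀ k f i → i ℕ.< k → coeff (contract k f) i ≡ coeff f (i ℕ.* suc p)
    coeff-contract (suc k) f zero    i<k         = ≡.refl
    coeff-contract (suc k) f (suc i) (ℕ.s≤s i<k) =
      ≡.trans (coeff-contract k (drop (suc p) f) i i<k) (coeff-drop (suc p) f (i ℕ.* suc p))

    contract-closed : ∀ {E} k {f} → f ∈ E [X] → contract k f ∈ E [X]
    contract-closed zero    f∈E = []
    contract-closed {E} (suc k) f∈E = coeff-closed E f∈E 0 ∷ contract-closed {E} k (drop-closed {E} (suc p) f∈E)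

    eval-contract : ∀ k f x → Vanishing f → Deg< (k ℕ.* suc p) f → eval f x ≈ eval (contract k f) (x ^ suc p)
    eval-contract zero    f x van f< = eval-zero f x (λ n → f< n ℕ.z≤n)
    eval-contract (suc k) f x van f< = begin
      eval f x
        ≈⟨ split f (λ t t<p → van 0 t t<p) ⟩
      coeff f 0 + x ^ suc p * eval (drop (suc p) f) x
        ≈⟨ +-congˡ (*-congˡ (eval-contract k (drop (suc p) f) x
             (λ q t t<p → trans (reflexive (≡.trans (coeff-drop (suc p) f (q ℕ.* suc p ℕ.+ suc t))
               (≡.cong (coeff f) (≡.sym (ℕ.+-assoc (suc p) (q ℕ.* suc p) (suc t)))))) (van (suc q) t t<p))
             (λ n k≤n → trans (reflexive (coeff-drop (suc p) f n)) (f< (suc p ℕ.+ n) (ℕ.+-monoʳ-≤ (suc p) k≤n))))) ⟩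
      coeff f 0 + x ^ suc p * eval (contract k (drop (suc p) f)) (x ^ suc p) ∎
      where
      split : ∀ f → (∀ t → t ℕ.< p → coeff f (suc t) ≈ 0#) → eval f x ≈ coeff f 0 + x ^ suc p * eval (drop (suc p) f) x
      split []      low≈0 = solve 1 (λ y → :0 := :0 :+ y :* :0) refl (x ^ suc p)
      split (a ∷ f) low≈0 = +-congˡ (trans (*-congˡ (eval-drop p f x low≈0)) (sym (*-assoc _ _ _)))

  deriv≈0⇒coeff≈0 : ∀ f n → deriv f ≈ₚ [] → n · 1# ≉0 → coeff f n ≈ 0#
  deriv≈0⇒coeff≈0 f zero    f′≈0 n≉0 = contradiction refl n≉0
  deriv≈0⇒coeff≈0 f (suc n) f′≈0 n≉0 = x≉0∧xy≈0⇒y≈0 n≉0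
    (trans (sym (·-* (suc n) (coeff f (suc n)))) (trans (sym (coeff-deriv f n)) (f′≈0 n)))

  characteristic≢1 : ∀ p → suc p · 1# ≈ 0# → 1 ℕ.≤ p
  characteristic≢1 zero    char = contradiction (trans (sym (+-identityʳ 1#)) char) 1≉0
  characteristic≢1 (suc _) char = ℕ.s≤s ℕ.z≤n

  module _ {E f x d} (m : IsMin E f x d) (f′≈0 : deriv f ≈ₚ []) where
    open IsMin m

    -- The leading term contributes `d · 1#` to the derivative, so this multiple of 1 with `d`
    -- positive is zero.
    positive-characteristic : ∃[ p ] (suc p · 1#) ≈ 0# × (∀ k → k ℕ.< p → ¬ (suc k · 1#) ≈ 0#)
    positive-characteristic = least (degree d (isMin-positive m) (proj₁ monic))
      where
      degree : ∀ d → ¬ d ≡ 0 → coeff f d ≈ 1# → ∃[ p ] (suc p · 1#) ≈ 0#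
      degree zero    d≢0 _    = contradiction ≡.refl d≢0
      degree (suc d) _   f₁≈1 = d , by-contradiction _ (λ d≉0 →
        1≉0 (trans (sym f₁≈1) (deriv≈0⇒coeff≈0 f (suc d) f′≈0 d≉0)))

    module _ {p} (char : suc p · 1# ≈ 0#) (least : ∀ k → k ℕ.< p → ¬ (suc k · 1#) ≈ 0#) where
      open Contract p

      multiple·1≈0 : ∀ q n → (q ℕ.* suc p ℕ.+ n) · 1# ≈ n · 1#
      multiple·1≈0 q n = begin
        (q ℕ.* suc p ℕ.+ n) · 1#  ≈⟨ ·-homo-+ 1# (q ℕ.* suc p) n ⟩
        (q ℕ.* suc p) · 1# + n · 1#  ≈⟨ +-congʳ (·1-homo-* q (suc p)) ⟩
        (q · 1#) * (suc p · 1#) + n · 1#  ≈⟨ +-congʳ (trans (*-congˡ char) (zeroʳ _)) ⟩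
        0# + n · 1#  ≈⟨ +-identityˡ _ ⟩
        n · 1#  ∎

      vanishing : Vanishing f
      vanishing q t t<p = deriv≈0⇒coeff≈0 f (q ℕ.* suc p ℕ.+ suc t) f′≈0
        (λ eq → least t t<p (trans (sym (multiple·1≈0 q (suc t))) eq))

      p-positive : 1 ℕ.≤ p
      p-positive = characteristic≢1 p char

      -- Collecting `d` coefficients suffices, because `d < d * suc p`; it also makes the degree of
      -- the contraction smaller than `d` by its length alone.
      contract-root : eval (contract d f) (x ^ suc p) ≈ 0#
      contract-root = trans (sym (eval-contract d f x vanishing (Deg<-weaken {f} (bound d (isMin-positive m)) (proj₂ monic)))) root
        where
        bound : ∀ d → ¬ d ≡ 0 → suc d ℕ.≤ d ℕ.* suc p
        bound zero    d≢0 = contradiction ≡.refl d≢0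
        bound (suc d) _   = ℕ.m<m*n (suc d) (suc p) (ℕ.s≤s p-positive)

      -- The leading coefficient does not vanish, so `d` is a multiple of `suc p`, and that
      -- coefficient survives in the contraction at position `q`.
      contract-nonzero : ¬ contract d f ≈ₚ []
      contract-nonzero eq = 1≉0 (begin
        1#  ≈⟨ proj₁ monic ⟨
        coeff f d ≈⟨ by-remainder (d % suc p) (m%n<n d (suc p)) (m≡m%n+[m/n]*n d (suc p)) ⟩
        0#  ∎)
        where
        q = d / suc p
        by-remainder : ∀ t → t ℕ.< suc p → d ≡ t ℕ.+ q ℕ.* suc p → coeff f d ≈ 0#
        by-remainder (suc t) (ℕ.s≤s t<p) d≡ = trans
          (reflexive (≡.cong (coeff f) (≡.trans d≡ (ℕ.+-comm (suc t) (q ℕ.* suc p))))) (vanishing q t t<p)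
        by-remainder zero _ d≡ = trans (reflexive (≡.trans (≡.cong (coeff f) d≡) (≡.sym (coeff-contract d f q q<d)))) (eq q)
          where
          q<qp : ∀ q → ¬ q ℕ.* suc p ≡ 0 → q ℕ.< q ℕ.* suc p
          q<qp zero    ≢0 = contradiction ≡.refl ≢0
          q<qp (suc q) _  = ℕ.m<m*n (suc q) (suc p) (ℕ.s≤s p-positive)
          q<d : q ℕ.< d
          q<d = ≡.subst (q ℕ.<_) (≡.sym d≡) (q<qp q (λ q≡0 → isMin-positive m (≡.trans d≡ q≡0)))

      power-degree : ∃[ g ] ∃[ e ] IsMin E g (x ^ suc p) e × e ℕ.< d
      power-degree = smaller (isMin-exists E (contract d f , contract-closed {E} d over , contract-nonzero , contract-root))
        where
        smaller : ∃[ g ] ∃[ e ] IsMin E g (x ^ suc p) e → ∃[ g ] ∃[ e ] IsMin E g (x ^ suc p) e × e ℕ.< d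
        smaller (g , e , m′) with e ℕ.<? d
        ... | yes e<d = g , e , m′ , e<d
        ... | no e≮d  = contradiction (IsMin.minimal m′ (contract-closed {E} d over)
          (Deg<-weaken {contract d f} (ℕ.≤-trans (ℕ.≤-reflexive (contract-length d f)) (ℕ.≮⇒≥ e≮d)) (Deg<-length (contract d f)))
          contract-root) contract-nonzero

  ^-homo : ∀ {L} (φ : Hom L) {x} n → x ∈ mem L → fun φ (x ^ n) ≈ fun φ x ^ n
  ^-homo φ zero    x∈L = Hom.1-homo φ
  ^-homo {L} φ (suc n) x∈L = trans (Hom.*-homo φ x∈L (^-closed L n x∈L)) (*-congˡ (^-homo {L} φ n x∈L))

  -- If the minimal polynomial of x is not squarefree it is a polynomial in X^p, so x^p has smaller degree.
  maximalSeparable-unique : ∀ {E L n} → E ≤ L → HasDegree E L n → UniqueExtensions (maximalSeparable E L) L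
  maximalSeparable-unique {E} {L} E≤L deg φ ψ agree {x} x∈L =
    conclude (isMin-exists E (finite⇒algebraic {E} {L} deg x∈L))
    where
    Agrees : ℕ → Set (c ⊔ ℓ₁)
    Agrees d = ∀ {x f} → x ∈ mem L → IsMin E f x d → fun φ x ≈ fun ψ x
    step : ∀ d → (∀ {e} → e ℕ.< d → Agrees e) → Agrees d
    step d rec {x} {f} x∈L m = by-cases (Squarefree f)
      (λ sqf → agree (maximalSeparable-contains {E} {L} E≤L x∈L (f , d , m , sqf)))
      (λ ¬sqf → inseparable (isMin-squarefree m ¬sqf))
      where
      inseparable : deriv f ≈ₚ [] → fun φ x ≈ fun ψ x
      inseparable f′≈0 = in-characteristic (positive-characteristic m f′≈0)
        where
        in-characteristic : ∃[ p ] (suc p · 1#) ≈ 0# × (∀ k → k ℕ.< p → ¬ (suc k · 1#) ≈ 0#) → fun φ x ≈ fun ψ x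
        in-characteristic (p , char , least) = descend (power-degree m f′≈0 char least)
          where
          descend : ∃[ g ] ∃[ e ] IsMin E g (x ^ suc p) e × e ℕ.< d → fun φ x ≈ fun ψ x
          descend (g , e , m′ , e<d) = frobenius-injective char least (begin
            fun φ x ^ suc p  ≈⟨ ^-homo {L} φ (suc p) x∈L ⟨
            fun φ (x ^ suc p)  ≈⟨ rec e<d (^-closed L (suc p) x∈L) m′ ⟩
            fun ψ (x ^ suc p)  ≈⟨ ^-homo {L} ψ (suc p) x∈L ⟩
            fun ψ x ^ suc p  ∎)
    conclude : ∃[ f ] ∃[ d ] IsMin E f x d → fun φ x ≈ fun ψ x
    conclude (f , d , m) = <-rec Agrees step d x∈L m

-- Counting embeddings, automorphisms and conjugates.

module Counting {c ℓ₁ ℓ₂ : Level} (em : ∀ {a} → ExcludedMiddle a) (K̄ : HeytingField c ℓ₁ ℓ₂)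
  {K₀ : FieldTheory.Subfield em K̄} (closure : FieldTheory.IsAlgebraicClosureOf em K̄ K₀) where
  open FieldTheory em K̄
  open Field em K̄
  open MinimalPolynomials em K̄ closure
  open Homomorphisms em K̄ closure
  open Separability em K̄ closure
  open MaximalSeparable em K̄ closure
  open Subfield using (mem)
  open Hom using (fun)
  open import Algebra.Morphism.Structures using (module IsRingIsomorphism)
  open import Function.Bundles using (Inverse)
  open import Data.Fin.Permutation using (↔⇒≡)
  import Function.Construct.Composition as Composition
  import Function.Construct.Symmetry as Symmetry
  open import Relation.Binary.Bundles using (Setoid)

  private
    u : Level
    u = c ⊔ ℓ₁

  Finite : ∀ {a ℓ} → ℕ → Setoid a ℓ → Set _
  Finite n S = Inverse (≡.setoid (Fin n)) S

  enumeration : ∀ {a ℓ n} (S : Setoid a ℓ) → let open Setoid S renaming (Carrier to A; _≈_ to _∼_) in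
                (g : Fin n → A) → (∀ i j → g i ∼ g j → i ≡ j) → (∀ x → ∃[ i ] x ∼ g i) → Finite n S
  enumeration S g distinct complete = record
    { to        = g
    ; from      = λ x → proj₁ (complete x)
    ; to-cong   = λ { ≡.refl → S.refl }
    ; from-cong = λ {x} {y} x∼y → distinct _ _ (S.trans (S.sym (proj₂ (complete x))) (S.trans x∼y (proj₂ (complete y))))
    ; inverse   = (λ { {x} ≡.refl → S.sym (proj₂ (complete x)) })
                , (λ {i} {x} x∼gi → distinct _ _ (S.trans (S.sym (proj₂ (complete x))) x∼gi))
    }
    where module S = Setoid S

  finite-unique : ∀ {a ℓ m n} {S : Setoid a ℓ} → Finite m S → Finite n S → m ≡ n
  finite-unique F G = ↔⇒≡ (Composition.inverse F (Symmetry.inverse G))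

  finite-card : ∀ {a ℓ n} {S : Setoid a ℓ} → Finite n S → Finite (card S) S
  finite-card {n = n} {S} F = choose-satisfies 0 (λ n → Finite n S) (n , F)

  card-unique : ∀ {a ℓ n} {S : Setoid a ℓ} → Finite n S → card S ≡ n
  card-unique F = finite-unique (finite-card F) F

  -- Each of the `N` classes holds at most one element up to equality; running through them, a
  -- representative is kept only if it is new. This excludes the default value of `card` for
  -- automorphisms and conjugates before their numbers are known.
  covered⇒finite : ∀ {a ℓ p} (S : Setoid a ℓ) → let open Setoid S renaming (Carrier to A; _≈_ to _∼_) in
    ∀ N (P : Fin N → A → Set p) → (∀ x → ∃[ i ] P i x) → (∀ i {x y} → P i x → P i y → x ∼ y) →
    ∃[ n ] Finite n S
  covered⇒finite {p = p} S N P cover unique =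
    let (n , g , distinct , complete) = collect N P unique
    in n , enumeration S g distinct (λ x → complete (proj₁ (cover x)) (proj₂ (cover x)))
    where
    open Setoid S renaming (Carrier to A; _≈_ to _∼_; sym to ∼-sym; trans to ∼-trans; refl to ∼-refl)
    Collected : ∀ N → (Fin N → A → Set p) → Set _
    Collected N P = ∃[ n ] Σ (Fin n → A) λ g → (∀ i j → g i ∼ g j → i ≡ j) × (∀ i {x} → P i x → ∃[ j ] x ∼ g j)
    collect : ∀ N (P : Fin N → A → Set p) → (∀ i {x y} → P i x → P i y → x ∼ y) → Collected N P
    collect zero    P unique = 0 , (λ ()) , (λ ()) , (λ ())
    collect (suc N) P unique = insert (collect N (λ i → P (suc i)) (λ i → unique (suc i)))
      where
      insert : Collected N (λ i → P (suc i)) → Collected (suc N) P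
      insert (n , g , distinct , complete) = by-cases (∃[ x ] P zero x × ¬ (∃[ j ] x ∼ g j))
        (λ (x , Px , x∉g) → suc n , (x ∷ᵥ g) ,
          (λ { zero    zero    eq → ≡.refl
             ; zero    (suc j) eq → contradiction (j , eq) x∉g
             ; (suc i) zero    eq → contradiction (i , ∼-sym eq) x∉g
             ; (suc i) (suc j) eq → ≡.cong suc (distinct i j eq) }) ,
          (λ { zero    Py → zero , unique zero Py Px
             ; (suc i) Py → let (j , eq) = complete i Py in suc j , eq }))
        (λ ∄x → n , g , distinct ,
          (λ { zero    {y} Py → by-contradiction _ (λ y∉g → ∄x (y , Py , y∉g))
             ; (suc i) Py → complete i Py }))

  module _ {E L M : Subfield} (σ : Iso E L M) where
    private module σ = IsRingIsomorphism (Iso.isRingIsomorphism σ)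

    -- An isomorphism takes its argument together with a membership proof. Choosing any such proof
    -- yields a function on `C`, and the congruence of `σ` makes the choice harmless.
    iso-fun : C → C
    iso-fun x = choose 0# (λ y → Σ (x ∈ mem L) λ x∈L → y ≈ proj₁ (Iso.to σ (x , x∈L)))

    iso-value : ∀ {x} (x∈L : x ∈ mem L) → iso-fun x ≈ proj₁ (Iso.to σ (x , x∈L))
    iso-value {x} x∈L = let (x∈L′ , eq) = choose-satisfies 0# (λ y → Σ (x ∈ mem L) λ x∈L → y ≈ proj₁ (Iso.to σ (x , x∈L))) (_ , x∈L , refl)
                        in trans eq (σ.⟦⟧-cong {x , x∈L′} {x , x∈L} refl)

    iso⇒hom : Hom L
    iso⇒hom = record
      { fun    = iso-fun
      ; cong = λ {x} {y} x∈L x≈y → trans (iso-value x∈L) (trans (σ.⟦⟧-cong {x , x∈L} {y , L.resp x≈y x∈L} x≈y) (sym (iso-value _)))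
      ; +-homo = λ x∈L y∈L → trans (iso-value (L.+-closed x∈L y∈L))
          (trans (σ.+-homo (_ , x∈L) (_ , y∈L)) (sym (+-cong (iso-value x∈L) (iso-value y∈L))))
      ; *-homo = λ x∈L y∈L → trans (iso-value (L.*-closed x∈L y∈L))
          (trans (σ.*-homo (_ , x∈L) (_ , y∈L)) (sym (*-cong (iso-value x∈L) (iso-value y∈L))))
      ; 1-homo = trans (iso-value L.1-closed) σ.1#-homo
      }
      where module L = Subfield L

    iso-fixes : E ≤ L → Fixes E iso⇒hom
    iso-fixes E≤L x∈E = trans (iso-value (E≤L x∈E)) (Iso.fixes σ _ x∈E)

    iso-into : ∀ {x} → x ∈ mem L → iso-fun x ∈ mem M
    iso-into x∈L = Subfield.resp M (sym (iso-value x∈L)) (proj₂ (Iso.to σ (_ , x∈L)))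

    iso-onto : ∀ {y} → y ∈ mem M → ∃[ x ] x ∈ mem L × iso-fun x ≈ y
    iso-onto {y} y∈M = let ((x , x∈L) , eq) = σ.surjective (y , y∈M)
                       in x , x∈L , trans (iso-value x∈L) (eq {x , x∈L} refl)

  hom⇒iso : ∀ {E L M} (φ : Hom L) → Fixes E φ → (∀ {x} → x ∈ mem L → fun φ x ∈ mem M) →
            (∀ {y} → y ∈ mem M → ∃[ x ] x ∈ mem L × fun φ x ≈ y) → Iso E L M
  hom⇒iso {E} {L} {M} φ fixed into onto = record
    { to = λ (x , x∈L) → fun φ x , into x∈L
    ; isRingIsomorphism = record
      { isRingMonomorphism = record
        { isRingHomomorphism = record
          { isSemiringHomomorphism = record
            { isNearSemiringHomomorphism = record
              { +-isMonoidHomomorphism = record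
                { isMagmaHomomorphism = record
                  { isRelHomomorphism = record { cong = λ {(x , x∈L)} x≈y → φ.cong x∈L x≈y }
                  ; homo = λ (x , x∈L) (y , y∈L) → φ.+-homo x∈L y∈L
                  }
                ; ε-homo = φ.0-homo
                }
              ; *-homo = λ (x , x∈L) (y , y∈L) → φ.*-homo x∈L y∈L
              }
            ; 1#-homo = φ.1-homo
            }
          ; -‿homo = λ (x , x∈L) → φ.neg-homo x∈L
          }
        ; injective = λ {(x , x∈L)} {(y , y∈L)} eq → φ.injective x∈L y∈L eq
        }
      ; surjective = λ (y , y∈M) → let (x , x∈L , eq) = onto y∈M in
          (x , x∈L) , λ {(z , z∈L)} z≈x → trans (φ.cong z∈L z≈x) eq
      }
    ; fixes = λ (x , x∈L) x∈E → fixed x∈E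
    }
    where module φ = Hom φ

  image : ∀ {L} → Hom L → Subfield
  image {L} φ = record
    { mem        = λ y → ∃[ x ] x ∈ mem L × fun φ x ≈ y
    ; resp       = λ y≈z (x , x∈L , eq) → x , x∈L , trans eq y≈z
    ; 0-closed   = _ , L.0-closed , φ.0-homo
    ; 1-closed   = _ , L.1-closed , φ.1-homo
    ; +-closed = λ (x , x∈L , eq) (y , y∈L , eq′) → _ , L.+-closed x∈L y∈L , trans (φ.+-homo x∈L y∈L) (+-cong eq eq′)
    ; *-closed = λ (x , x∈L , eq) (y , y∈L , eq′) → _ , L.*-closed x∈L y∈L , trans (φ.*-homo x∈L y∈L) (*-cong eq eq′)
    ; neg-closed = λ (x , x∈L , eq) → _ , L.neg-closed x∈L , trans (φ.neg-homo x∈L) (-‿cong eq)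
    ; inv-closed = λ {a} {b} (x , x∈L , eq) ab≈1 → inverse-image x∈L eq ab≈1 (inverse (x≉0 x∈L eq ab≈1))
    }
    where
    module φ = Hom φ
    module L = Subfield L
    x≉0 : ∀ {x a b} → x ∈ mem L → fun φ x ≈ a → a * b ≈ 1# → x ≉0
    x≉0 {x} {a} {b} x∈L eq ab≈1 x≈0 = 1≉0 (begin
      1#  ≈⟨ ab≈1 ⟨
      a * b  ≈⟨ *-congʳ eq ⟨
      fun φ x * b  ≈⟨ *-congʳ (trans (φ.cong x∈L x≈0) φ.0-homo) ⟩
      0# * b  ≈⟨ zeroˡ b ⟩
      0#  ∎)
    inverse-image : ∀ {x a b} → x ∈ mem L → fun φ x ≈ a → a * b ≈ 1# → ∃[ w ] x * w ≈ 1# → ∃[ w ] w ∈ mem L × fun φ w ≈ b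
    inverse-image {x} {a} {b} x∈L eq ab≈1 (w , xw≈1) = w , w∈L , (begin
      fun φ w  ≈⟨ *-identityʳ _ ⟨
      fun φ w * 1#  ≈⟨ *-congˡ ab≈1 ⟨
      fun φ w * (a * b)  ≈⟨ solve 3 (λ w a b → w :* (a :* b) := a :* w :* b) refl _ a b ⟩
      a * fun φ w * b  ≈⟨ *-congʳ (*-congʳ eq) ⟨
      fun φ x * fun φ w * b ≈⟨ *-congʳ (trans (sym (φ.*-homo x∈L w∈L)) (trans (φ.cong (L.*-closed x∈L w∈L) xw≈1) φ.1-homo)) ⟩
      1# * b  ≈⟨ *-identityˡ b ⟩
      b  ∎)
      where w∈L = L.inv-closed x∈L xw≈1

  Embeddings : Subfield → Subfield → Setoid u u
  Embeddings E L = record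
    { Carrier = Σ (Hom L) λ φ → Fixes E φ
    ; _≈_ = λ (φ , _) (ψ , _) → fun φ ≈[ L ] fun ψ
    ; isEquivalence = record
      { refl  = λ _ → refl
      ; sym   = λ p x∈L → sym (p x∈L)
      ; trans = λ p q x∈L → trans (p x∈L) (q x∈L)
      }
    }

  -- There are [M : E] distinct embeddings of M, they extend to L, and one more embedding of L
  -- would, by uniqueness, restrict to one more embedding of M.
  embeddings-finite : ∀ {E M L n k} → E ≤ M → M ≤ L → HasDegree E M n → HasDegree M L k →
                      (∀ {x} → x ∈ mem M → SeparableOver E x) → UniqueExtensions M L → Finite n (Embeddings E L)
  embeddings-finite {E} {M} {L} {n} E≤M M≤L deg-M deg-L sep unique =
    extend-all (separable⇒many {E} {M} E≤M deg-M sep (inclusion E))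
    where
    extend-all : Σ (Fin n → Hom M) (λ Φ → (∀ i → Fixes E (Φ i)) × Distinct M Φ) → Finite n (Embeddings E L)
    extend-all (Φ , fixed , distinct) = enumeration (Embeddings E L)
      (λ i → Ψ i , λ x∈E → trans (Ψ-extends i (E≤M x∈E)) (fixed i x∈E))
      (λ i j eq → distinct i j (λ x∈M → trans (sym (Ψ-extends i x∈M)) (trans (eq (M≤L x∈M)) (Ψ-extends j x∈M))))
      (λ (φ , φ-fixed) → by-contradiction _ (λ φ∉Ψ → too-many φ φ-fixed φ∉Ψ))
      where
      extension : ∀ i → ∃[ ψ ] fun {L} ψ ≈[ M ] fun (Φ i)
      extension i = extension-exists {M} {L} M≤L deg-L (Φ i)
      Ψ : Fin n → Hom L
      Ψ i = proj₁ (extension i)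
      Ψ-extends : ∀ i → fun (Ψ i) ≈[ M ] fun (Φ i)
      Ψ-extends i = proj₂ (extension i)
      too-many : ∀ (φ : Hom L) → Fixes E φ → ¬ (∃[ i ] fun φ ≈[ L ] fun (Ψ i)) → ⊥
      too-many φ φ-fixed φ∉Ψ = ℕ.<⇒≱ ℕ.≤-refl (distinct-bound {suc n} {n} {E} {M} {λ x → x} (restrict {M} {L} M≤L φ ∷ᵥ Φ) E≤M
        (λ { zero x∈E → φ-fixed x∈E ; (suc i) x∈E → fixed i x∈E })
        (λ { zero    zero    eq → ≡.refl
           ; zero (suc j) eq → contradiction (j , λ {x} x∈L → agree j (λ {y} → eq {y}) x∈L) φ∉Ψ
           ; (suc i) zero eq → contradiction (i , λ {x} x∈L → agree i (λ {y} y∈M → sym (eq y∈M)) x∈L) φ∉Ψ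
           ; (suc i) (suc j) eq → ≡.cong suc (distinct i j eq) })
        deg-M)
        where
        agree : ∀ i → fun φ ≈[ M ] fun (Φ i) → fun φ ≈[ L ] fun (Ψ i)
        agree i eq = unique φ (Ψ i) (λ x∈M → trans (eq x∈M) (sym (Ψ-extends i x∈M)))

  -- The last two hypotheses say that `ι` and `φ` have the same image, and the automorphism is
  -- `ι⁻¹ ∘ φ`. For automorphisms `σ` and `τ` it is `σ⁻¹ ∘ τ`, as needed for orbits.
  factorisation : ∀ {E L} → E ≤ L → (ι φ : Hom L) → Fixes E ι → Fixes E φ →
    (∀ {x} → x ∈ mem L → ∃[ w ] w ∈ mem L × fun ι w ≈ fun φ x) →
    (∀ {w} → w ∈ mem L → ∃[ x ] x ∈ mem L × fun φ x ≈ fun ι w) →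
    Σ (Iso E L L) λ ρ → ∀ {x} → x ∈ mem L → fun ι (iso-fun ρ x) ≈ fun φ x
  factorisation {E} {L} E≤L ι φ ι-fixed φ-fixed preimage coimage = ρ-iso , λ x∈L →
    trans (ι.cong (iso-into ρ-iso x∈L) (iso-value ρ-iso x∈L)) (proj₂ (ρ-spec x∈L))
    where
    module ι = Hom ι
    module φ = Hom φ
    module L = Subfield L
    ρ : C → C
    ρ x = choose 0# (λ w → w ∈ mem L × fun ι w ≈ fun φ x)
    ρ-spec : ∀ {x} → x ∈ mem L → ρ x ∈ mem L × fun ι (ρ x) ≈ fun φ x
    ρ-spec {x} x∈L = choose-satisfies 0# (λ w → w ∈ mem L × fun ι w ≈ fun φ x) (preimage x∈L)
    ρ-unique : ∀ {x w} → x ∈ mem L → w ∈ mem L → fun ι w ≈ fun φ x → ρ x ≈ w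
    ρ-unique x∈L w∈L eq = ι.injective (proj₁ (ρ-spec x∈L)) w∈L (trans (proj₂ (ρ-spec x∈L)) (sym eq))
    ρ-hom : Hom L
    ρ-hom = record
      { fun    = ρ
      ; cong   = λ x∈L x≈y → ρ-unique x∈L (proj₁ (ρ-spec (L.resp x≈y x∈L)))
          (trans (proj₂ (ρ-spec (L.resp x≈y x∈L))) (sym (φ.cong x∈L x≈y)))
      ; +-homo = λ x∈L y∈L → ρ-unique (L.+-closed x∈L y∈L) (L.+-closed (proj₁ (ρ-spec x∈L)) (proj₁ (ρ-spec y∈L)))
          (trans (ι.+-homo (proj₁ (ρ-spec x∈L)) (proj₁ (ρ-spec y∈L)))
            (trans (+-cong (proj₂ (ρ-spec x∈L)) (proj₂ (ρ-spec y∈L))) (sym (φ.+-homo x∈L y∈L))))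
      ; *-homo = λ x∈L y∈L → ρ-unique (L.*-closed x∈L y∈L) (L.*-closed (proj₁ (ρ-spec x∈L)) (proj₁ (ρ-spec y∈L)))
          (trans (ι.*-homo (proj₁ (ρ-spec x∈L)) (proj₁ (ρ-spec y∈L)))
            (trans (*-cong (proj₂ (ρ-spec x∈L)) (proj₂ (ρ-spec y∈L))) (sym (φ.*-homo x∈L y∈L))))
      ; 1-homo = ρ-unique L.1-closed L.1-closed (trans ι.1-homo (sym φ.1-homo))
      }
    ρ-iso : Iso E L L
    ρ-iso = hom⇒iso ρ-hom
      (λ x∈E → ρ-unique (E≤L x∈E) (E≤L x∈E) (trans (ι-fixed x∈E) (sym (φ-fixed x∈E))))
      (λ x∈L → proj₁ (ρ-spec x∈L))
      (λ {y} y∈L → let (x , x∈L , eq) = coimage y∈L in x , x∈L , ρ-unique x∈L y∈L (sym eq))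

  -- Every embedding of L is uniquely ι ∘ σ, where ι is the isomorphism chosen for its image and σ ∈ Aut(L/E).
  module _ {E L N} (E≤L : E ≤ L) (F : Finite N (Embeddings E L)) where
    private
      module F = Inverse F

      Φ : Fin N → Hom L
      Φ i = proj₁ (F.to i)

      index : (φ : Hom L) → Fixes E φ → ∃[ i ] fun φ ≈[ L ] fun (Φ i)
      index φ fixed = F.from (φ , fixed) , λ {x} x∈L → sym (proj₁ F.inverse {φ , fixed} ≡.refl x∈L)

    aut-finite : ∃[ n ] Finite n (Aut E L)
    aut-finite = covered⇒finite (Aut E L) N (λ i σ → fun (iso⇒hom σ) ≈[ L ] fun (Φ i))
      (λ σ → index (iso⇒hom σ) (iso-fixes σ E≤L))
      (λ i {σ} {τ} σ≈ τ≈ (x , x∈L) → trans (sym (iso-value σ x∈L)) (trans (trans (σ≈ x∈L) (sym (τ≈ x∈L))) (iso-value τ x∈L)))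

    -- A conjugate is the image of an embedding, and `Φ` lists all embeddings.
    conjugates-finite : ∃[ n ] Finite n (Conjugates E L)
    conjugates-finite = covered⇒finite (Conjugates E L) N (λ i (M , _) → M ≣ image (Φ i))
      (λ (M , ι) → let (i , ι≈) = index (iso⇒hom ι) (iso-fixes ι E≤L) in i ,
        (λ y∈M → let (x , x∈L , eq) = iso-onto ι y∈M in x , x∈L , trans (sym (ι≈ x∈L)) eq) ,
        (λ (x , x∈L , eq) → Subfield.resp M (trans (ι≈ x∈L) eq) (iso-into ι x∈L)))
      (λ i (M≤ , ≤M) (M′≤ , ≤M′) → (λ y∈M → ≤M′ (M≤ y∈M)) , (λ y∈M′ → ≤M (M′≤ y∈M′)))

    embeddings-product : r E L ℕ.* s E L ≡ N
    embeddings-product = finite-unique (enumeration (Embeddings E L) g distinct complete) F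
      where
      module A = Inverse (finite-card (proj₂ aut-finite))
      module B = Inverse (finite-card (proj₂ conjugates-finite))
      σ = λ i → iso⇒hom (A.to i)
      ι = λ j → iso⇒hom (proj₂ (B.to j))
      composite : Fin (r E L) × Fin (s E L) → Σ (Hom L) λ φ → Fixes E φ
      composite (i , j) = record
        { fun    = λ x → fun (ι j) (fun (σ i) x)
        ; cong   = λ x∈L x≈y → Hom.cong (ι j) (into x∈L) (Hom.cong (σ i) x∈L x≈y)
        ; +-homo = λ x∈L y∈L → trans (Hom.cong (ι j) (into (Subfield.+-closed L x∈L y∈L)) (Hom.+-homo (σ i) x∈L y∈L)) (Hom.+-homo (ι j) (into x∈L) (into y∈L))
        ; *-homo = λ x∈L y∈L → trans (Hom.cong (ι j) (into (Subfield.*-closed L x∈L y∈L)) (Hom.*-homo (σ i) x∈L y∈L)) (Hom.*-homo (ι j) (into x∈L) (into y∈L))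
        ; 1-homo = trans (Hom.cong (ι j) (into (Subfield.1-closed L)) (Hom.1-homo (σ i))) (Hom.1-homo (ι j))
        } , λ x∈E → trans (Hom.cong (ι j) (into (E≤L x∈E)) (iso-fixes (A.to i) E≤L x∈E)) (iso-fixes (proj₂ (B.to j)) E≤L x∈E)
        where
        into : ∀ {x} → x ∈ mem L → fun (σ i) x ∈ mem L
        into = iso-into (A.to i)
      g : Fin (r E L ℕ.* s E L) → Σ (Hom L) λ φ → Fixes E φ
      g k = composite (remQuot {r E L} (s E L) k)
      -- Automorphisms map `L` onto itself, so the image of a composite is the conjugate that it
      -- ends in; equal composites thus have equal conjugates.
      M≤M′ : ∀ i j i′ j′ → fun (proj₁ (composite (i , j))) ≈[ L ] fun (proj₁ (composite (i′ , j′))) →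
             proj₁ (B.to j) ≤ proj₁ (B.to j′)
      M≤M′ i j i′ j′ eq y∈M =
        let (x , x∈L , ιx≈y) = iso-onto (proj₂ (B.to j)) y∈M
            (w , w∈L , σw≈x) = iso-onto (A.to i) x∈L
        in Subfield.resp (proj₁ (B.to j′)) (trans (sym (eq w∈L)) (trans (Hom.cong (ι j) (iso-into (A.to i) w∈L) σw≈x) ιx≈y))
             (iso-into (proj₂ (B.to j′)) (iso-into (A.to i′) w∈L))
      distinct-pairs : ∀ i j i′ j′ → fun (proj₁ (composite (i , j))) ≈[ L ] fun (proj₁ (composite (i′ , j′))) →
                       j ≡ j′ → combine i j ≡ combine i′ j′
      distinct-pairs i j i′ j eq ≡.refl = ≡.cong (λ i → combine i j)
        (≡.trans (≡.sym (proj₂ A.inverse {i} {A.to i} (Setoid.refl (Aut E L) {A.to i})))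
          (proj₂ A.inverse {i′} {A.to i} (λ (x , x∈L) → trans (sym (iso-value (A.to i) x∈L)) (trans
            (Hom.injective (ι j) (iso-into (A.to i) x∈L) (iso-into (A.to i′) x∈L) (eq x∈L)) (iso-value (A.to i′) x∈L)))))
      distinct : ∀ k k′ → fun (proj₁ (g k)) ≈[ L ] fun (proj₁ (g k′)) → k ≡ k′
      distinct k k′ eq = ≡.trans (≡.sym (Fin.combine-remQuot {r E L} (s E L) k))
        (≡.trans (distinct-pairs _ _ _ _ eq j≡j′) (Fin.combine-remQuot {r E L} (s E L) k′))
        where
        p  = remQuot {r E L} (s E L) k
        p′ = remQuot {r E L} (s E L) k′
        j≡j′ : proj₂ p ≡ proj₂ p′
        j≡j′ = ≡.trans (≡.sym (proj₂ B.inverse {proj₂ p} {B.to (proj₂ p)} (Setoid.refl (Conjugates E L) {B.to (proj₂ p)})))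
          (proj₂ B.inverse {proj₂ p′} {B.to (proj₂ p)} (M≤M′ _ _ _ _ eq , M≤M′ _ _ _ _ (λ x∈L → sym (eq x∈L))))
      complete : ∀ (φ : Σ (Hom L) λ φ → Fixes E φ) → ∃[ k ] fun (proj₁ φ) ≈[ L ] fun (proj₁ (g k))
      complete (φ , fixed) = combine i j ,
        λ {x} x∈L → trans (factor x∈L) (reflexive (≡.cong (λ p → fun (proj₁ (composite p)) x) (≡.sym (Fin.remQuot-combine {r E L} {s E L} i j))))
        where
        conj : Setoid.Carrier (Conjugates E L)
        conj = image φ , hom⇒iso φ fixed (λ {x} x∈L → x , x∈L , refl) (λ y∈ → y∈)
        j = B.from conj
        M≣ : proj₁ (B.to j) ≣ image φ
        M≣ = proj₁ B.inverse {conj} ≡.refl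
        ρ : Σ (Iso E L L) λ ρ → ∀ {x} → x ∈ mem L → fun (ι j) (iso-fun ρ x) ≈ fun φ x
        ρ = factorisation E≤L (ι j) φ (iso-fixes (proj₂ (B.to j)) E≤L) fixed
          (λ {x} x∈L → iso-onto (proj₂ (B.to j)) (proj₂ M≣ (x , x∈L , refl)))
          (λ x∈L → proj₁ M≣ (iso-into (proj₂ (B.to j)) x∈L))
        i = A.from (proj₁ ρ)
        factor : fun φ ≈[ L ] fun (proj₁ (composite (i , j)))
        factor {x} x∈L = begin
          fun φ x  ≈⟨ proj₂ ρ x∈L ⟨
          fun (ι j) (iso-fun (proj₁ ρ) x) ≈⟨ Hom.cong (ι j) (iso-into (proj₁ ρ) x∈L) (trans (iso-value (proj₁ ρ) x∈L)
                                               (trans (sym (proj₁ A.inverse {proj₁ ρ} ≡.refl (x , x∈L))) (sym (iso-value (A.to i) x∈L)))) ⟩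
          fun (ι j) (fun (σ i) x)  ∎

  count : ∀ {E M L n k} → E ≤ M → M ≤ L → HasDegree E M n → HasDegree M L k →
          (∀ {x} → x ∈ mem M → SeparableOver E x) → UniqueExtensions M L → r E L ℕ.* s E L ≡ n
  count {E} {M} {L} E≤M M≤L deg-M deg-L sep unique =
    embeddings-product {E} {L} (λ x∈E → M≤L (E≤M x∈E)) (embeddings-finite {E} {M} {L} E≤M M≤L deg-M deg-L sep unique)

  -- Embeddings that map the field into itself.

  Stable : Subfield → Subfield → Set u
  Stable E L = (φ : Hom L) → Fixes E φ → ∀ {x} → x ∈ mem L → fun φ x ∈ mem L

  -- An injective linear map of a finite-dimensional space into itself: the images of a basis are
  -- independent, and there are enough of them to span.
  into⇒onto : ∀ {E L n} → E ≤ L → HasDegree E L n → (φ : Hom L) → Fixes E φ →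
              (∀ {x} → x ∈ mem L → fun φ x ∈ mem L) → ∀ {y} → y ∈ mem L → ∃[ x ] x ∈ mem L × fun φ x ≈ y
  into⇒onto {E} {L} {n} E≤L (b , B) φ fixed into {y} y∈L =
    preimage (independent-spans E {v = λ i → fun φ (b i)} independent (λ i → B.spanning _ (into (B.members i))) (B.spanning y y∈L))
    where
    module B = IsBasis B
    module L = SubfieldProperties L
    combination-homo : ∀ a → (∀ i → a i ∈ mem E) → fun φ (sum (λ i → a i * b i)) ≈ sum (λ i → a i * fun φ (b i))
    combination-homo a a∈E = trans (Hom.linear-homo φ (λ i → E≤L (a∈E i)) B.members) (sum-cong-≋ {n} (λ i → *-congʳ (fixed (a∈E i))))
    combination∈L : ∀ a → (∀ i → a i ∈ mem E) → sum (λ i → a i * b i) ∈ mem L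
    combination∈L a a∈E = L.sum-closed (λ i → L.*-closed (E≤L (a∈E i)) (B.members i))
    independent : Independent E (λ i → fun φ (b i))
    independent a a∈E Σ≈0 = B.independent a a∈E (Hom.injective φ (combination∈L a a∈E) L.0-closed
      (trans (combination-homo a a∈E) (trans Σ≈0 (sym (Hom.0-homo φ)))))
    preimage : y ∈ Span E (λ i → fun φ (b i)) → ∃[ x ] x ∈ mem L × fun φ x ≈ y
    preimage (a , a∈E , y≈) = sum (λ i → a i * b i) , combination∈L a a∈E , trans (combination-homo a a∈E) (sym y≈)

  stable⇒aut : ∀ {E L n} → E ≤ L → HasDegree E L n → (φ : Hom L) → Fixes E φ →
               (∀ {x} → x ∈ mem L → fun φ x ∈ mem L) → Iso E L L
  stable⇒aut {E} {L} E≤L deg φ fixed into = hom⇒iso φ fixed into (into⇒onto {E} {L} E≤L deg φ fixed into)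

  stable⇒s≡1 : ∀ {E L n} → E ≤ L → HasDegree E L n → Stable E L → s E L ≡ 1
  stable⇒s≡1 {E} {L} E≤L deg stable = card-unique (enumeration {n = 1} (Conjugates E L)
    (λ _ → L , hom⇒iso (inclusion L) (λ _ → refl) (λ x∈L → x∈L) (λ {y} y∈L → y , y∈L , refl))
    (λ { zero zero _ → ≡.refl })
    (λ (M , ι) → zero ,
      (λ y∈M → let (x , x∈L , eq) = iso-onto ι y∈M in Subfield.resp L eq (stable (iso⇒hom ι) (iso-fixes ι E≤L) x∈L)) ,
      (λ y∈L → let (x , x∈L , eq) = into⇒onto {E} {L} E≤L deg (iso⇒hom ι) (iso-fixes ι E≤L) (stable (iso⇒hom ι) (iso-fixes ι E≤L)) y∈L
               in Subfield.resp M eq (iso-into ι x∈L))))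

  rigid⇒r≡1 : ∀ {E L} → E ≤ L → ((σ : Iso E L L) → Fixes L (iso⇒hom σ)) → r E L ≡ 1
  rigid⇒r≡1 {E} {L} E≤L rigid = card-unique (enumeration {n = 1} (Aut E L)
    (λ _ → hom⇒iso (inclusion L) (λ _ → refl) (λ x∈L → x∈L) (λ {y} y∈L → y , y∈L , refl))
    (λ { zero zero _ → ≡.refl })
    (λ σ → zero , λ (x , x∈L) → trans (sym (iso-value σ x∈L)) (rigid σ x∈L)))

-- Degrees, normality and fixed fields.

module ClusterSizes {c ℓ₁ ℓ₂ : Level} (em : ∀ {a} → ExcludedMiddle a) (K̄ : HeytingField c ℓ₁ ℓ₂)
  {K₀ : FieldTheory.Subfield em K̄} (closure : FieldTheory.IsAlgebraicClosureOf em K̄ K₀) where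
  open FieldTheory em K̄
  open Field em K̄
  open Polynomials em K̄
  open ClosedField em K̄ closure
  open MinimalPolynomials em K̄ closure
  open Homomorphisms em K̄ closure
  open Separability em K̄ closure
  open MaximalSeparable em K̄ closure
  open Counting em K̄ closure
  open Subfield using (mem)
  open Hom using (fun)
  open import Data.Nat.Divisibility using (_∣_; divides)
  open import Function.Bundles using (Inverse)
  import Function.Construct.Composition as Composition

  degree-lower : ∀ {E M L n} → E ≤ M → M ≤ L → HasDegree E L n → HasDegree E M [ M ∶ E ]
  degree-lower {E} {M} {L} E≤M M≤L deg = [_∶_]-satisfies (proj₂ (proj₁ (intermediate-finite {E} {M} {L} E≤M M≤L deg)))

  degree-upper : ∀ {E M L n} → E ≤ M → M ≤ L → HasDegree E L n → HasDegree M L [ L ∶ M ]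
  degree-upper {E} {M} {L} E≤M M≤L deg = [_∶_]-satisfies (proj₂ (proj₂ (intermediate-finite {E} {M} {L} E≤M M≤L deg)))

  tower-law : ∀ {E M L n} → E ≤ M → M ≤ L → HasDegree E L n → [ L ∶ E ] ≡ [ L ∶ M ] ℕ.* [ M ∶ E ]
  tower-law {E} {M} {L} E≤M M≤L deg = [_∶_]-unique (tower {E} {M} {L} E≤M M≤L
    (degree-lower {E} {M} {L} E≤M M≤L deg) (degree-upper {E} {M} {L} E≤M M≤L deg))

  equal-degree : ∀ {E M L n} → E ≤ M → M ≤ L → HasDegree E L n → [ L ∶ M ] ≡ [ L ∶ E ] → M ≤ E
  equal-degree {E} {M} {L} E≤M M≤L deg eq = degree-1 {E} {M} E≤M (≡.subst (HasDegree E M) index≡1 (degree-lower {E} {M} {L} E≤M M≤L deg))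
    where
    index≡1 : [ M ∶ E ] ≡ 1
    index≡1 = ℕ.*-cancelˡ-≡ _ _ [ L ∶ M ] {{ℕ.>-nonZero (degree-positive (degree-upper {E} {M} {L} E≤M M≤L deg))}}
      (≡.trans (≡.sym (tower-law {E} {M} {L} E≤M M≤L deg)) (≡.trans (≡.sym eq) (≡.sym (ℕ.*-identityʳ _))))

  ∏-closed : ∀ L {βs} → All (_∈ mem L) βs → ∏[X- βs ] ∈ L [X]
  ∏-closed L []            = Subfield.1-closed L ∷ []
  ∏-closed L (β∈L ∷ βs∈L) = *ₚ-closed L (Subfield.neg-closed L β∈L ∷ Subfield.1-closed L ∷ []) (∏-closed L βs∈L)

  coeffs-closed : ∀ E p → (∀ n → coeff p n ∈ mem E) → p ∈ E [X]
  coeffs-closed E []      coeff∈E = []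
  coeffs-closed E (a ∷ p) coeff∈E = coeff∈E 0 ∷ coeffs-closed E p (λ n → coeff∈E (suc n))

  root-fixed : ∀ {E L f x d} → E ≤ L → (φ : Hom L) → Fixes E φ → IsMin E f x d → x ∈ mem L →
               eval f (fun φ x) ≈ 0#
  root-fixed {E} {L} E≤L φ fixed m x∈L = trans (sym (eval-fixed {E} {L} φ E≤L fixed (IsMin.over m) x∈L))
    (trans (Hom.cong φ (eval-closed L (All.map E≤L (IsMin.over m)) x∈L) (IsMin.root m)) (Hom.0-homo φ))

  -- The image of `x` is a root of the minimal polynomial of `x`, which splits in `L`.
  normal⇒stable : ∀ {E L} → E ≤ L → Normal E L → Stable E L
  normal⇒stable {E} {L} E≤L normal φ fixed {x} x∈L = with-minimal (isMin-exists E (Normal.algebraic normal x x∈L))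
    where
    with-minimal : ∃[ f ] ∃[ d ] IsMin E f x d → fun φ x ∈ mem L
    with-minimal (f , d , m) = with-splitting (Normal.splits normal f (isMin⇒irreducible m) x x∈L (IsMin.root m))
      where
      with-splitting : SplitsIn L f → fun φ x ∈ mem L
      with-splitting (a , βs , βs∈L , f≈a∏) =
        let (β , β∈βs , φx≈β) = root-∏ βs (x≉0∧xy≈0⇒y≈0 a≉0 (trans (sym (eval-f (fun φ x))) (root-fixed {E} {L} E≤L φ fixed m x∈L)))
        in Subfield.resp L (sym φx≈β) (All.lookup βs∈L β∈βs)
        where
        eval-f : ∀ y → eval f y ≈ a * eval ∏[X- βs ] y
        eval-f y = trans (eval-congʳ f (map (a *_) ∏[X- βs ]) f≈a∏ y) (eval-scale a ∏[X- βs ] y)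
        a≉0 : a ≉0
        a≉0 a≈0 = isMin⇒¬constant m (λ n → trans (f≈a∏ (suc n)) (trans (coeff-scale a ∏[X- βs ] (suc n))
          (trans (*-congʳ a≈0) (zeroˡ _))))

  module _ {E L : Subfield} (E≤L : E ≤ L) where

    fixedField-lower : E ≤ fixedField E L
    fixedField-lower x∈E = E≤L x∈E , λ σ → Iso.fixes σ _ x∈E

    fixedField-upper : fixedField E L ≤ L
    fixedField-upper = proj₁

    fixedField-fixed : (σ : Iso E L L) → iso-fun σ ≈[ fixedField E L ] (λ x → x)
    fixedField-fixed σ (x∈L , fix) = trans (iso-value σ x∈L) (fix σ)

    fixedField-mem : ∀ {x} → x ∈ mem L → (∀ (σ : Iso E L L) → iso-fun σ x ≈ x) → x ∈ mem (fixedField E L)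
    fixedField-mem x∈L fix = x∈L , λ σ → trans (sym (iso-value σ x∈L)) (fix σ)

  -- Orbit polynomials and the extension over the fixed field.

  OrbitPolynomial : Subfield → Subfield → C → Set _
  OrbitPolynomial E L x =
    ∃[ αs ] All (_∈ mem L) αs × Unique setoid αs × IsMin (fixedField E L) ∏[X- αs ] x (length αs)

  -- Over the fixed field, x has minimal polynomial ∏ (X - α), where α ranges over the orbit of x.
  orbit-polynomial : ∀ {E L n x} → E ≤ L → HasDegree E L n → x ∈ mem L →
    OrbitPolynomial E L x
  orbit-polynomial {E} {L} {n} {x} E≤L deg x∈L = with-minimal (isMin-exists E (finite⇒algebraic {E} {L} deg x∈L))
    where
    F = fixedField E L
    InOrbit : C → Set _
    InOrbit y = ∃[ σ ] iso-fun {E} {L} {L} σ x ≈ y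
    with-minimal : ∃[ f ] ∃[ d ] IsMin E f x d →
      OrbitPolynomial E L x
    with-minimal (f , d , m) = with-roots (splitting d f (IsMin.monic m))
      where
      with-roots : ∃[ βs ] length βs ≡ d × f ≈ₚ ∏[X- βs ] →
        OrbitPolynomial E L x
      -- The orbit of `x` lies among the roots `βs` of its minimal polynomial over `E`; this is what
      -- makes it finite.
      with-roots (βs , _ , f≈∏) = with-orbit (distinct-elements InOrbit (λ y≈z (σ , eq) → σ , trans eq y≈z) βs)
        where
        with-orbit : ∃[ αs ] Unique setoid αs × All InOrbit αs × length αs ℕ.≤ length βs ×
            (∀ {y} → InOrbit y → (∃[ β ] β ∈ˡ βs × y ≈ β) → ∃[ α ] α ∈ˡ αs × y ≈ α) →
          OrbitPolynomial E L x
        with-orbit (αs , uniq , orbit , _ , covers) = αs , αs∈L , uniq , record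
          { over    = coeffs-closed F g (λ k → fixedField-mem E≤L (coeff-closed L g∈L k) (λ σ →
                        trans (sym (Hom.coeff-map (iso⇒hom σ) g∈L k)) (invariant σ k)))
          ; monic   = ∏-monic αs
          ; root    = orbit-root identity (iso-value identity x∈L)
          -- A polynomial over the fixed field that vanishes at `x` vanishes on the whole orbit,
          -- which has `length αs` distinct elements.
          ; minimal = λ {h} h∈F h< hx≈0 → many-roots⇒zero h uniq (All.map (λ {α} (σ , σx≈α) → begin
              eval h α  ≈⟨ eval-congˡ h σx≈α ⟨
              eval h (iso-fun σ x) ≈⟨ eval-fixed {F} {L} (iso⇒hom σ) (fixedField-upper E≤L) (fixedField-fixed E≤L σ) h∈F x∈L ⟨
              iso-fun σ (eval h x) ≈⟨ Hom.cong (iso⇒hom σ) (eval-closed L (All.map (fixedField-upper E≤L) h∈F) x∈L) hx≈0 ⟩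
              iso-fun σ 0#  ≈⟨ Hom.0-homo (iso⇒hom σ) ⟩
              0#  ∎) orbit) h<
          }
          where
          g = ∏[X- αs ]
          identity : Iso E L L
          identity = hom⇒iso (inclusion L) (λ _ → refl) (λ x∈L → x∈L) (λ {y} y∈L → y , y∈L , refl)
          αs∈L : All (_∈ mem L) αs
          αs∈L = All.map (λ (σ , eq) → Subfield.resp L eq (iso-into σ x∈L)) orbit
          g∈L : g ∈ L [X]
          g∈L = ∏-closed L αs∈L
          orbit-root : ∀ {y} (σ : Iso E L L) → iso-fun σ x ≈ y → eval g y ≈ 0#
          orbit-root {y} σ σx≈y =
            let (α , α∈αs , y≈α) = covers (σ , σx≈y) (root-∏ βs (begin
                  eval ∏[X- βs ] y  ≈⟨ eval-congʳ f ∏[X- βs ] f≈∏ y ⟨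
                  eval f y  ≈⟨ eval-congˡ f σx≈y ⟨
                  eval f (iso-fun σ x) ≈⟨ root-fixed {E} {L} E≤L (iso⇒hom σ) (iso-fixes σ E≤L) m x∈L ⟩
                  0#  ∎))
            in ∏-root α∈αs y≈α
          -- Both polynomials are monic of the same degree with the orbit as roots: `α = τ x` is
          -- `σ (ρ x)` for `ρ = σ⁻¹ ∘ τ`, and `ρ x` is a root of `g`.
          invariant : (σ : Iso E L L) → map (iso-fun σ) g ≈ₚ g
          invariant σ = monic-unique (map (iso-fun σ) g) g uniq (Hom.map-monic (iso⇒hom σ) g∈L (∏-monic αs)) (∏-monic αs)
            (All.map conjugate-root orbit) (∏-roots αs)
            where
            conjugate-root : ∀ {α} → InOrbit α → eval (map (iso-fun σ) g) α ≈ 0#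
            conjugate-root {α} (τ , τx≈α) =
              let (ρ , σρ≈τ) = factorisation {E} {L} E≤L (iso⇒hom σ) (iso⇒hom τ) (iso-fixes σ E≤L) (iso-fixes τ E≤L)
                    (λ y∈L → iso-onto σ (iso-into τ y∈L)) (λ y∈L → iso-onto τ (iso-into σ y∈L))
              in begin
              eval (map (iso-fun σ) g) α ≈⟨ eval-congˡ (map (iso-fun σ) g) (trans (σρ≈τ x∈L) τx≈α) ⟨
              eval (map (iso-fun σ) g) (iso-fun σ (iso-fun ρ x)) ≈⟨ Hom.eval-homo (iso⇒hom σ) g∈L (iso-into ρ x∈L) ⟨
              iso-fun σ (eval g (iso-fun ρ x)) ≈⟨ Hom.cong (iso⇒hom σ) (eval-closed L g∈L (iso-into ρ x∈L)) (orbit-root ρ refl) ⟩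
              iso-fun σ 0#  ≈⟨ Hom.0-homo (iso⇒hom σ) ⟩
              0#  ∎

  fixedField-separable : ∀ {E L n x} → E ≤ L → HasDegree E L n → x ∈ mem L → SeparableOver (fixedField E L) x
  fixedField-separable {E} {L} E≤L deg x∈L =
    let (αs , _ , uniq , m) = orbit-polynomial {E} {L} E≤L deg x∈L in ∏[X- αs ] , length αs , m , unique⇒squarefree uniq

  fixedField-normal : ∀ {E L n} → E ≤ L → HasDegree E L n → Normal (fixedField E L) L
  fixedField-normal {E} {L} E≤L deg = record
    { algebraic = λ x x∈L → let (_ , _ , _ , m) = orbit-polynomial {E} {L} E≤L deg x∈L in isMin⇒algebraic m
    ; splits    = λ f irr x x∈L root →
        let (αs , αs∈L , _ , m) = orbit-polynomial {E} {L} E≤L deg x∈L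
            (a , f≈a∏) = irreducible-associate irr root m
        in a , αs , αs∈L , f≈a∏
    }

  fixedField-galois : ∀ {E L n} → E ≤ L → HasDegree E L n → Galois (fixedField E L) L
  fixedField-galois {E} {L} E≤L deg = record
    { normal    = fixedField-normal {E} {L} E≤L deg
    ; separable = λ x x∈L → separable-from (fixedField-separable {E} {L} E≤L deg x∈L)
    }

  -- The two groups have the same elements. Finiteness over `E′` comes from the embeddings and then
  -- passes to the group over `E`.
  r-base-change : ∀ {E E′ L n} → E ≤ E′ → E′ ≤ L → HasDegree E L n →
                  (∀ (σ : Iso E L L) → iso-fun σ ≈[ E′ ] (λ x → x)) → r E′ L ≡ r E L
  r-base-change {E} {E′} {L} E≤E′ E′≤L deg fixed = ≡.sym (card-unique (Composition.inverse (finite-card (proj₂ finite)) base-change))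
    where
    E≤L : E ≤ L
    E≤L x∈E = E′≤L (E≤E′ x∈E)
    M = maximalSeparable E′ L
    module M = IsMaximalSeparable (maximalSeparable-isMaximal {E′} {L} E′≤L)
    deg′ = degree-upper {E} {E′} {L} E≤E′ E′≤L deg
    finite : ∃[ k ] Inverse (≡.setoid (Fin k)) (Aut E′ L)
    finite = aut-finite {E′} {L} E′≤L (embeddings-finite {E′} {M} {L} M.lower M.upper
      (degree-lower {E′} {M} {L} M.lower M.upper deg′) (degree-upper {E′} {M} {L} M.lower M.upper deg′)
      (λ {x} x∈M → separable-to (M.separable x x∈M)) (maximalSeparable-unique {E′} {L} E′≤L deg′))
    base-change : Inverse (Aut E′ L) (Aut E L)
    base-change = record
      { to = λ σ → record { to = Iso.to σ ; isRingIsomorphism = Iso.isRingIsomorphism σ ; fixes = λ x x∈E → Iso.fixes σ x (E≤E′ x∈E) }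
      ; from      = λ σ → record { to = Iso.to σ ; isRingIsomorphism = Iso.isRingIsomorphism σ
                                 ; fixes = λ (x , x∈L) x∈E′ → trans (sym (iso-value σ x∈L)) (fixed σ x∈E′) }
      ; to-cong   = λ σ≈τ → σ≈τ
      ; from-cong = λ σ≈τ → σ≈τ
      ; inverse   = (λ eq → eq) , (λ eq → eq)
      }

  separable-count : ∀ {E L n} → E ≤ L → HasDegree E L n → (∀ {x} → x ∈ mem L → SeparableOver E x) → r E L ℕ.* s E L ≡ n
  separable-count {E} {L} E≤L deg sep = count {E} {L} {L} E≤L (λ x∈L → x∈L) deg
    (trivial-degree {L} {L} (λ x∈L → x∈L) (λ x∈L → x∈L)) sep (λ φ ψ agree → agree)

  r*1≡r : ∀ {a b n} → a ℕ.* b ≡ n → b ≡ 1 → a ≡ n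
  r*1≡r {a} eq ≡.refl = ≡.trans (≡.sym (ℕ.*-identityʳ a)) eq

  -- Separability makes `r E L * s E L` the degree, and normality makes the second factor 1.
  galois-count : ∀ {E L n} → E ≤ L → HasDegree E L n → Galois E L → r E L ≡ n
  galois-count {E} {L} E≤L deg galois = r*1≡r
    (separable-count {E} {L} E≤L deg (λ {x} x∈L → separable-to (Galois.separable galois x x∈L)))
    (stable⇒s≡1 {E} {L} E≤L deg (normal⇒stable {E} {L} E≤L (Galois.normal galois)))

  r≡[L∶fixedField] : ∀ {E L n} → E ≤ L → HasDegree E L n → r E L ≡ [ L ∶ fixedField E L ]
  r≡[L∶fixedField] {E} {L} E≤L deg = ≡.trans
    (≡.sym (r-base-change {E} {F} {L} (fixedField-lower E≤L) (fixedField-upper E≤L) deg (fixedField-fixed E≤L)))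
    (galois-count {F} {L} (fixedField-upper E≤L) (degree-upper {E} {F} {L} (fixedField-lower E≤L) (fixedField-upper E≤L) deg)
      (fixedField-galois {E} {L} E≤L deg))
    where F = fixedField E L

  -- N is the fixed field of Aut(L/N) ⊆ Aut(L/E)
  galois⇒contains-fixedField : ∀ {E N L n} → E ≤ N → N ≤ L → HasDegree E L n → Galois N L → fixedField E L ≤ N
  galois⇒contains-fixedField {E} {N} {L} E≤N N≤L deg galois x∈F = F′≤N (smaller-group x∈F)
    where
    deg′ = degree-upper {E} {N} {L} E≤N N≤L deg
    F′ = fixedField N L
    smaller-group : fixedField E L ≤ F′
    smaller-group (x∈L , fix) = x∈L , λ σ → fix (record
      { to = Iso.to σ ; isRingIsomorphism = Iso.isRingIsomorphism σ ; fixes = λ x x∈E → Iso.fixes σ x (E≤N x∈E) })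
    F′≤N : F′ ≤ N
    -- Both degrees equal `r N L`: the one over `F′` always, the one over `N` because `L` is Galois
    -- over `N`.
    F′≤N = equal-degree {N} {F′} {L} (fixedField-lower N≤L) (fixedField-upper N≤L) deg′
      (≡.trans (≡.sym (r≡[L∶fixedField] {N} {L} N≤L deg′)) (galois-count {N} {L} N≤L deg′ galois))

  r*s≡degree : ∀ {E L n} → E ≤ L → HasDegree E L n → r E L ℕ.* s E L ≡ [ maximalSeparable E L ∶ E ]
  r*s≡degree {E} {L} E≤L deg = count {E} {M} {L} M.lower M.upper
    (degree-lower {E} {M} {L} M.lower M.upper deg) (degree-upper {E} {M} {L} M.lower M.upper deg)
    (λ {x} x∈M → separable-to (M.separable x x∈M)) (maximalSeparable-unique {E} {L} E≤L deg)
    where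
    M = maximalSeparable E L
    module M = IsMaximalSeparable (maximalSeparable-isMaximal {E} {L} E≤L)

  l*s≡degree : ∀ {E L n} → E ≤ L → HasDegree E L n → l E L ℕ.* s E L ≡ [ L ∶ E ]
  l*s≡degree {E} {L} E≤L deg = ≡.trans (ℕ.*-assoc [ L ∶ M ] (r E L) (s E L))
    (≡.trans (≡.cong ([ L ∶ M ] ℕ.*_) (r*s≡degree {E} {L} E≤L deg)) (≡.sym (tower-law {E} {M} {L} M.lower M.upper deg)))
    where
    M = maximalSeparable E L
    module M = IsMaximalSeparable (maximalSeparable-isMaximal {E} {L} E≤L)

  -- The invariants of a finite extension.

  module Extension {K L : Subfield} {n} (K≤L : K ≤ L) (deg : HasDegree K L n) where
    Lₛ Lᴬ : Subfield
    Lₛ = maximalSeparable K L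
    Lᴬ = fixedField K L

    module Lₛ = IsMaximalSeparable (maximalSeparable-isMaximal {K} {L} K≤L)

    K≤Lᴬ : K ≤ Lᴬ
    K≤Lᴬ = fixedField-lower K≤L

    Lᴬ≤L : Lᴬ ≤ L
    Lᴬ≤L = fixedField-upper K≤L

    deg-Lₛ/K : HasDegree K Lₛ [ Lₛ ∶ K ]
    deg-Lₛ/K = degree-lower {K} {Lₛ} {L} Lₛ.lower Lₛ.upper deg

    deg-L/Lₛ : HasDegree Lₛ L [ L ∶ Lₛ ]
    deg-L/Lₛ = degree-upper {K} {Lₛ} {L} Lₛ.lower Lₛ.upper deg

    Lₛ-separable : ∀ {x} → x ∈ mem Lₛ → SeparableOver K x
    Lₛ-separable {x} x∈Lₛ = separable-to (Lₛ.separable x x∈Lₛ)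

    unique : UniqueExtensions Lₛ L
    unique = maximalSeparable-unique {K} {L} K≤L deg

    r*s≡[Lₛ∶K] : r K L ℕ.* s K L ≡ [ Lₛ ∶ K ]
    r*s≡[Lₛ∶K] = r*s≡degree {K} {L} K≤L deg

    l*s≡[L∶K] : l K L ℕ.* s K L ≡ [ L ∶ K ]
    l*s≡[L∶K] = l*s≡degree {K} {L} K≤L deg

    r≡[L∶Lᴬ] : r K L ≡ [ L ∶ Lᴬ ]
    r≡[L∶Lᴬ] = r≡[L∶fixedField] {K} {L} K≤L deg

    r-nonZero : ℕ.NonZero (r K L)
    r-nonZero = ℕ.>-nonZero (≡.subst (0 ℕ.<_) (≡.sym r≡[L∶Lᴬ]) (degree-positive (degree-upper {K} {Lᴬ} {L} K≤Lᴬ Lᴬ≤L deg)))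

    -- Multiplied by `r K L`, both sides become `[ L ∶ K ]`: one by the tower law through `Lᴬ`, the
    -- other through `Lₛ`.
    [Lᴬ∶K]≡[L∶Lₛ]*s : [ Lᴬ ∶ K ] ≡ [ L ∶ Lₛ ] ℕ.* s K L
    [Lᴬ∶K]≡[L∶Lₛ]*s = ℕ.*-cancelˡ-≡ _ _ (r K L) {{r-nonZero}} (P.begin
      r K L ℕ.* [ Lᴬ ∶ K ]  P.≡⟨ ≡.cong (ℕ._* [ Lᴬ ∶ K ]) r≡[L∶Lᴬ] ⟩
      [ L ∶ Lᴬ ] ℕ.* [ Lᴬ ∶ K ]  P.≡⟨ tower-law {K} {Lᴬ} {L} K≤Lᴬ Lᴬ≤L deg ⟨
      [ L ∶ K ]  P.≡⟨ l*s≡[L∶K] ⟨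
      [ L ∶ Lₛ ] ℕ.* r K L ℕ.* s K L P.≡⟨ ≡.cong (ℕ._* s K L) (ℕ.*-comm [ L ∶ Lₛ ] (r K L)) ⟩
      r K L ℕ.* [ L ∶ Lₛ ] ℕ.* s K L  P.≡⟨ ℕ.*-assoc (r K L) [ L ∶ Lₛ ] (s K L) ⟩
      r K L ℕ.* ([ L ∶ Lₛ ] ℕ.* s K L)  P.∎)
      where module P = ≡.≡-Reasoning

    -- Every competing field contains `Lᴬ`, so by the tower law its degree below `L` divides that of
    -- `Lᴬ`.
    Lᴬ-maximalGalois : IsMaximalGalois K L Lᴬ
    Lᴬ-maximalGalois = record
      { lower   = K≤Lᴬ
      ; upper   = Lᴬ≤L
      ; galois  = fixedField-galois {K} {L} K≤L deg
      ; maximum = λ N K≤N N≤L galois → bound N K≤N N≤L (galois⇒contains-fixedField {K} {N} {L} K≤N N≤L deg galois)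
      }
      where
      deg-L/Lᴬ = degree-upper {K} {Lᴬ} {L} K≤Lᴬ Lᴬ≤L deg
      bound : ∀ N → K ≤ N → N ≤ L → Lᴬ ≤ N → [ L ∶ N ] ℕ.≤ [ L ∶ Lᴬ ]
      bound N K≤N N≤L Lᴬ≤N = ≡.subst ([ L ∶ N ] ℕ.≤_) (≡.sym (tower-law {Lᴬ} {N} {L} Lᴬ≤N N≤L deg-L/Lᴬ))
        (ℕ.m≤m*n [ L ∶ N ] [ N ∶ Lᴬ ] {{ℕ.>-nonZero (degree-positive (degree-lower {Lᴬ} {N} {L} Lᴬ≤N N≤L deg-L/Lᴬ))}})

    -- `N` contains `Lᴬ`, and maximality of both makes their degrees below `L` equal.
    maximalGalois-unique : ∀ N → IsMaximalGalois K L N → N ≣ Lᴬ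
    maximalGalois-unique N maximal = N≤Lᴬ , Lᴬ≤N
      where
      module N = IsMaximalGalois maximal
      Lᴬ≤N : Lᴬ ≤ N
      Lᴬ≤N = galois⇒contains-fixedField {K} {N} {L} N.lower N.upper deg N.galois
      N≤Lᴬ : N ≤ Lᴬ
      N≤Lᴬ = equal-degree {Lᴬ} {N} {L} Lᴬ≤N N.upper (degree-upper {K} {Lᴬ} {L} K≤Lᴬ Lᴬ≤L deg) (ℕ.≤-antisym
        (IsMaximalGalois.maximum Lᴬ-maximalGalois N N.lower N.upper N.galois)
        (N.maximum Lᴬ K≤Lᴬ Lᴬ≤L (IsMaximalGalois.galois Lᴬ-maximalGalois)))

    l-Lₛ≡r-Lₛ : l K Lₛ ≡ r K Lₛ
    l-Lₛ≡r-Lₛ = ≡.trans (≡.cong (ℕ._* r K Lₛ) ([_∶_]-unique (trivial-degree {maximalSeparable K Lₛ} {Lₛ} M.upper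
        (M.greatest Lₛ Lₛ.lower (λ x∈ → x∈) Lₛ.separable))))
      (ℕ.*-identityˡ (r K Lₛ))
      where module M = IsMaximalSeparable (maximalSeparable-isMaximal {K} {Lₛ} Lₛ.lower)

    -- The count with base and separable part both `Lₛ`: only the inclusion is to be extended, and
    -- it extends uniquely to `L`.
    r*s-over-Lₛ : r Lₛ L ℕ.* s Lₛ L ≡ 1
    r*s-over-Lₛ = count {Lₛ} {Lₛ} {L} (λ x∈ → x∈) Lₛ.upper (trivial-degree {Lₛ} {Lₛ} (λ x∈ → x∈) (λ x∈ → x∈)) deg-L/Lₛ
      base-separable unique

    r-over-Lₛ : r Lₛ L ≡ 1
    r-over-Lₛ = ℕ.m*n≡1⇒m≡1 (r Lₛ L) (s Lₛ L) r*s-over-Lₛ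

    s-over-Lₛ : s Lₛ L ≡ 1
    s-over-Lₛ = ℕ.m*n≡1⇒n≡1 (r Lₛ L) (s Lₛ L) r*s-over-Lₛ

    l-over-Lₛ : l Lₛ L ≡ [ L ∶ Lₛ ]
    l-over-Lₛ = r*1≡r (l*s≡degree {Lₛ} {L} Lₛ.upper deg-L/Lₛ) s-over-Lₛ

    -- The image of `x` is a root of the same minimal polynomial over `K`, hence separable too.
    Lₛ-stable : (φ : Hom L) → Fixes K φ → (∀ {x} → x ∈ mem L → fun φ x ∈ mem L) →
                ∀ {x} → x ∈ mem Lₛ → fun φ x ∈ mem Lₛ
    Lₛ-stable φ fixed into x∈Lₛ = let (f , d , m , sqf) = Lₛ-separable x∈Lₛ in
      maximalSeparable-contains {K} {L} K≤L (into (Lₛ.upper x∈Lₛ))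
        (f , d , isMin-conjugate m (root-fixed {K} {L} K≤L φ fixed m (Lₛ.upper x∈Lₛ)) , sqf)

    r*s-Lₛ : r K Lₛ ℕ.* s K Lₛ ≡ [ Lₛ ∶ K ]
    r*s-Lₛ = separable-count {K} {Lₛ} Lₛ.lower deg-Lₛ/K Lₛ-separable

    -- Counting over the fixed field of Aut(Lₛ/K), which Aut(L/K) also fixes, gives r K Lₛ = r K L · s F′ L.
    r∣r-Lₛ : r K L ∣ r K Lₛ
    r∣r-Lₛ = divides (s F′ L) (≡.trans (≡.sym product) (≡.trans (ℕ.*-comm (r F′ L) (s F′ L)) (≡.cong (s F′ L ℕ.*_) same-group)))
      where
      F′ = fixedField K Lₛ
      K≤F′ : K ≤ F′
      K≤F′ = fixedField-lower Lₛ.lower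
      F′≤Lₛ : F′ ≤ Lₛ
      F′≤Lₛ = fixedField-upper Lₛ.lower
      F′≤L : F′ ≤ L
      F′≤L x∈F′ = Lₛ.upper (F′≤Lₛ x∈F′)
      product : r F′ L ℕ.* s F′ L ≡ r K Lₛ
      product = ≡.trans (count {F′} {Lₛ} {L} F′≤Lₛ Lₛ.upper (degree-upper {K} {F′} {Lₛ} K≤F′ F′≤Lₛ deg-Lₛ/K) deg-L/Lₛ
          (λ x∈Lₛ → separable-over {K} {F′} K≤F′ (Lₛ-separable x∈Lₛ)) unique)
        (≡.sym (r≡[L∶fixedField] {K} {Lₛ} Lₛ.lower deg-Lₛ/K))
      same-group : r F′ L ≡ r K L
      same-group = r-base-change {K} {F′} {L} K≤F′ F′≤L deg (λ σ (x∈Lₛ , fix) → fix (restricted σ))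
        where
        restricted : Iso K L L → Iso K Lₛ Lₛ
        restricted σ = stable⇒aut {K} {Lₛ} Lₛ.lower deg-Lₛ/K (restrict {Lₛ} {L} Lₛ.upper (iso⇒hom σ)) (iso-fixes σ K≤L)
          (Lₛ-stable (iso⇒hom σ) (iso-fixes σ K≤L) (iso-into σ))

    -- For `L` and for `Lₛ` the product of `r` and `s` is `[ Lₛ ∶ K ]`, so the factor gained by `r`
    -- is lost by `s`.
    s-Lₛ∣s : s K Lₛ ∣ s K L
    s-Lₛ∣s = quotient r∣r-Lₛ
      where
      quotient : r K L ∣ r K Lₛ → s K Lₛ ∣ s K L
      quotient (divides q r-Lₛ≡q*r) = divides q (ℕ.*-cancelˡ-≡ _ _ (r K L) {{r-nonZero}} (P.begin
        r K L ℕ.* s K L  P.≡⟨ r*s≡[Lₛ∶K] ⟩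
        [ Lₛ ∶ K ]  P.≡⟨ r*s-Lₛ ⟨
        r K Lₛ ℕ.* s K Lₛ P.≡⟨ ≡.cong (ℕ._* s K Lₛ) (≡.trans r-Lₛ≡q*r (ℕ.*-comm q (r K L))) ⟩
        r K L ℕ.* q ℕ.* s K Lₛ  P.≡⟨ ℕ.*-assoc (r K L) q (s K Lₛ) ⟩
        r K L ℕ.* (q ℕ.* s K Lₛ)  P.∎))
        where module P = ≡.≡-Reasoning

    module NormalExtension (normal : Normal K L) where

      stable : Stable K L
      stable = normal⇒stable {K} {L} K≤L normal

      s≡1 : s K L ≡ 1
      s≡1 = stable⇒s≡1 {K} {L} K≤L deg stable

      module _ {M} (K≤M : K ≤ M) (M≤L : M ≤ L) (φ : Hom M) (fixed : Fixes K φ) where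

        -- Normality of `L` speaks of embeddings of `L`; one of an intermediate field is controlled
        -- through an extension to `L`.
        extended : ∃[ ψ ] fun {L} ψ ≈[ M ] fun φ
        extended = extension-exists {M} {L} M≤L (degree-upper {K} {M} {L} K≤M M≤L deg) φ

        extended-fixed : Fixes K (proj₁ extended)
        extended-fixed x∈K = trans (proj₂ extended (K≤M x∈K)) (fixed x∈K)

      Lₛ-stable′ : Stable K Lₛ
      Lₛ-stable′ φ fixed x∈Lₛ = Subfield.resp Lₛ (proj₂ (extended Lₛ.lower Lₛ.upper φ fixed) x∈Lₛ)
        (Lₛ-stable (proj₁ (extended Lₛ.lower Lₛ.upper φ fixed)) (extended-fixed Lₛ.lower Lₛ.upper φ fixed)
          (stable (proj₁ (extended Lₛ.lower Lₛ.upper φ fixed)) (extended-fixed Lₛ.lower Lₛ.upper φ fixed)) x∈Lₛ)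

      s-Lₛ≡1 : s K Lₛ ≡ 1
      s-Lₛ≡1 = stable⇒s≡1 {K} {Lₛ} Lₛ.lower deg-Lₛ/K Lₛ-stable′

      -- An extension of `φ` to `L` is an automorphism, by stability, and automorphisms fix `Lᴬ`.
      Lᴬ-rigid : (φ : Hom Lᴬ) → Fixes K φ → Fixes Lᴬ φ
      Lᴬ-rigid φ fixed {x} x∈Lᴬ@(x∈L , fix) = trans (sym (proj₂ (extended K≤Lᴬ Lᴬ≤L φ fixed) x∈Lᴬ))
        (fix (stable⇒aut {K} {L} K≤L deg ψ ψ-fixed (stable ψ ψ-fixed)))
        where
        ψ = proj₁ (extended K≤Lᴬ Lᴬ≤L φ fixed)
        ψ-fixed : Fixes K ψ
        ψ-fixed = extended-fixed K≤Lᴬ Lᴬ≤L φ fixed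

      deg-Lᴬ/K : HasDegree K Lᴬ [ Lᴬ ∶ K ]
      deg-Lᴬ/K = degree-lower {K} {Lᴬ} {L} K≤Lᴬ Lᴬ≤L deg

      r-Lᴬ≡1 : r K Lᴬ ≡ 1
      r-Lᴬ≡1 = rigid⇒r≡1 {K} {Lᴬ} K≤Lᴬ (λ σ → Lᴬ-rigid (iso⇒hom σ) (iso-fixes σ K≤Lᴬ))

      s-Lᴬ≡1 : s K Lᴬ ≡ 1
      s-Lᴬ≡1 = stable⇒s≡1 {K} {Lᴬ} K≤Lᴬ deg-Lᴬ/K (λ φ fixed x∈Lᴬ → Subfield.resp Lᴬ (sym (Lᴬ-rigid φ fixed x∈Lᴬ)) x∈Lᴬ)

open import Data.Nat.Base using (_*_)
open import Data.Nat.Divisibility using (_∣_)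

proposition2p8 :
  ∀ {c ℓ₁ ℓ₂ : Level} (em : ∀ {a} → ExcludedMiddle a) (K̄ : HeytingField c ℓ₁ ℓ₂) →
  let open FieldTheory em K̄ in
  (K L : Subfield) → IsAlgebraicClosureOf K → IsFiniteExtension K L →
  let Lₛ = maximalSeparable K L
      Lᴬ = fixedField K L
  in
  -- (1)
  ( r K L ≡ [ L ∶ Lᴬ ]
  × IsMaximalGalois K L Lᴬ
  × (∀ N → IsMaximalGalois K L N → N ≣ Lᴬ) )
  ×
  -- (2)
  ( l K Lₛ ≡ r K Lₛ
  × r Lₛ L ≡ 1
  × s Lₛ L ≡ 1
  × l Lₛ L ≡ [ L ∶ Lₛ ] )
  ×
  -- (3)
  ( r K L * s K L ≡ [ Lₛ ∶ K ]
  × l K L * s K L ≡ [ L ∶ K ]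
  × [ Lᴬ ∶ K ] ≡ [ L ∶ Lₛ ] * s K L )
  ×
  -- (4)
  ( r K L ∣ r K Lₛ
  × s K Lₛ ∣ s K L )
  ×
  -- (5)
  ( Normal K L →
    -- (a)
    ( r K Lₛ ≡ [ Lₛ ∶ K ]
    × s K Lₛ ≡ 1 )
    ×
    -- (b)
    ( r K L ≡ r K Lₛ
    × l K L ≡ [ L ∶ K ]
    × s K L ≡ 1 )
    ×
    -- (c)
    ( r K Lᴬ ≡ 1
    × s K Lᴬ ≡ 1
    × l K Lᴬ ≡ [ Lᴬ ∶ K ] ) )
proposition2p8 em K̄ K L closure (K≤L , n , deg) =
  (r≡[L∶Lᴬ] , Lᴬ-maximalGalois , maximalGalois-unique) ,
  (l-Lₛ≡r-Lₛ , r-over-Lₛ , s-over-Lₛ , l-over-Lₛ) ,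
  (r*s≡[Lₛ∶K] , l*s≡[L∶K] , [Lᴬ∶K]≡[L∶Lₛ]*s) ,
  (r∣r-Lₛ , s-Lₛ∣s) ,
  λ normal → let open NormalExtension normal in
    (r*1≡r r*s-Lₛ s-Lₛ≡1 , s-Lₛ≡1) ,
    (≡.trans (r*1≡r r*s≡[Lₛ∶K] s≡1) (≡.sym (r*1≡r r*s-Lₛ s-Lₛ≡1)) , r*1≡r l*s≡[L∶K] s≡1 , s≡1) ,
    (r-Lᴬ≡1 , s-Lᴬ≡1 , r*1≡r (l*s≡degree {K} {fixedField K L} K≤Lᴬ deg-Lᴬ/K) s-Lᴬ≡1)
  where
  open FieldTheory em K̄
  open ClusterSizes em K̄ closure
  open Extension {K} {L} K≤L deg
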